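{- Every left flotilla $H$ satisfies the Erdős–Hajnal Conjecture: there exists $\epsilon(H)>0$ such that every $H$-free tournament $T$ with $n$ vertices contains a transitive subtournament with at least $n^{\epsilon(H)}$ vertices.
   Context: A tournament is a digraph in which for every pair of distinct vertices $u,v$ exactly one of the arcs $(u,v),(v,u)$ is present; it is transitive if it has no directed cycle. $T$ contains $H$ if $H$ is isomorphic to an induced subtournament of $T$; otherwise $T$ is $H$-free. For an ordering $\theta=(v_1,\dots,v_n)$ of $V(T)$, an arc $(v_i,v_j)$ is backward if $i>j$, and $B(T,\theta)$ is the undirected graph on $V(T)$ whose edges are the pairs joined by a backward arc. A left boat in $B(T,\theta)$ is a set $\{v_{i_1},v_{i_2},v_{i_3},v_{i_4}\}$ with $i_1<i_2<i_3<i_4$ and $i_3=i_2+1=i_1+2$ such that the subgraph of $B(T,\theta)$ induced on it has exactly the edges $v_{i_1}v_{i_3}$, $v_{i_1}v_{i_4}$, $v_{i_2}v_{i_4}$. A tournament $H$ is a left flotilla if there exists an ordering $\theta$ of $V(H)$ such that every connected component of $B(H,\theta)$ is a left boat. -}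

module Defs where

open import Data.Nat using (ℕ; zero; suc; _<_; _≤_; _^_)
open import Data.Fin using (Fin; toℕ; inject₁; fromℕ) renaming (zero to fzero; suc to fsuc)
open import Data.Bool using (Bool; true; false; not; _∧_; _∨_)
open import Data.Product using (Σ; _×_; ∃; ∃-syntax)
open import Data.Sum using (_⊎_)
open import Relation.Nullary using (¬_)
open import Relation.Binary.PropositionalEquality using (_≡_; _≢_)
open import Relation.Binary.Construct.Closure.ReflexiveTransitive using (Star)
open import Function.Definitions using (Injective; Bijective)
open import Function.Bundles using (_⇔_)

record Tournament (n : ℕ) : Set where
  field
    arc    : Fin n → Fin n → Bool
    irrefl : ∀ u → arc u u ≡ false
    tourn  : ∀ u v → u ≢ v → arc u v ≡ not (arc v u)
open Tournament public

Contains : ∀ {n h} → Tournament n → Tournament h → Set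
Contains {n} {h} T H =
  Σ (Fin h → Fin n) λ f → Injective _≡_ _≡_ f × (∀ u v → arc H u v ≡ arc T (f u) (f v))

DirectedCycle : ∀ {m} → (Fin m → Fin m → Bool) → Set
DirectedCycle {m} R =
  Σ ℕ λ k → Σ (Fin (suc k) → Fin m) λ c →
    Injective _≡_ _≡_ c
    × (∀ (i : Fin k) → R (c (inject₁ i)) (c (fsuc i)) ≡ true)
    × R (c (fromℕ k)) (c fzero) ≡ true

Acyclic : ∀ {m} → (Fin m → Fin m → Bool) → Set
Acyclic R = ¬ DirectedCycle R

HasTransitiveSub : ∀ {n} → Tournament n → ℕ → Set
HasTransitiveSub {n} T k =
  Σ (Fin k → Fin n) λ f → Injective _≡_ _≡_ f × Acyclic (λ u v → arc T (f u) (f v))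

-- Backward graph B(H, θ), on positions: θ i is the i-th vertex of the ordering.
-- Positions i, j are adjacent iff the arc between θ i and θ j goes from the later to the earlier position.
BEdge : ∀ {h} → Tournament h → (Fin h → Fin h) → Fin h → Fin h → Set
BEdge H θ i j = (toℕ j < toℕ i × arc H (θ i) (θ j) ≡ true)
              ⊎ (toℕ i < toℕ j × arc H (θ j) (θ i) ≡ true)

Connected : ∀ {h} → Tournament h → (Fin h → Fin h) → Fin h → Fin h → Set
Connected H θ = Star (BEdge H θ)

LeftBoat : ∀ {h} → Tournament h → (Fin h → Fin h) → Fin h → Fin h → Fin h → Fin h → Set
LeftBoat H θ p1 p2 p3 p4 =
  toℕ p2 ≡ suc (toℕ p1) × toℕ p3 ≡ suc (toℕ p2) × toℕ p3 < toℕ p4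
  × ¬ BEdge H θ p1 p2 × BEdge H θ p1 p3 × BEdge H θ p1 p4
  × ¬ BEdge H θ p2 p3 × BEdge H θ p2 p4 × ¬ BEdge H θ p3 p4

ComponentIsLeftBoat : ∀ {h} → Tournament h → (Fin h → Fin h) → Fin h → Set
ComponentIsLeftBoat {h} H θ x =
  Σ (Fin h) λ p1 → Σ (Fin h) λ p2 → Σ (Fin h) λ p3 → Σ (Fin h) λ p4 →
    LeftBoat H θ p1 p2 p3 p4
    × (∀ y → Connected H θ x y ⇔ (y ≡ p1 ⊎ y ≡ p2 ⊎ y ≡ p3 ⊎ y ≡ p4))

LeftFlotilla : ∀ {h} → Tournament h → Set
LeftFlotilla {h} H =
  Σ (Fin h → Fin h) λ θ → Bijective _≡_ _≡_ θ × (∀ x → ComponentIsLeftBoat H θ x)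

-- Erdős–Hajnal property with exponent ε = p / q (p, q > 0):
-- every H-free n-vertex tournament has a transitive subtournament on k vertices with k ≥ n^(p/q),
-- i.e. n^p ≤ k^q.
ErdosHajnal : ∀ {h} → Tournament h → Set
ErdosHajnal H =
  Σ ℕ λ p → Σ ℕ λ q → 0 < p × 0 < q ×
    (∀ n (T : Tournament n) → ¬ Contains T H →
      Σ ℕ λ k → HasTransitiveSub T k × n ^ p ≤ k ^ q)

module Submission where

-- Idea.  For a large integer q, prove the weighted statement: for every weight w there is a chain
-- (transitive set) I with Σ_V w^q ≤ (Σ_I w)^q; for w = 1 this is the conjecture with ε = 1/q.  In a
-- minimal counterexample a chain carrying more than 1/6 of the largest possible weight is never
-- complete to a set of non-negligible measure μ = w^q, since the weight of a chain of that set
-- found by minimality would add up to too much.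
--
-- H-freeness gives, by greedy embedding, two large sets with almost all arcs in one direction, and
-- by iteration a long sequence of layers with almost all arcs going forward.  The boats of H are
-- embedded one after the other, the triple of a boat into one layer P and its last vertex into a
-- later layer W, so it suffices to find a boat between two large sets P and W.  If there is none,
-- then for v ∈ W no vertex of P outside M(v) = { x ∈ P : v → x } is in a cyclic triangle with two
-- vertices of M(v); hence M(v) splits into modules of P, one complete to the next.  Contracting
-- modules and transferring to a representative the weight of a heaviest chain, one may assume that
-- all M(v) are chains.  They are light, so by double counting some heavy chain of P is missed by
-- most of W, hence complete to a large part of W: a contradiction.

open import Defs
open import Data.Nat
open import Data.Nat.Properties
open import Data.Nat.Tactic.RingSolver using (solve-∀)
open import Data.Bool using (Bool; true; false; not)
import Data.Bool.Properties as Bool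
open import Data.Fin using (Fin; toℕ; fromℕ; fromℕ<; inject₁) renaming (zero to fzero; suc to fsuc)
import Data.Fin.Properties as Fin
open import Data.Product using (Σ; ∃; _×_; _,_; proj₁; proj₂)
open import Data.Sum as Sum using (_⊎_; inj₁; inj₂)
open import Data.Empty using (⊥; ⊥-elim)
open import Data.List using (List; []; _∷_; _++_; length; lookup; take)
open import Data.List.Properties using (length-take)
open import Data.List.Relation.Unary.All as All using (All; []; _∷_)
import Data.List.Relation.Unary.All.Properties as All
open import Data.List.Relation.Unary.Any as Any using (here; there)
open import Data.List.Relation.Unary.AllPairs as AllPairs using (AllPairs; []; _∷_)
import Data.List.Relation.Unary.AllPairs.Properties as AllPairs
open import Data.List.Membership.Propositional using (find; lose) renaming (_∈_ to _∈ˡ_)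
import Data.List.Membership.Propositional.Properties as ∈ˡ
open import Relation.Nullary using (¬_; Dec; yes; no; does; contradiction)
open import Relation.Nullary.Decidable using (_×-dec_; _⊎-dec_; _→-dec_; ¬?; dec-true)
open import Relation.Binary.PropositionalEquality
open import Relation.Unary using (Decidable)
import Relation.Binary.Construct.Closure.ReflexiveTransitive as Star
open import Relation.Binary using (tri<; tri≈; tri>)
open import Function.Bundles using (Equivalence)

-- With `q = 5 * m`, `Q = 2 ^ m` and `M` the measure of the counterexample, negligible means of
-- measure below `M / Q`. A chain heavier than one sixth of the bound `α` leaves at most five sixths
-- of `α` to any chain of a set to which it is complete, and `Q` times the `q`-th power of 5/6 is at
-- most 1: hence the numbers 5 and 6. The constants of the embedding depend on `h` alone, so `m` can
-- be chosen afterwards to make `2 ^ m` exceed them.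
--
-- Weights are forced by the contraction. By minimality a module has a chain whose weight to the
-- power `q` is at least the measure of the module; one vertex of that weight replaces the module
-- without loss of measure, and chains of the quotient lift back. No class swallows `P`, because a
-- typical `v` of the later layer beats at most half of `P` and only sets beaten by a single `v` are
-- merged.
--
-- Everything is refuted rather than constructed, so minimality is available only under a double
-- negation. A finite search for a chain of prescribed length removes it at the very end.

-- Finite sums, subsets and weighted measures.

∑ : ∀ {n} → (Fin n → ℕ) → ℕ
∑ {zero}  f = 0
∑ {suc n} f = f fzero + ∑ (λ v → f (fsuc v))

∑-cong : ∀ {n} {f g : Fin n → ℕ} → (∀ v → f v ≡ g v) → ∑ f ≡ ∑ g
∑-cong {zero}  f≗g = refl
∑-cong {suc n} f≗g = cong₂ _+_ (f≗g fzero) (∑-cong (λ v → f≗g (fsuc v)))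

∑-mono : ∀ {n} {f g : Fin n → ℕ} → (∀ v → f v ≤ g v) → ∑ f ≤ ∑ g
∑-mono {zero}  f≤g = z≤n
∑-mono {suc n} f≤g = +-mono-≤ (f≤g fzero) (∑-mono (λ v → f≤g (fsuc v)))

∑-* : ∀ {n} c (f : Fin n → ℕ) → ∑ (λ v → c * f v) ≡ c * ∑ f
∑-* {zero}  c f = sym (*-zeroʳ c)
∑-* {suc n} c f = trans (cong (c * f fzero +_) (∑-* c (λ v → f (fsuc v)))) (sym (*-distribˡ-+ c (f fzero) (∑ λ v → f (fsuc v))))

∑-+ : ∀ {n} (f g : Fin n → ℕ) → ∑ (λ v → f v + g v) ≡ ∑ f + ∑ g
∑-+ {zero}  f g = refl
∑-+ {suc n} f g = trans (cong (f fzero + g fzero +_) (∑-+ (λ v → f (fsuc v)) (λ v → g (fsuc v)))) (interchange (f fzero) (g fzero) _ _)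
  where
  interchange : ∀ a b c d → a + b + (c + d) ≡ a + c + (b + d)
  interchange = solve-∀

∑-const : ∀ n c → ∑ {n} (λ _ → c) ≡ n * c
∑-const zero    c = refl
∑-const (suc n) c = cong (c +_) (∑-const n c)

∑-comm : ∀ {m n} (f : Fin m → Fin n → ℕ) → ∑ (λ u → ∑ (f u)) ≡ ∑ (λ v → ∑ λ u → f u v)
∑-comm {zero}  {n} f = sym (trans (∑-const n 0) (*-zeroʳ n))
∑-comm {suc m}     f = trans (cong (∑ (f fzero) +_) (∑-comm λ u → f (fsuc u))) (sym (∑-+ (f fzero) _))

∑-member : ∀ {n} (f : Fin n → ℕ) v → f v ≤ ∑ f
∑-member f fzero    = m≤m+n _ _
∑-member f (fsuc v) = ≤-trans (∑-member (λ u → f (fsuc u)) v) (m≤n+m _ _)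

Subset : ℕ → Set
Subset n = Fin n → Bool

infix 4 _∈_ _∉_ _∈?_
_∈_ _∉_ : ∀ {n} → Fin n → Subset n → Set
v ∈ Z = Z v ≡ true
v ∉ Z = ¬ v ∈ Z

_∈?_ : ∀ {n} (v : Fin n) (Z : Subset n) → Dec (v ∈ Z)
v ∈? Z = Z v Bool.≟ true

⟪_⟫ : ∀ {n} {P : Fin n → Set} → Decidable P → Subset n
⟪ P? ⟫ v = does (P? v)

∈⁺ : ∀ {n} {P : Fin n → Set} (P? : Decidable P) {v} → P v → v ∈ ⟪ P? ⟫
∈⁺ P? {v} = dec-true (P? v)

∈⁻ : ∀ {n} {P : Fin n → Set} (P? : Decidable P) {v} → v ∈ ⟪ P? ⟫ → P v
∈⁻ P? {v} v∈ with P? v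
... | yes p = p
... | no _ with () ← v∈

ι : Bool → ℕ
ι true  = 1
ι false = 0

ι-cover : ∀ a b c → (a ≡ true → b ≡ true ⊎ c ≡ true) → ι a ≤ ι b + ι c
ι-cover false b c _ = z≤n
ι-cover true b c h with h refl
... | inj₁ refl = m≤m+n _ _
... | inj₂ refl = m≤n+m _ _

wt : ∀ {n} → (Fin n → ℕ) → List (Fin n) → ℕ
wt w []       = 0
wt w (x ∷ xs) = w x + wt w xs

wt-++ : ∀ {n} (w : Fin n → ℕ) xs ys → wt w (xs ++ ys) ≡ wt w xs + wt w ys
wt-++ w []       ys = refl
wt-++ w (x ∷ xs) ys = trans (cong (w x +_) (wt-++ w xs ys)) (sym (+-assoc (w x) _ _))

abstract

  mass : ∀ {n} → (Fin n → ℕ) → Subset n → ℕ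
  mass w Z = ∑ λ v → ι (Z v) * w v

  card : ∀ {n} → Subset n → ℕ
  card = mass λ _ → 1

  mass-mono : ∀ {n} {w w′ : Fin n → ℕ} {Z Z′} → (∀ {v} → v ∈ Z → v ∈ Z′ × w v ≤ w′ v) → mass w Z ≤ mass w′ Z′
  mass-mono {w = w} {w′} {Z} {Z′} h = ∑-mono step
    where
    step : ∀ v → ι (Z v) * w v ≤ ι (Z′ v) * w′ v
    step v with Z v in eq
    ... | false = z≤n
    ... | true with p , q ← h eq rewrite p = *-monoʳ-≤ 1 q

  mass-cong : ∀ {n} {w w′ : Fin n → ℕ} {Z} → (∀ v → w v ≡ w′ v) → mass w Z ≡ mass w′ Z
  mass-cong {Z = Z} h = ∑-cong λ v → cong (ι (Z v) *_) (h v)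

  mass-⊆ : ∀ {n} {w : Fin n → ℕ} {Z Z′} → (∀ {v} → v ∈ Z → v ∈ Z′) → mass w Z ≤ mass w Z′
  mass-⊆ {w = w} {Z} {Z′} h = mass-mono {w = w} {w} {Z} {Z′} λ p → h p , ≤-refl

  mass-∪ : ∀ {n} {w : Fin n → ℕ} {Z A B} → (∀ {v} → v ∈ Z → v ∈ A ⊎ v ∈ B) → mass w Z ≤ mass w A + mass w B
  mass-∪ {w = w} {Z} {A} {B} h = begin
    mass w Z                                     ≤⟨ ∑-mono (λ v → *-monoˡ-≤ (w v) (ι-cover (Z v) (A v) (B v) h)) ⟩
    ∑ (λ v → (ι (A v) + ι (B v)) * w v)          ≡⟨ ∑-cong (λ v → *-distribʳ-+ (w v) (ι (A v)) (ι (B v))) ⟩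
    ∑ (λ v → ι (A v) * w v + ι (B v) * w v)      ≡⟨ ∑-+ (λ v → ι (A v) * w v) (λ v → ι (B v) * w v) ⟩
    mass w A + mass w B                          ∎
    where open ≤-Reasoning

  mass-⋃ : ∀ {n k} {w : Fin n → ℕ} {Z} (A : Fin k → Subset n) → (∀ {v} → v ∈ Z → ∃ λ j → v ∈ A j) →
           mass w Z ≤ ∑ λ j → mass w (A j)
  mass-⋃ {w = w} {Z} A h = begin
    mass w Z                                ≤⟨ ∑-mono step ⟩
    ∑ (λ v → ∑ λ j → ι (A j v) * w v)       ≡⟨ ∑-comm (λ v j → ι (A j v) * w v) ⟩
    ∑ (λ j → mass w (A j))                  ∎
    where
    open ≤-Reasoning
    step : ∀ v → ι (Z v) * w v ≤ ∑ λ j → ι (A j v) * w v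
    step v with Z v in eq
    ... | false = z≤n
    ... | true with j , p ← h eq = ≤-trans (≤-reflexive (cong (λ b → ι b * w v) (sym p))) (∑-member (λ j → ι (A j v) * w v) j)

  mass-* : ∀ {n} c (w : Fin n → ℕ) Z → mass (λ v → c * w v) Z ≡ c * mass w Z
  mass-* c w Z = trans (∑-cong λ v → swap (ι (Z v)) c (w v)) (∑-* c λ v → ι (Z v) * w v)
    where
    swap : ∀ a b c → a * (b * c) ≡ b * (a * c)
    swap = solve-∀

  mass-member : ∀ {n} {w : Fin n → ℕ} {Z v} → v ∈ Z → w v ≤ mass w Z
  mass-member {w = w} {Z} {v} v∈Z =
    ≤-trans (≤-reflexive (trans (sym (*-identityˡ (w v))) (cong (λ b → ι b * w v) (sym v∈Z)))) (∑-member (λ u → ι (Z u) * w u) v)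

  card-positive : ∀ {n} {Z : Subset n} {v} → v ∈ Z → 1 ≤ card Z
  card-positive {Z = Z} v∈Z = mass-member {w = λ _ → 1} {Z} v∈Z

  mass-full : ∀ n c → mass {n} (λ _ → c) (λ _ → true) ≡ n * c
  mass-full n c = trans (∑-cong {n} {λ _ → 1 * c} {λ _ → c} λ _ → *-identityˡ c) (∑-const n c)

  mass-fubini : ∀ {n} {w w′ : Fin n → ℕ} {A B} (g : Fin n → Fin n → ℕ) →
                mass (λ x → w x * mass (λ y → g x y * w′ y) B) A ≡ mass (λ y → w′ y * mass (λ x → g x y * w x) A) B
  mass-fubini {w = w} {w′} {A} {B} g = begin
    ∑ (λ x → ι (A x) * (w x * ∑ (λ y → ι (B y) * (g x y * w′ y))))     ≡⟨ ∑-cong (λ x → push (ι (A x)) (w x) (λ y → ι (B y) * (g x y * w′ y))) ⟩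
    ∑ (λ x → ∑ λ y → ι (A x) * (w x * (ι (B y) * (g x y * w′ y))))     ≡⟨ ∑-comm (λ x y → ι (A x) * (w x * (ι (B y) * (g x y * w′ y)))) ⟩
    ∑ (λ y → ∑ λ x → ι (A x) * (w x * (ι (B y) * (g x y * w′ y))))     ≡⟨ ∑-cong (λ y → ∑-cong λ x → swap (ι (A x)) (w x) (ι (B y)) (g x y) (w′ y)) ⟩
    ∑ (λ y → ∑ λ x → ι (B y) * (w′ y * (ι (A x) * (g x y * w x))))     ≡⟨ ∑-cong (λ y → sym (push (ι (B y)) (w′ y) (λ x → ι (A x) * (g x y * w x)))) ⟩
    ∑ (λ y → ι (B y) * (w′ y * ∑ (λ x → ι (A x) * (g x y * w x))))     ∎
    where
    open ≡-Reasoning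
    push : ∀ {n} a b (f : Fin n → ℕ) → a * (b * ∑ f) ≡ ∑ λ y → a * (b * f y)
    push a b f = sym (trans (∑-* a (λ y → b * f y)) (cong (a *_) (∑-* b f)))
    swap : ∀ a w b g u → a * (w * (b * (g * u))) ≡ b * (u * (a * (g * w)))
    swap = solve-∀

  mass-⟪⟫ : ∀ {n} {w : Fin n → ℕ} {A} {P : Fin n → Set} (P? : Decidable P) →
            mass w ⟪ (λ v → v ∈? A ×-dec P? v) ⟫ ≡ mass (λ v → ι (⟪ P? ⟫ v) * w v) A
  mass-⟪⟫ {w = w} {A} P? = ∑-cong step
    where
    step : ∀ v → ι (⟪ (λ v → v ∈? A ×-dec P? v) ⟫ v) * w v ≡ ι (A v) * (ι (⟪ P? ⟫ v) * w v)
    step v with A v | P? v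
    ... | true  | yes _ = solve₁ (w v) where
      solve₁ : ∀ a → 1 * a ≡ 1 * (1 * a)
      solve₁ = solve-∀
    ... | true  | no _  = refl
    ... | false | yes _ = refl
    ... | false | no _  = refl

  card-< : ∀ {n} {Z Z′ : Subset n} → (∀ {v} → v ∈ Z → v ∈ Z′) → (∃ λ v → v ∈ Z′ × v ∉ Z) → card Z < card Z′
  card-< {Z = Z} {Z′} sub (u , u∈ , u∉) = lemma Z Z′ sub u u∈ u∉
    where
    lemma : ∀ {n} (Z Z′ : Subset n) → (∀ {v} → v ∈ Z → v ∈ Z′) → ∀ u → u ∈ Z′ → u ∉ Z → card Z < card Z′
    lemma Z Z′ sub fzero u∈ u∉ with Z fzero
    ... | true  = contradiction refl u∉
    ... | false rewrite u∈ = s≤s (mass-⊆ {w = λ _ → 1} {λ v → Z (fsuc v)} {λ v → Z′ (fsuc v)} sub)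
    lemma Z Z′ sub (fsuc u) u∈ u∉ =
      +-mono-≤-< (*-monoˡ-≤ 1 (ι-cover′ (Z fzero) (Z′ fzero) sub)) (lemma (λ v → Z (fsuc v)) (λ v → Z′ (fsuc v)) sub u u∈ u∉)
      where
      ι-cover′ : ∀ a b → (a ≡ true → b ≡ true) → ι a ≤ ι b
      ι-cover′ false b _ = z≤n
      ι-cover′ true b h rewrite h refl = ≤-refl

  -- Vertices are taken in order until the target `s` is reached; the last one taken overshoots it
  -- by at most its own weight, hence by at most `A`.
  mass-split : ∀ {n} (w : Fin n → ℕ) (Z : Subset n) A s → (∀ {v} → v ∈ Z → w v ≤ A) → s ≤ mass w Z →
               Σ (Subset n) λ t → s ≤ mass w ⟪ (λ v → v ∈? Z ×-dec v ∈? t) ⟫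
                                × mass w ⟪ (λ v → v ∈? Z ×-dec v ∈? t) ⟫ ≤ s + A
  mass-split {n} w Z A s h s≤ = conclude (lemma (λ v → ι (Z v) * w v) A s bound s≤)
    where
    bound : ∀ v → ι (Z v) * w v ≤ A
    bound v with Z v in e
    ... | false = z≤n
    ... | true  = ≤-trans (≤-reflexive (*-identityˡ (w v))) (h e)
    Below : ∀ {n} → (Fin n → ℕ) → ℕ → ℕ → Set
    Below {n} f A s = Σ (Subset n) λ t → s ≤ ∑ (λ v → ι (t v) * f v) × ∑ (λ v → ι (t v) * f v) ≤ s + A
    none : ∀ {n} (f : Fin n → ℕ) → ∑ (λ v → ι false * f v) ≡ 0
    none {n} f = trans (∑-const n 0) (*-zeroʳ n)
    lemma : ∀ {n} (f : Fin n → ℕ) A s → (∀ v → f v ≤ A) → s ≤ ∑ f → Below f A s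
    extend : ∀ {n} (f : Fin (suc n) → ℕ) A s → (∀ v → f v ≤ A) → f fzero ≤ s → Below (λ v → f (fsuc v)) A (s ∸ f fzero) → Below f A s
    lemma {zero}  f A s h p = (λ ()) , p , z≤n
    lemma {suc n} f A s h p with ≤-total s (f fzero)
    ... | inj₁ q = (λ { fzero → true ; (fsuc _) → false })
                 , ≤-trans q (≤-reflexive (sym only))
                 , ≤-trans (≤-reflexive only) (≤-trans (h fzero) (m≤n+m A s))
      where
      only : 1 * f fzero + ∑ (λ v → ι false * f (fsuc v)) ≡ f fzero
      only = trans (cong₂ _+_ (*-identityˡ (f fzero)) (none λ v → f (fsuc v))) (+-identityʳ (f fzero))
    ... | inj₂ q = extend f A s h q (lemma (λ v → f (fsuc v)) A (s ∸ f fzero) (λ v → h (fsuc v))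
                     (≤-trans (∸-monoˡ-≤ (f fzero) p) (≤-reflexive (m+n∸m≡n (f fzero) _))))
    extend f A s h q (t , l , u) = (λ { fzero → true ; (fsuc v) → t v })
      , ≤-trans (≤-reflexive (sym (m+[n∸m]≡n q))) (+-mono-≤ (≤-reflexive (sym (*-identityˡ (f fzero)))) l)
      , ≤-trans (+-mono-≤ (≤-reflexive (*-identityˡ (f fzero))) u)
                (≤-reflexive (trans (sym (+-assoc (f fzero) _ A)) (cong (_+ A) (m+[n∸m]≡n q))))
    eq : ∀ t → ∑ (λ v → ι (t v) * (ι (Z v) * w v)) ≡ mass w ⟪ (λ v → v ∈? Z ×-dec v ∈? t) ⟫
    eq t = ∑-cong λ v → lem (t v) (Z v) (w v)
      where
      lem : ∀ a b c → ι a * (ι b * c) ≡ ι (does ((b Bool.≟ true) ×-dec (a Bool.≟ true))) * c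
      lem true  true  c = solve₁ c where
        solve₁ : ∀ a → 1 * (1 * a) ≡ 1 * a
        solve₁ = solve-∀
      lem true  false c = refl
      lem false true  c = refl
      lem false false c = refl
    conclude : Below (λ v → ι (Z v) * w v) A s →
               Σ (Subset n) λ t → s ≤ mass w ⟪ (λ v → v ∈? Z ×-dec v ∈? t) ⟫
                                × mass w ⟪ (λ v → v ∈? Z ×-dec v ∈? t) ⟫ ≤ s + A
    conclude (t , p , q) = t , subst (s ≤_) (eq t) p , subst (_≤ s + A) (eq t) q

  mass-⊎ : ∀ {n} {w : Fin n → ℕ} {Z A B} → (∀ {v} → v ∈ A → v ∈ Z) → (∀ {v} → v ∈ B → v ∈ Z) → (∀ {v} → v ∈ A → v ∉ B) →
           mass w A + mass w B ≤ mass w Z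
  mass-⊎ {w = w} {Z} {A} {B} A⊆Z B⊆Z disjoint = begin
    mass w A + mass w B                          ≡⟨ ∑-+ (λ v → ι (A v) * w v) (λ v → ι (B v) * w v) ⟨
    ∑ (λ v → ι (A v) * w v + ι (B v) * w v)      ≡⟨ ∑-cong (λ v → sym (*-distribʳ-+ (w v) (ι (A v)) (ι (B v)))) ⟩
    ∑ (λ v → (ι (A v) + ι (B v)) * w v)          ≤⟨ ∑-mono (λ v → *-monoˡ-≤ (w v) (packed (Z v) (A v) (B v) A⊆Z B⊆Z disjoint)) ⟩
    mass w Z                                     ∎
    where
    open ≤-Reasoning
    packed : ∀ z a b → (a ≡ true → z ≡ true) → (b ≡ true → z ≡ true) → (a ≡ true → ¬ b ≡ true) → ι a + ι b ≤ ι z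
    packed z false false _ _ _ = z≤n
    packed z true  true  _ _ d = contradiction refl (d refl)
    packed z true  false f _ _ rewrite f refl = ≤-refl
    packed z false true  _ g _ rewrite g refl = ≤-refl

  mass-remove : ∀ {n} (w : Fin n → ℕ) Z x → mass w Z ≤ w x + mass w ⟪ (λ v → v ∈? Z ×-dec ¬? (v Fin.≟ x)) ⟫
  mass-remove w Z x = ≤-trans (mass-∪ {A = ⟪ Fin._≟ x ⟫} cover) (+-monoˡ-≤ _ (single w x))
    where
    cover : ∀ {v} → v ∈ Z → v ∈ ⟪ Fin._≟ x ⟫ ⊎ v ∈ ⟪ (λ v → v ∈? Z ×-dec ¬? (v Fin.≟ x)) ⟫
    cover {v} p with v Fin.≟ x
    ... | yes _ = inj₁ refl
    ... | no _ rewrite p = inj₂ refl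
    single : ∀ {n} (w : Fin n → ℕ) x → mass w ⟪ Fin._≟ x ⟫ ≤ w x
    single {suc n} w fzero = ≤-reflexive (trans (cong₂ _+_ (*-identityˡ (w fzero)) (trans (∑-const n 0) (*-zeroʳ n))) (+-identityʳ (w fzero)))
    single w (fsuc x) = single (λ v → w (fsuc v)) x

  mass-covered : ∀ {n} (w : Fin n → ℕ) Z xs → (∀ {v} → v ∈ Z → v ∈ˡ xs) → mass w Z ≤ wt w xs
  mass-covered {n} w Z [] h = ≤-trans (∑-mono {n} {g = λ _ → 0} zero-at) (≤-reflexive (trans (∑-const n 0) (*-zeroʳ n)))
    where
    zero-at : ∀ v → ι (Z v) * w v ≤ 0
    zero-at v with Z v in eq
    ... | false = z≤n
    ... | true with () ← h eq
  mass-covered w Z (x ∷ xs) h = ≤-trans (mass-remove w Z x) (+-monoʳ-≤ (w x) (mass-covered w _ xs cover))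
    where
    cover : ∀ {v} → v ∈ ⟪ (λ v → v ∈? Z ×-dec ¬? (v Fin.≟ x)) ⟫ → v ∈ˡ xs
    cover {v} p with v∈Z , v≢x ← ∈⁻ (λ v → v ∈? Z ×-dec ¬? (v Fin.≟ x)) {v} p with h v∈Z
    ... | here q  = contradiction q v≢x
    ... | there q = q

mass-⋃ˡ : ∀ {n} {w : Fin n → ℕ} {Z} (A : Fin n → Subset n) xs → (∀ {v} → v ∈ Z → ∃ λ x → x ∈ˡ xs × v ∈ A x) →
          mass w Z ≤ wt (λ x → mass w (A x)) xs
mass-⋃ˡ {w = w} {Z} A [] h = mass-covered w Z [] λ v∈Z → contradiction (proj₁ (proj₂ (h v∈Z))) λ ()
mass-⋃ˡ {w = w} {Z} A (x ∷ xs) h =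
  ≤-trans (mass-∪ {A = A x} {Rest} (λ {v} → split {v})) (+-monoʳ-≤ _ (mass-⋃ˡ A xs (λ {v} p → h-rest {v} (∈⁻ Rest? {v} p))))
  where
  Rest? : Decidable λ v → v ∈ Z × ¬ v ∈ A x
  Rest? v = v ∈? Z ×-dec ¬? (v ∈? A x)
  Rest : Subset _
  Rest = ⟪ Rest? ⟫
  split : ∀ {v} → v ∈ Z → v ∈ A x ⊎ v ∈ Rest
  split {v} v∈Z = side (v ∈? A x)
    where
    side : Dec (v ∈ A x) → v ∈ A x ⊎ v ∈ Rest
    side (yes p) = inj₁ p
    side (no ¬p) = inj₂ (∈⁺ Rest? (v∈Z , ¬p))
  h-rest : ∀ {v} → v ∈ Z × ¬ v ∈ A x → ∃ λ y → y ∈ˡ xs × v ∈ A y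
  h-rest (v∈Z , v∉A) with h v∈Z
  ... | _ , here refl , v∈A = contradiction v∈A v∉A
  ... | y , there y∈  , v∈A = y , y∈ , v∈A

inhabited : ∀ {n} (w : Fin n → ℕ) Z → 0 < mass w Z → ∃ λ v → v ∈ Z
inhabited w Z pos with Fin.any? (_∈? Z)
... | yes p = p
... | no ¬p = contradiction (mass-covered w Z [] λ v∈Z → contradiction (_ , v∈Z) ¬p) (<⇒≱ pos)

-- Inequalities between powers.

power-superadd : ∀ a b q → a ^ suc q + b ^ suc q ≤ (a + b) ^ suc q
power-superadd a b q = begin
  a * a ^ q + b * b ^ q                   ≤⟨ +-mono-≤ (*-monoʳ-≤ a (^-monoˡ-≤ q (m≤m+n a b))) (*-monoʳ-≤ b (^-monoˡ-≤ q (m≤n+m b a))) ⟩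
  a * (a + b) ^ q + b * (a + b) ^ q       ≡⟨ *-distribʳ-+ ((a + b) ^ q) a b ⟨
  (a + b) ^ suc q                         ∎
  where open ≤-Reasoning

wt-power : ∀ {n} (w : Fin n → ℕ) q xs → wt (λ v → w v ^ suc q) xs ≤ wt w xs ^ suc q
wt-power w q []       = z≤n
wt-power w q (x ∷ xs) = ≤-trans (+-monoʳ-≤ _ (wt-power w q xs)) (power-superadd (w x) (wt w xs) q)

power-* : ∀ a b q → (a * b) ^ q ≡ a ^ q * b ^ q
power-* a b zero    = refl
power-* a b (suc q) = trans (cong (a * b *_) (power-* a b q)) (interchange a b (a ^ q) (b ^ q))
  where
  interchange : ∀ a b c d → a * b * (c * d) ≡ a * c * (b * d)
  interchange = solve-∀

-- 2 · 5⁵ ≤ 6⁵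
six-fifths : ∀ m → 2 ^ m * 5 ^ (5 * m) ≤ 6 ^ (5 * m)
six-fifths m = begin
  2 ^ m * 5 ^ (5 * m)     ≡⟨ cong (2 ^ m *_) (^-*-assoc 5 5 m) ⟨
  2 ^ m * (5 ^ 5) ^ m     ≡⟨ power-* 2 (5 ^ 5) m ⟨
  (2 * 5 ^ 5) ^ m         ≤⟨ ^-monoˡ-≤ m (≤ᵇ⇒≤ (2 * 5 ^ 5) (6 ^ 5) _) ⟩
  (6 ^ 5) ^ m             ≡⟨ ^-*-assoc 6 5 m ⟩
  6 ^ (5 * m)             ∎
  where open ≤-Reasoning

-- For exponent 2 this says `b ^ 2 ≤ 2 * x * b`; multiplying by `x + b` passes to the next exponent.
-- The factor 2 pays for keeping only the heavier neighbourhood of a vertex in `atom-light`.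
power-gap : ∀ x b q → b ≤ x → x ^ (2 + q) + 2 * b ^ (2 + q) ≤ (x + b) ^ (2 + q)
power-gap x b zero    b≤x = begin
  x ^ 2 + 2 * b ^ 2                 ≡⟨ shape x b ⟩
  x * x + b * b + b * b             ≤⟨ +-mono-≤ (+-monoʳ-≤ (x * x) (*-monoˡ-≤ b b≤x)) (≤-trans (*-monoˡ-≤ b b≤x) (m≤m+n (x * b) (b * b))) ⟩
  x * x + x * b + (x * b + b * b)   ≡⟨ square x b ⟩
  (x + b) ^ 2                       ∎
  where
  open ≤-Reasoning
  shape : ∀ x b → x * (x * 1) + 2 * (b * (b * 1)) ≡ x * x + b * b + b * b
  shape = solve-∀
  square : ∀ x b → x * x + x * b + (x * b + b * b) ≡ (x + b) * ((x + b) * 1)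
  square = solve-∀
power-gap x b (suc q) b≤x = begin
  x * x ^ (2 + q) + 2 * (b * b ^ (2 + q))                                               ≤⟨ m≤m+n _ (x * (2 * b ^ (2 + q)) + b * x ^ (2 + q)) ⟩
  x * x ^ (2 + q) + 2 * (b * b ^ (2 + q)) + (x * (2 * b ^ (2 + q)) + b * x ^ (2 + q))   ≡⟨ expand x b (x ^ (2 + q)) (b ^ (2 + q)) ⟩
  (x + b) * (x ^ (2 + q) + 2 * b ^ (2 + q))                                             ≤⟨ *-monoʳ-≤ (x + b) (power-gap x b q b≤x) ⟩
  (x + b) ^ (3 + q)                                                                     ∎
  where
  open ≤-Reasoning
  expand : ∀ x b c d → x * c + 2 * (b * d) + (x * (2 * d) + b * c) ≡ (x + b) * (c + 2 * d)
  expand = solve-∀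

-- Chains, and a minimal counterexample.

module Chains {n} (T : Tournament n) where

  infix 4 _⟶_ _⟶?_
  _⟶_ : Fin n → Fin n → Set
  x ⟶ y = arc T x y ≡ true

  _⟶?_ : ∀ x y → Dec (x ⟶ y)
  x ⟶? y = arc T x y Bool.≟ true

  ⟶-irrefl : ∀ {x} → ¬ x ⟶ x
  ⟶-irrefl {x} p with () ← trans (sym p) (irrefl T x)

  ⟶-≢ : ∀ {x y} → x ⟶ y → x ≢ y
  ⟶-≢ p refl = ⟶-irrefl p

  ⟶-asym : ∀ {x y} → x ⟶ y → ¬ y ⟶ x
  ⟶-asym {x} {y} p q with () ← trans (sym p) (trans (tourn T x y (⟶-≢ p)) (cong not q))

  ⟶-total : ∀ {x y} → x ≢ y → ¬ x ⟶ y → y ⟶ x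
  ⟶-total {x} {y} x≢y ¬p = trans (tourn T y x (λ e → x≢y (sym e))) (cong not (Bool.¬-not ¬p))

  Chain : List (Fin n) → Set
  Chain = AllPairs _⟶_

  Chain-++ : ∀ {xs ys} → Chain xs → Chain ys → (∀ {x y} → x ∈ˡ xs → y ∈ˡ ys → x ⟶ y) → Chain (xs ++ ys)
  Chain-++ cx cy h = AllPairs.++⁺ cx cy (All.tabulate λ x∈ → All.tabulate λ y∈ → h x∈ y∈)

  Chain-++⁻ˡ : ∀ xs {ys} → Chain (xs ++ ys) → Chain xs
  Chain-++⁻ˡ []       _       = []
  Chain-++⁻ˡ (x ∷ xs) (p ∷ c) = All.++⁻ˡ xs p ∷ Chain-++⁻ˡ xs c

  Chain-++⁻ʳ : ∀ xs {ys} → Chain (xs ++ ys) → Chain ys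
  Chain-++⁻ʳ []       c       = c
  Chain-++⁻ʳ (x ∷ xs) (_ ∷ c) = Chain-++⁻ʳ xs c

  ++-cross : ∀ xs {ys} → Chain (xs ++ ys) → ∀ {x y} → x ∈ˡ xs → y ∈ˡ ys → x ⟶ y
  ++-cross (x ∷ xs) (p ∷ _) (here refl) y∈ = All.lookup (All.++⁻ʳ xs p) y∈
  ++-cross (x ∷ xs) (_ ∷ c) (there x∈)  y∈ = ++-cross xs c x∈ y∈

  HasHeavyChain : ℕ → (Fin n → ℕ) → Subset n → Set
  HasHeavyChain q w Z = ∃ λ xs → Chain xs × All (_∈ Z) xs × mass (λ v → w v ^ q) Z ≤ wt w xs ^ q

-- `below` and `bounded` together say that `U` has no heavy chain for the weight `a`. `ih` speaks of
-- every smaller set with every weight, because contraction changes the weight.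
module Critical {n} (T : Tournament n) (m : ℕ) (1≤m : 1 ≤ m) (U : Subset n) (a : Fin n → ℕ) (α : ℕ)
  (ih : ∀ B w → card B < card U → ¬ ¬ Chains.HasHeavyChain T (5 * m) w B)
  (below : α ^ (5 * m) < mass (λ v → a v ^ (5 * m)) U)
  (bounded : ∀ xs → Chains.Chain T xs → All (_∈ U) xs → wt a xs ≤ α) where

  open Chains T

  q Q M : ℕ
  q = 5 * m
  Q = 2 ^ m
  M = mass (λ v → a v ^ q) U

  μ : Fin n → ℕ
  μ v = a v ^ q

  module _ (c : ℕ) (B : Subset n) (B<U : card B < card U) (M≤ : M ≤ Q * mass μ B) (α<6c : α < 6 * c)
           (additive : ∀ zs → Chain zs → All (_∈ B) zs → c + wt a zs ≤ α) where

    -- By minimality `B` has a chain of some weight `z` with `M ≤ Q * z ^ q`. As `c` exceeds a sixth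
    -- of `α` and `c + z ≤ α`, `z` is at most five sixths of `α`, and `six-fifths` then bounds
    -- `Q * z ^ q` by `α ^ q < M`.
    too-heavy : ⊥
    too-heavy = ih B a B<U λ (zs , cz , zs⊆B , heavy) → <-irrefl refl (begin-strict
      6 ^ q * M                        ≤⟨ *-monoʳ-≤ (6 ^ q) (≤-trans M≤ (*-monoʳ-≤ Q heavy)) ⟩
      6 ^ q * (Q * wt a zs ^ q)        ≡⟨ assoc (6 ^ q) Q _ ⟩
      Q * (6 ^ q * wt a zs ^ q)        ≡⟨ cong (Q *_) (power-* 6 (wt a zs) q) ⟨
      Q * (6 * wt a zs) ^ q            ≤⟨ *-monoʳ-≤ Q (^-monoˡ-≤ q (light (wt a zs) (additive zs cz zs⊆B))) ⟩
      Q * (5 * α) ^ q                  ≡⟨ cong (Q *_) (power-* 5 α q) ⟩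
      Q * (5 ^ q * α ^ q)              ≡⟨ *-assoc Q (5 ^ q) _ ⟨
      Q * 5 ^ q * α ^ q                ≤⟨ *-monoˡ-≤ (α ^ q) (six-fifths m) ⟩
      6 ^ q * α ^ q                    <⟨ *-monoʳ-< (6 ^ q) {{m^n≢0 6 q}} below ⟩
      6 ^ q * M                        ∎)
      where
      open ≤-Reasoning
      assoc : ∀ a b c → a * (b * c) ≡ b * (a * c)
      assoc = solve-∀
      light : ∀ z → c + z ≤ α → 6 * z ≤ 5 * α
      light z le = +-cancelˡ-≤ α _ _ (begin
        α + 6 * z         ≤⟨ +-monoˡ-≤ (6 * z) (<⇒≤ α<6c) ⟩
        6 * c + 6 * z     ≡⟨ *-distribˡ-+ 6 c z ⟨
        6 * (c + z)       ≤⟨ *-monoʳ-≤ 6 le ⟩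
        α + 5 * α         ∎)

  module _ (ys : List (Fin n)) (B : Subset n) (cy : Chain ys) (ys⊆U : All (_∈ U) ys) (B⊆U : ∀ {v} → v ∈ B → v ∈ U)
           (M≤ : M ≤ Q * mass μ B) (α<6ys : α < 6 * wt a ys) where

    private
      nonempty : ∀ zs → α < 6 * wt a zs → ∃ λ y → y ∈ˡ zs
      nonempty (y ∷ _) _ = y , here refl

      proper : (∀ {y} → y ∈ˡ ys → y ∉ B) → card B < card U
      proper h with y , y∈ ← nonempty ys α<6ys = card-< B⊆U (y , All.lookup ys⊆U y∈ , h y∈)

    -- A chain of `B` may be appended to `ys`, so the two weights add up to at most `α`. A vertex of
    -- `ys` witnesses that `B` is smaller than `U`.
    no-dominated : (∀ {y v} → y ∈ˡ ys → v ∈ B → y ⟶ v) → ⊥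
    no-dominated h = too-heavy (wt a ys) B (proper λ y∈ y∈B → ⟶-irrefl (h y∈ y∈B)) M≤ α<6ys λ zs cz zs⊆B →
      subst (_≤ α) (wt-++ a ys zs)
        (bounded (ys ++ zs) (Chain-++ cy cz λ y∈ z∈ → h y∈ (All.lookup zs⊆B z∈)) (All.++⁺ ys⊆U (All.map B⊆U zs⊆B)))

    no-dominating : (∀ {y v} → y ∈ˡ ys → v ∈ B → v ⟶ y) → ⊥
    no-dominating h = too-heavy (wt a ys) B (proper λ y∈ y∈B → ⟶-irrefl (h y∈ y∈B)) M≤ α<6ys λ zs cz zs⊆B →
      subst (_≤ α) (trans (wt-++ a zs ys) (+-comm (wt a zs) _))
        (bounded (zs ++ ys) (Chain-++ cz cy λ z∈ y∈ → h y∈ (All.lookup zs⊆B z∈)) (All.++⁺ (All.map B⊆U zs⊆B) ys⊆U))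

  private
    -- If `b ≤ x`, this is `power-gap`. Otherwise the left side is at most `3 * b ^ q`; as `x` is
    -- more than a sixth of the sum, `b` is less than five sixths of it, and the gain `Q ≥ 4`
    -- absorbs the 3.
    power-sum : ∀ x b → x + b < 6 * x → 2 ≤ m → x ^ q + 2 * b ^ q ≤ (x + b) ^ q
    power-sum x b x+b< 2≤m with ≤-total b x
    ... | inj₁ b≤x = subst (λ r → x ^ r + 2 * b ^ r ≤ (x + b) ^ r) (m+[n∸m]≡n (≤-trans 2≤m (m≤n*m m 5)))
                       (power-gap x b (q ∸ 2) b≤x)
    ... | inj₂ x≤b = *-cancelˡ-≤ (5 ^ q) {{m^n≢0 5 q}} (begin
      5 ^ q * (x ^ q + 2 * b ^ q)    ≤⟨ *-monoʳ-≤ (5 ^ q) (+-monoˡ-≤ _ (^-monoˡ-≤ q x≤b)) ⟩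
      5 ^ q * (3 * b ^ q)            ≤⟨ *-monoʳ-≤ (5 ^ q) (*-monoˡ-≤ (b ^ q) (≤-trans (n≤1+n 3) (^-monoʳ-≤ 2 2≤m))) ⟩
      5 ^ q * (Q * b ^ q)            ≡⟨ rearrange (5 ^ q) Q (b ^ q) ⟩
      Q * 5 ^ q * b ^ q              ≤⟨ *-monoˡ-≤ (b ^ q) (six-fifths m) ⟩
      6 ^ q * b ^ q                  ≡⟨ power-* 6 b q ⟨
      (6 * b) ^ q                    ≤⟨ ^-monoˡ-≤ q ratio ⟩
      (5 * (x + b)) ^ q              ≡⟨ power-* 5 (x + b) q ⟩
      5 ^ q * (x + b) ^ q            ∎)
      where
      open ≤-Reasoning
      rearrange : ∀ a b c → a * (b * c) ≡ b * a * c
      rearrange = solve-∀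
      expand : ∀ x b → x + 5 * (x + b) ≡ 6 * x + 5 * b
      expand = solve-∀
      ratio : 6 * b ≤ 5 * (x + b)
      ratio = +-cancelˡ-≤ x _ _ (begin
        x + 6 * b           ≡⟨ +-assoc x b (5 * b) ⟨
        x + b + 5 * b       ≤⟨ +-monoˡ-≤ (5 * b) (<⇒≤ x+b<) ⟩
        6 * x + 5 * b       ≡⟨ expand x b ⟨
        x + 5 * (x + b)     ∎)

  module _ (2≤m : 2 ≤ m) {v : Fin n} (v∈U : v ∈ U) where

    private
      In? : Decidable λ u → u ∈ U × u ⟶ v
      In? u = u ∈? U ×-dec u ⟶? v
      Out? : Decidable λ u → u ∈ U × v ⟶ u
      Out? u = u ∈? U ×-dec v ⟶? u

      M≤sides : M ≤ μ v + (mass μ ⟪ In? ⟫ + mass μ ⟪ Out? ⟫)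
      M≤sides = ≤-trans (mass-remove μ U v) (+-monoʳ-≤ (μ v) (mass-∪ λ {u} → cover {u}))
        where
        cover : ∀ {u} → u ∈ ⟪ (λ u → u ∈? U ×-dec ¬? (u Fin.≟ v)) ⟫ → u ∈ ⟪ In? ⟫ ⊎ u ∈ ⟪ Out? ⟫
        cover {u} p = side (∈⁻ (λ u → u ∈? U ×-dec ¬? (u Fin.≟ v)) {u} p) (u ⟶? v)
          where
          side : u ∈ U × u ≢ v → Dec (u ⟶ v) → u ∈ ⟪ In? ⟫ ⊎ u ∈ ⟪ Out? ⟫
          side (u∈U , _)   (yes u⟶v) = inj₁ (∈⁺ In? (u∈U , u⟶v))
          side (u∈U , u≢v) (no ¬u⟶v) = inj₂ (∈⁺ Out? (u∈U , ⟶-total u≢v ¬u⟶v))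

      side-bound : ∀ B → card B < card U → (∀ zs → Chain zs → All (_∈ B) zs → a v + wt a zs ≤ α) →
                   M ≤ μ v + 2 * mass μ B → α < 6 * a v → ⊥
      side-bound B B<U additive M≤ α<6a = ih B a B<U λ (zs , cz , zs⊆B , heavy) → <-irrefl refl (begin-strict
        α ^ q                          <⟨ below ⟩
        M                              ≤⟨ M≤ ⟩
        μ v + 2 * mass μ B             ≤⟨ +-monoʳ-≤ (μ v) (*-monoʳ-≤ 2 heavy) ⟩
        a v ^ q + 2 * wt a zs ^ q      ≤⟨ power-sum (a v) (wt a zs) (≤-<-trans (additive zs cz zs⊆B) α<6a) 2≤m ⟩
        (a v + wt a zs) ^ q            ≤⟨ ^-monoˡ-≤ q (additive zs cz zs⊆B) ⟩
        α ^ q                          ∎)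
        where open ≤-Reasoning

      twice : ∀ x y z → x ≤ y → z + (x + y) ≤ z + 2 * y
      twice x y z p = +-monoʳ-≤ z (≤-trans (+-monoˡ-≤ y p) (≤-reflexive (cong (y +_) (sym (+-identityʳ y)))))

    -- The other vertices of `U` lie before or after `v`, and the heavier side `B` satisfies
    -- `M ≤ μ v + 2 * mass μ B`. A chain of `B` stays a chain when `v` is added at the proper end,
    -- so with `a v` above a sixth of `α`, `power-sum` would give `M ≤ α ^ q`.
    atom-light : 6 * a v ≤ α
    atom-light = ≮⇒≥ λ α<6a → case-side α<6a (≤-total (mass μ ⟪ In? ⟫) (mass μ ⟪ Out? ⟫))
      where
      case-side : α < 6 * a v → _ ⊎ _ → ⊥
      case-side α<6a (inj₁ in≤out) = side-bound ⟪ Out? ⟫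
        (card-< (λ {u} p → proj₁ (∈⁻ Out? {u} p)) (v , v∈U , λ p → ⟶-irrefl (proj₂ (∈⁻ Out? {v} p))))
        (λ zs cz zs⊆ → bounded (v ∷ zs) (All.map (λ {u} p → proj₂ (∈⁻ Out? {u} p)) zs⊆ ∷ cz) (v∈U ∷ All.map (λ {u} p → proj₁ (∈⁻ Out? {u} p)) zs⊆))
        (≤-trans M≤sides (twice _ _ (μ v) in≤out)) α<6a
      case-side α<6a (inj₂ out≤in) = side-bound ⟪ In? ⟫
        (card-< (λ {u} p → proj₁ (∈⁻ In? {u} p)) (v , v∈U , λ p → ⟶-irrefl (proj₂ (∈⁻ In? {v} p))))
        (λ zs cz zs⊆ → subst (_≤ α) (trans (wt-++ a zs (v ∷ [])) (trans (+-comm (wt a zs) _) (cong (_+ wt a zs) (+-identityʳ (a v)))))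
           (bounded (zs ++ v ∷ []) (Chain-++ cz ([] ∷ []) λ { {z} z∈ (here refl) → proj₂ (∈⁻ In? {z} (All.lookup zs⊆ z∈)) })
              (All.++⁺ (All.map (λ {u} p → proj₁ (∈⁻ In? {u} p)) zs⊆) (v∈U ∷ []))))
        (≤-trans M≤sides (≤-trans (+-monoʳ-≤ (μ v) (≤-reflexive (+-comm (mass μ ⟪ In? ⟫) _))) (twice _ _ (μ v) out≤in))) α<6a

    -- Allows single vertices to be neglected: when sets are halved, in the greedy embedding, and as
    -- classes of the trivial contraction.
    atom-small : Q * μ v ≤ M
    atom-small = *-cancelˡ-≤ (5 ^ q) {{m^n≢0 5 q}} (begin
      5 ^ q * (Q * μ v)       ≡⟨ rearrange (5 ^ q) Q (μ v) ⟩
      Q * 5 ^ q * μ v         ≤⟨ *-monoˡ-≤ (μ v) (six-fifths m) ⟩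
      6 ^ q * a v ^ q         ≡⟨ power-* 6 (a v) q ⟨
      (6 * a v) ^ q           ≤⟨ ^-monoˡ-≤ q atom-light ⟩
      α ^ q                   ≤⟨ <⇒≤ below ⟩
      M                       ≤⟨ m≤n*m M (5 ^ q) {{m^n≢0 5 q}} ⟩
      5 ^ q * M               ∎)
      where
      open ≤-Reasoning
      rearrange : ∀ a b c → a * (b * c) ≡ b * a * c
      rearrange = solve-∀

-- A boat between two large sets.

module Boats {n} (T : Tournament n) (m : ℕ) (1≤m : 1 ≤ m) (U : Subset n) (a : Fin n → ℕ) (α : ℕ)
  (ih : ∀ B w → card B < card U → ¬ ¬ Chains.HasHeavyChain T (5 * m) w B)
  (below : α ^ (5 * m) < mass (λ v → a v ^ (5 * m)) U)
  (bounded : ∀ xs → Chains.Chain T xs → All (_∈ U) xs → wt a xs ≤ α)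
  (2≤m : 2 ≤ m) (P W : Subset n) (P⊆U : ∀ {v} → v ∈ P → v ∈ U) (W⊆U : ∀ {v} → v ∈ W → v ∈ U)
  (P∩W : ∀ {v} → v ∈ P → v ∈ W → ⊥)
  (bigP : 4 * mass (λ v → a v ^ (5 * m)) U ≤ 2 ^ m * mass (λ v → a v ^ (5 * m)) P)
  (bigW : 4 * mass (λ v → a v ^ (5 * m)) U ≤ 2 ^ m * mass (λ v → a v ^ (5 * m)) W) where

  open Chains T
  open Critical T m 1≤m U a α ih below bounded

  OutP? : ∀ v → Decidable λ x → x ∈ P × v ⟶ x
  OutP? v x = x ∈? P ×-dec v ⟶? x

  0<M : 0 < M
  0<M = ≤-<-trans z≤n below

  0<big : ∀ {Z} → 4 * M ≤ Q * mass μ Z → 0 < mass μ Z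
  0<big {Z} le = n≢0⇒n>0 λ eq → <⇒≱ (<-≤-trans 0<M (m≤n*m M 4)) (≤-trans le (≤-reflexive (trans (cong (Q *_) eq) (*-zeroʳ Q))))

  some-w : ∃ λ v → v ∈ W
  some-w = inhabited μ W (0<big bigW)

  -- `W` is inhabited and disjoint from `P`, so minimality applies to every subset of `P`, with any
  -- weight.
  P<U : ∀ {Z} → (∀ {v} → v ∈ Z → v ∈ P) → card Z < card U
  P<U Z⊆P = card-< (λ p → P⊆U (Z⊆P p)) (proj₁ some-w , W⊆U (proj₂ some-w) , λ p → P∩W (Z⊆P p) (proj₂ some-w))

  -- Outside `C` lies at least half of `P`, of measure at least `2 * M / Q`: too much for two
  -- negligible sets. This is where the factor 4 of `bigP` is used up.
  no-halves : ∀ {C B₁ B₂} → 2 * mass μ C ≤ mass μ P → (∀ {v} → v ∈ P → v ∈ C ⊎ (v ∈ B₁ ⊎ v ∈ B₂)) →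
              ¬ M ≤ Q * mass μ B₁ → ¬ M ≤ Q * mass μ B₂ → ⊥
  no-halves {C} {B₁} {B₂} half cover small₁ small₂ = arith (mass μ P) (mass μ C) (mass μ B₁) (mass μ B₂) half p≤ (≰⇒> small₁) (≰⇒> small₂) bigP
    where
    Rest? : Decidable λ v → v ∈ B₁ ⊎ v ∈ B₂
    Rest? v = v ∈? B₁ ⊎-dec v ∈? B₂
    p≤ : mass μ P ≤ mass μ C + (mass μ B₁ + mass μ B₂)
    p≤ = ≤-trans (mass-∪ {A = C} {⟪ Rest? ⟫} (λ {v} p → Sum.map₂ (∈⁺ Rest? {v}) (cover p))) (+-monoʳ-≤ (mass μ C) (mass-∪ {A = B₁} {B₂} λ {v} → ∈⁻ Rest? {v}))
    arith : ∀ p c b₁ b₂ → 2 * c ≤ p → p ≤ c + (b₁ + b₂) → Q * b₁ < M → Q * b₂ < M → 4 * M ≤ Q * p → ⊥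
    arith p c b₁ b₂ h₁ h₂ h₃ h₄ h₅ = <-irrefl refl (begin-strict
      4 * M                              ≤⟨ h₅ ⟩
      Q * p                              ≤⟨ *-monoʳ-≤ Q p≤2b ⟩
      Q * (2 * (b₁ + b₂))                ≡⟨ e₁ Q b₁ b₂ ⟩
      2 * (Q * b₁) + 2 * (Q * b₂)        <⟨ +-mono-<-≤ (*-monoʳ-< 2 h₃) (*-monoʳ-≤ 2 (<⇒≤ h₄)) ⟩
      2 * M + 2 * M                      ≡⟨ e₂ M ⟩
      4 * M                              ∎)
      where
      open ≤-Reasoning
      e₁ : ∀ q x y → q * (2 * (x + y)) ≡ 2 * (q * x) + 2 * (q * y)
      e₁ = solve-∀
      e₂ : ∀ x → 2 * x + 2 * x ≡ 4 * x
      e₂ = solve-∀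
      e₃ : ∀ p → p + p ≡ 2 * p
      e₃ = solve-∀
      p≤2b : p ≤ 2 * (b₁ + b₂)
      p≤2b = +-cancelˡ-≤ p _ _ (begin
        p + p                        ≡⟨ e₃ p ⟩
        2 * p                        ≤⟨ *-monoʳ-≤ 2 h₂ ⟩
        2 * (c + (b₁ + b₂))          ≡⟨ *-distribˡ-+ 2 c _ ⟩
        2 * c + 2 * (b₁ + b₂)        ≤⟨ +-monoˡ-≤ _ h₁ ⟩
        p + 2 * (b₁ + b₂)            ∎)

  -- A partition of P into modules (the fibres of κ) with representatives S, reweighted so that
  -- every chain of representatives lifts to a chain of P of at least the same weight.
  record Contraction : Set where
    field
      κ      : Fin n → Fin n
      S      : Subset n
      b      : Fin n → ℕ
      κ-S    : ∀ {x} → x ∈ P → κ x ∈ S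
      S⊆P    : ∀ {x} → x ∈ S → x ∈ P
      κ-rep  : ∀ {x} → x ∈ S → κ x ≡ x
      κ-arc  : ∀ {x y} → x ∈ P → y ∈ P → κ x ≢ κ y → x ⟶ y → κ x ⟶ κ y
      heavy  : mass μ P ≤ mass (λ x → b x ^ q) S
      lift   : ∀ {x} → x ∈ S → ∃ λ L → Chain L × All (λ z → z ∈ P × κ z ≡ x) L × b x ≤ wt a L
      half   : ∀ {x} → x ∈ S → 2 * mass μ ⟪ (λ z → z ∈? P ×-dec κ z Fin.≟ x) ⟫ ≤ mass μ P

    κ-arc⁻ : ∀ {x y} → x ∈ P → y ∈ P → κ x ⟶ κ y → x ⟶ y
    κ-arc⁻ {x} {y} x∈ y∈ h with x ⟶? y
    ... | yes p = p
    ... | no ¬p = contradiction (κ-arc y∈ x∈ (λ e → ⟶-≢ h (sym e)) (⟶-total (λ { refl → ⟶-irrefl h }) ¬p)) (⟶-asym h)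

    -- Arcs between different classes copy those between representatives, so the lifts of the
    -- vertices of `I`, concatenated in order, form a chain.
    lift-chain : ∀ {I} → Chain I → All (_∈ S) I → ∃ λ J → Chain J × All (λ z → z ∈ P × κ z ∈ˡ I) J × wt b I ≤ wt a J
    lift-chain {[]}    _        _          = [] , [] , [] , z≤n
    lift-chain {x ∷ I} (p ∷ cI) (x∈ ∷ I⊆S) with lift x∈ | lift-chain cI I⊆S
    ... | L , cL , hL , wL | J , cJ , hJ , wJ =
      L ++ J , Chain-++ cL cJ cross , All.++⁺ (All.map (λ (z∈ , e) → z∈ , here e) hL) (All.map (λ (z∈ , k) → z∈ , there k) hJ) ,
      ≤-trans (+-mono-≤ wL wJ) (≤-reflexive (sym (wt-++ a L J)))
      where
      cross : ∀ {y z} → y ∈ˡ L → z ∈ˡ J → y ⟶ z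
      cross {y} {z} y∈ z∈ with All.lookup hL y∈ | All.lookup hJ z∈
      ... | y∈P , refl | z∈P , k = κ-arc⁻ y∈P z∈P (All.lookup p k)

    -- Each vertex of `P` outside the class of `x` beats the whole class or is beaten by all of it.
    -- By `half` one of the two kinds is not negligible, so a chain lifted from `x` cannot weigh
    -- more than a sixth of `α`.
    light : ∀ {x} → x ∈ S → 6 * b x ≤ α
    light {x} x∈ with lift x∈
    ... | L , cL , hL , wL = ≤-trans (*-monoʳ-≤ 6 wL) (≮⇒≥ λ α<6L → no-halves (half x∈) (λ {z} → cover {z})
        (λ le → no-dominating L ⟪ In? ⟫ cL L⊆U (λ {z} p → P⊆U (proj₁ (∈⁻ In? {z} p))) le α<6L (λ {_} {z} l∈ z∈ → in-arc l∈ (∈⁻ In? {z} z∈)))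
        (λ le → no-dominated L ⟪ Out? ⟫ cL L⊆U (λ {z} p → P⊆U (proj₁ (∈⁻ Out? {z} p))) le α<6L (λ {_} {z} l∈ z∈ → out-arc l∈ (∈⁻ Out? {z} z∈))))
      where
      Class? : Decidable λ z → z ∈ P × κ z ≡ x
      Class? z = z ∈? P ×-dec κ z Fin.≟ x
      In? : Decidable λ z → z ∈ P × κ z ⟶ x
      In? z = z ∈? P ×-dec κ z ⟶? x
      Out? : Decidable λ z → z ∈ P × x ⟶ κ z
      Out? z = z ∈? P ×-dec x ⟶? κ z
      L⊆U : All (_∈ U) L
      L⊆U = All.map (λ (z∈ , _) → P⊆U z∈) hL
      in-arc : ∀ {l z} → l ∈ˡ L → z ∈ P × κ z ⟶ x → z ⟶ l
      in-arc l∈ (z∈P , h) with All.lookup hL l∈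
      ... | l∈P , refl = κ-arc⁻ z∈P l∈P h
      out-arc : ∀ {l z} → l ∈ˡ L → z ∈ P × x ⟶ κ z → l ⟶ z
      out-arc l∈ (z∈P , h) with All.lookup hL l∈
      ... | l∈P , refl = κ-arc⁻ l∈P z∈P h
      cover : ∀ {z} → z ∈ P → z ∈ ⟪ Class? ⟫ ⊎ (z ∈ ⟪ In? ⟫ ⊎ z ∈ ⟪ Out? ⟫)
      cover {z} z∈ = side (κ z Fin.≟ x) (κ z ⟶? x)
        where
        side : Dec (κ z ≡ x) → Dec (κ z ⟶ x) → z ∈ ⟪ Class? ⟫ ⊎ (z ∈ ⟪ In? ⟫ ⊎ z ∈ ⟪ Out? ⟫)
        side (yes e) _       = inj₁ (∈⁺ Class? (z∈ , e))
        side (no _)  (yes i) = inj₂ (inj₁ (∈⁺ In? (z∈ , i)))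
        side (no ¬e) (no ¬i) = inj₂ (inj₂ (∈⁺ Out? (z∈ , ⟶-total ¬e ¬i)))

    Meets? : ∀ v → Decidable λ x → x ∈ S × ∃ λ z → z ∈ P × κ z ≡ x × v ⟶ z
    Meets? v x = x ∈? S ×-dec Fin.any? λ z → z ∈? P ×-dec κ z Fin.≟ x ×-dec v ⟶? z

    -- The image in the quotient of the out-neighbourhood of `v`. A class may meet that
    -- neighbourhood and also escape from it; its representative can then serve in either role of a
    -- forbidden triangle.
    D : Fin n → Subset n
    D v = ⟪ Meets? v ⟫

    Escapes : Fin n → Fin n → Set
    Escapes v x = ∃ λ z → z ∈ P × κ z ≡ x × ¬ v ⟶ z

    escapes? : ∀ v x → Dec (Escapes v x)
    escapes? v x = Fin.any? λ z → z ∈? P ×-dec κ z Fin.≟ x ×-dec ¬? (v ⟶? z)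

    -- `homogeneous` in one direction suffices, since a missing arc is a reversed one. Two distinct
    -- members are recorded so that merging strictly decreases the number of representatives.
    record Module (v : Fin n) : Set where
      field
        E           : Subset n
        E⊆S         : ∀ {x} → x ∈ E → x ∈ S
        captured    : ∀ {x} → x ∈ E → ¬ Escapes v x
        x₀ x₁       : Fin n
        x₀∈E        : x₀ ∈ E
        x₁∈E        : x₁ ∈ E
        x₁≢x₀       : x₁ ≢ x₀
        homogeneous : ∀ {y x x′} → y ∈ S → y ∉ E → x ∈ E → x′ ∈ E → x ⟶ y → x′ ⟶ y

    module _ (v : Fin n) (triangle-free : ∀ {x₁ x₂ y} → x₁ ∈ D v → x₂ ∈ D v → y ∈ S → Escapes v y → x₁ ⟶ x₂ → x₂ ⟶ y → y ⟶ x₁ → ⊥)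
             (no-module : Module v → ⊥) where

      private
        -- The invariant of `listing`. It concerns every vertex outside the current piece, not only
        -- those outside `D v`, since any of them may split the piece further.
        Cut : Subset n → Set
        Cut E = ∀ {x₁ x₂ y} → x₁ ∈ E → x₂ ∈ E → y ∈ S → y ∉ E ⊎ Escapes v y → x₁ ⟶ x₂ → x₂ ⟶ y → y ⟶ x₁ → ⊥

        Listing : Subset n → Set
        Listing E = ∃ λ I → Chain I × All (_∈ E) I × (∀ {x} → x ∈ E → x ∈ˡ I)

        module Split (E : Subset n) (E⊆S : ∀ {x} → x ∈ E → x ∈ S) (cut : Cut E)
                     (y : Fin n) (y∈S : y ∈ S) (outer : y ∉ E ⊎ Escapes v y) where

          In? : Decidable λ x → x ∈ E × x ⟶ y
          In? x = x ∈? E ×-dec x ⟶? y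
          Out? : Decidable λ x → x ∈ E × y ⟶ x
          Out? x = x ∈? E ×-dec y ⟶? x

          -- Otherwise `x′ ⟶ x ⟶ y ⟶ x′` would be a triangle excluded by `cut`.
          cross : ∀ {x x′} → x ∈ E → x ⟶ y → x′ ∈ E → y ⟶ x′ → x ⟶ x′
          cross {x} {x′} x∈ i x′∈ o with x ⟶? x′
          ... | yes p = p
          ... | no ¬p = ⊥-elim (cut x′∈ x∈ y∈S outer (⟶-total (λ { refl → ⟶-asym i o }) ¬p) i o)

          -- The only new case is a `z` of `E` lost from the piece: it is `y` or lies in the other
          -- piece, and `x₁` beats both `y` and, by `cross`, the other piece, so `z ⟶ x₁` is
          -- impossible.
          cut-in : Cut ⟪ In? ⟫
          cut-in {x₁} {x₂} {z} p₁ p₂ z∈S out a₁ a₂ a₃ = by-cases (z ∈? E) out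
            where
            e₁ = ∈⁻ In? {x₁} p₁
            e₂ = ∈⁻ In? {x₂} p₂
            by-cases : Dec (z ∈ E) → z ∉ ⟪ In? ⟫ ⊎ Escapes v z → ⊥
            by-cases _        (inj₂ esc) = cut (proj₁ e₁) (proj₁ e₂) z∈S (inj₂ esc) a₁ a₂ a₃
            by-cases (no z∉)  _          = cut (proj₁ e₁) (proj₁ e₂) z∈S (inj₁ z∉) a₁ a₂ a₃
            by-cases (yes z∈) (inj₁ z∉In) = inner (z Fin.≟ y) (z ⟶? y)
              where
              inner : Dec (z ≡ y) → Dec (z ⟶ y) → ⊥
              inner (yes refl) _       = ⟶-asym (proj₂ e₁) a₃
              inner (no _)     (yes i) = z∉In (∈⁺ In? (z∈ , i))
              inner (no z≢y)   (no ¬i) = ⟶-asym (cross (proj₁ e₁) (proj₂ e₁) z∈ (⟶-total z≢y ¬i)) a₃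

          cut-out : Cut ⟪ Out? ⟫
          cut-out {x₁} {x₂} {z} p₁ p₂ z∈S out a₁ a₂ a₃ = by-cases (z ∈? E) out
            where
            e₁ = ∈⁻ Out? {x₁} p₁
            e₂ = ∈⁻ Out? {x₂} p₂
            by-cases : Dec (z ∈ E) → z ∉ ⟪ Out? ⟫ ⊎ Escapes v z → ⊥
            by-cases _        (inj₂ esc) = cut (proj₁ e₁) (proj₁ e₂) z∈S (inj₂ esc) a₁ a₂ a₃
            by-cases (no z∉)  _          = cut (proj₁ e₁) (proj₁ e₂) z∈S (inj₁ z∉) a₁ a₂ a₃
            by-cases (yes z∈) (inj₁ z∉Out) = inner (z Fin.≟ y) (y ⟶? z)
              where
              inner : Dec (z ≡ y) → Dec (y ⟶ z) → ⊥
              inner (yes refl) _       = ⟶-asym (proj₂ e₂) a₂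
              inner (no _)     (yes o) = z∉Out (∈⁺ Out? (z∈ , o))
              inner (no z≢y)   (no ¬o) = ⟶-asym a₂ (cross z∈ (⟶-total (λ e → z≢y (sym e)) ¬o) (proj₁ e₂) (proj₂ e₂))

          -- `mid` consists of the splitting vertex `y` if that lies in `E`, and is empty otherwise.
          combine : ∀ mid → Chain mid → (∀ {x} → x ∈ˡ mid → x ≡ y × x ∈ E) → (y ∈ E → y ∈ˡ mid) →
                    Listing ⟪ In? ⟫ → Listing ⟪ Out? ⟫ → Listing E
          combine mid cm only covered (I , cI , I⊆ , ⊆I) (O , cO , O⊆ , ⊆O) =
            I ++ mid ++ O ,
            Chain-++ cI (Chain-++ cm cO mid-out) in-rest ,
            All.++⁺ (All.map (λ {x} p → proj₁ (∈⁻ In? {x} p)) I⊆)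
              (All.++⁺ (All.tabulate λ p → proj₂ (only p)) (All.map (λ {x} p → proj₁ (∈⁻ Out? {x} p)) O⊆)) ,
            cover
            where
            in-elem : ∀ {x} → x ∈ˡ I → x ∈ E × x ⟶ y
            in-elem {x} p = ∈⁻ In? {x} (All.lookup I⊆ p)
            out-elem : ∀ {x} → x ∈ˡ O → x ∈ E × y ⟶ x
            out-elem {x} p = ∈⁻ Out? {x} (All.lookup O⊆ p)
            mid-out : ∀ {x x′} → x ∈ˡ mid → x′ ∈ˡ O → x ⟶ x′
            mid-out p p′ with refl , _ ← only p = proj₂ (out-elem p′)
            in-rest : ∀ {x x′} → x ∈ˡ I → x′ ∈ˡ mid ++ O → x ⟶ x′
            in-rest p p′ with ∈ˡ.∈-++⁻ mid p′
            ... | inj₁ r with refl , _ ← only r = proj₂ (in-elem p)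
            in-rest p p′ | inj₂ r = cross (proj₁ (in-elem p)) (proj₂ (in-elem p)) (proj₁ (out-elem r)) (proj₂ (out-elem r))
            cover : ∀ {x} → x ∈ E → x ∈ˡ I ++ mid ++ O
            cover {x} x∈ = place (x Fin.≟ y) (x ⟶? y)
              where
              place : Dec (x ≡ y) → Dec (x ⟶ y) → x ∈ˡ I ++ mid ++ O
              place (yes refl) _       = ∈ˡ.∈-++⁺ʳ I (∈ˡ.∈-++⁺ˡ (covered x∈))
              place (no _)     (yes i) = ∈ˡ.∈-++⁺ˡ (⊆I (∈⁺ In? (x∈ , i)))
              place (no x≢y)   (no ¬i) = ∈ˡ.∈-++⁺ʳ I (∈ˡ.∈-++⁺ʳ mid (⊆O (∈⁺ Out? (x∈ , ⟶-total x≢y ¬i))))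

        -- A vertex that is not homogeneous to E splits it into two smaller pieces, one complete to the
        -- other; a piece of size at least two that nothing splits is a module.
        listing : ∀ k E → (∀ {x} → x ∈ E → x ∈ S) → Cut E → card E ≤ k → Listing E
        listing k E E⊆S cut le with Fin.any? (_∈? E)
        ... | no ¬p = [] , [] , [] , λ x∈ → contradiction (_ , x∈) ¬p
        listing zero E E⊆S cut le | yes (x₀ , x₀∈) = contradiction (≤-trans (card-positive x₀∈) le) λ ()
        listing (suc k) E E⊆S cut le | yes (x₀ , x₀∈)
          with Fin.any? (λ x → x ∈? E ×-dec ¬? (x Fin.≟ x₀))
        ... | no ¬p = x₀ ∷ [] , [] ∷ [] , x₀∈ ∷ [] , cover
          where
          cover : ∀ {x} → x ∈ E → x ∈ˡ x₀ ∷ []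
          cover {x} x∈ with x Fin.≟ x₀
          ... | yes e = here e
          ... | no ¬e = contradiction (x , x∈ , ¬e) ¬p
        ... | yes (x₁ , x₁∈ , x₁≢x₀)
          with Fin.any? (λ y → y ∈? E ×-dec escapes? v y)
        ... | yes (y , y∈E , esc) = combine (y ∷ []) ([] ∷ []) (λ { (here refl) → refl , y∈E }) (λ _ → here refl)
              (listing k ⟪ In? ⟫ (λ {x} p → E⊆S (proj₁ (∈⁻ In? {x} p))) cut-in
                (s≤s⁻¹ (≤-trans (card-< (λ {x} p → proj₁ (∈⁻ In? {x} p)) (y , y∈E , λ p → ⟶-irrefl (proj₂ (∈⁻ In? {y} p)))) le)))
              (listing k ⟪ Out? ⟫ (λ {x} p → E⊆S (proj₁ (∈⁻ Out? {x} p))) cut-out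
                (s≤s⁻¹ (≤-trans (card-< (λ {x} p → proj₁ (∈⁻ Out? {x} p)) (y , y∈E , λ p → ⟶-irrefl (proj₂ (∈⁻ Out? {y} p)))) le)))
          where open Split E E⊆S cut y (E⊆S y∈E) (inj₂ esc)
        ... | no ¬esc
          with Fin.any? (λ y → y ∈? S ×-dec ¬? (y ∈? E) ×-dec Fin.any? (λ x → x ∈? E ×-dec x ⟶? y) ×-dec Fin.any? (λ x → x ∈? E ×-dec y ⟶? x))
        ... | yes (y , y∈S , y∉E , (x , x∈ , x⟶y) , (x′ , x′∈ , y⟶x′)) =
              combine [] [] (λ ()) (λ y∈E → contradiction y∈E y∉E)
              (listing k ⟪ In? ⟫ (λ {x} p → E⊆S (proj₁ (∈⁻ In? {x} p))) cut-in
                (s≤s⁻¹ (≤-trans (card-< (λ {x} p → proj₁ (∈⁻ In? {x} p)) (x′ , x′∈ , λ p → ⟶-asym y⟶x′ (proj₂ (∈⁻ In? {x′} p)))) le)))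
              (listing k ⟪ Out? ⟫ (λ {x} p → E⊆S (proj₁ (∈⁻ Out? {x} p))) cut-out
                (s≤s⁻¹ (≤-trans (card-< (λ {x} p → proj₁ (∈⁻ Out? {x} p)) (x , x∈ , λ p → ⟶-asym x⟶y (proj₂ (∈⁻ Out? {x} p)))) le)))
          where open Split E E⊆S cut y y∈S (inj₁ y∉E)
        ... | no ¬split = ⊥-elim (no-module record
          { E = E ; E⊆S = E⊆S ; captured = λ x∈ esc → ¬esc (_ , x∈ , esc)
          ; x₀ = x₀ ; x₁ = x₁ ; x₀∈E = x₀∈ ; x₁∈E = x₁∈ ; x₁≢x₀ = x₁≢x₀
          ; homogeneous = homogeneous })
          where
          homogeneous : ∀ {y x x′} → y ∈ S → y ∉ E → x ∈ E → x′ ∈ E → x ⟶ y → x′ ⟶ y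
          homogeneous {y} {x} {x′} y∈S y∉E x∈ x′∈ x⟶y with x′ ⟶? y
          ... | yes p = p
          ... | no ¬p = contradiction (y , y∈S , y∉E , (x , x∈ , x⟶y) , (x′ , x′∈ , ⟶-total (λ { refl → y∉E x′∈ }) ¬p)) ¬split

      D-listing : ∃ λ I → Chain I × All (_∈ D v) I × (∀ {x} → x ∈ D v → x ∈ˡ I)
      D-listing = listing (card (D v)) (D v) (λ {x} p → proj₁ (∈⁻ (Meets? v) {x} p)) cut ≤-refl
        where
        cut : Cut (D v)
        cut {y = y} p₁ p₂ y∈S (inj₂ esc) = triangle-free p₁ p₂ y∈S esc
        -- A representative outside `D v` is not beaten by `v`, so it is its own witness of escape.
        cut {y = y} p₁ p₂ y∈S (inj₁ y∉D) = triangle-free p₁ p₂ y∈S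
          (y , S⊆P y∈S , κ-rep y∈S , λ v⟶y → y∉D (∈⁺ (Meets? v) (y∈S , y , S⊆P y∈S , κ-rep y∈S , v⟶y)))

  module _ (c : Contraction) {v : Fin n} (v-few : 2 * mass μ ⟪ OutP? v ⟫ ≤ mass μ P) (mod : Contraction.Module c v) where

    open Contraction c
    open Module mod

    -- The classes of `E` are merged into that of `x₀`, whose new weight is that of a chain `I` of
    -- `E` which minimality makes heavy for `b`. Thus the measure does not drop, and the lifts of
    -- the members of `I` combine into a lift of `x₀`. The continuation is needed because `I` exists
    -- only under a double negation.
    contract : (∀ (c′ : Contraction) → card (Contraction.S c′) < card S → ⊥) → ⊥
    contract continue = ih E b (P<U λ x∈ → S⊆P (E⊆S x∈)) build
      where
      build : HasHeavyChain q b E → ⊥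
      build (I , cI , I⊆E , heavyI) = continue record
          { κ = κ′ ; S = S′ ; b = b′
          ; κ-S = κ-S′ ; S⊆P = λ {x} x∈ → S⊆P (proj₁ (∈⁻ S′? {x} x∈)) ; κ-rep = κ-rep′ ; κ-arc = κ-arc′
          ; heavy = heavy′ ; lift = lift′ ; half = half′ }
        (card-< (λ {x} x∈ → proj₁ (∈⁻ S′? {x} x∈)) (x₁ , E⊆S x₁∈E , λ p → x₁-gone (proj₂ (∈⁻ S′? {x₁} p))))
        where
        κ′ : Fin n → Fin n
        κ′ z with κ z ∈? E
        ... | yes _ = x₀
        ... | no _  = κ z

        κ′-cases : ∀ z → (κ z ∈ E × κ′ z ≡ x₀) ⊎ (κ z ∉ E × κ′ z ≡ κ z)
        κ′-cases z with κ z ∈? E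
        ... | yes p = inj₁ (p , refl)
        ... | no ¬p = inj₂ (¬p , refl)

        S′? : Decidable λ x → x ∈ S × (x ∉ E ⊎ x ≡ x₀)
        S′? x = x ∈? S ×-dec (¬? (x ∈? E) ⊎-dec x Fin.≟ x₀)
        S′ : Subset n
        S′ = ⟪ S′? ⟫

        b′ : Fin n → ℕ
        b′ x with x Fin.≟ x₀
        ... | yes _ = wt b I
        ... | no _  = b x

        b′-x₀ : b′ x₀ ≡ wt b I
        b′-x₀ with x₀ Fin.≟ x₀
        ... | yes _ = refl
        ... | no ¬e = contradiction refl ¬e

        b′-other : ∀ {x} → x ∉ E → b′ x ≡ b x
        b′-other {x} x∉E with x Fin.≟ x₀
        ... | yes refl = contradiction x₀∈E x∉E
        ... | no _     = refl

        x₁-gone : ¬ (x₁ ∉ E ⊎ x₁ ≡ x₀)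
        x₁-gone (inj₁ x₁∉E) = x₁∉E x₁∈E
        x₁-gone (inj₂ e)    = x₁≢x₀ e

        κ-S′ : ∀ {x} → x ∈ P → κ′ x ∈ S′
        κ-S′ {x} x∈ with κ′-cases x
        ... | inj₁ (_ , e)  rewrite e = ∈⁺ S′? (E⊆S x₀∈E , inj₂ refl)
        ... | inj₂ (∉E , e) rewrite e = ∈⁺ S′? (κ-S x∈ , inj₁ ∉E)

        κ-rep′ : ∀ {x} → x ∈ S′ → κ′ x ≡ x
        κ-rep′ {x} x∈ with ∈⁻ S′? {x} x∈ | κ′-cases x
        ... | x∈S , inj₁ x∉E  | inj₁ (κx∈E , _) = contradiction (subst (_∈ E) (κ-rep x∈S) κx∈E) x∉E
        ... | x∈S , inj₂ refl | inj₁ (_ , e)    = e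
        ... | x∈S , _         | inj₂ (_ , e)    = trans e (κ-rep x∈S)

        κ-arc′ : ∀ {x y} → x ∈ P → y ∈ P → κ′ x ≢ κ′ y → x ⟶ y → κ′ x ⟶ κ′ y
        κ-arc′ {x} {y} x∈ y∈ differ x⟶y with κ′-cases x | κ′-cases y
        ... | inj₁ (_ , e)  | inj₁ (_ , e′) = contradiction (trans e (sym e′)) differ
        ... | inj₂ (_ , e)  | inj₂ (_ , e′) rewrite e | e′ = κ-arc x∈ y∈ differ x⟶y
        ... | inj₁ (p , e)  | inj₂ (p′ , e′) rewrite e | e′ =
              homogeneous (κ-S y∈) p′ p x₀∈E (κ-arc x∈ y∈ (λ r → p′ (subst (_∈ E) r p)) x⟶y)
        ... | inj₂ (p , e)  | inj₁ (p′ , e′) rewrite e | e′ with κ x ⟶? x₀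
        ...   | yes r = r
        -- An arc from `x₀` to `κ x` would by homogeneity force one from `κ y` to `κ x`.
        ...   | no ¬r = contradiction (κ-arc x∈ y∈ (λ r → p (subst (_∈ E) (sym r) p′)) x⟶y)
                          (⟶-asym (homogeneous (κ-S x∈) p x₀∈E p′ (⟶-total differ ¬r)))

        Old? : Decidable λ x → x ∈ S × x ∉ E
        Old? x = x ∈? S ×-dec ¬? (x ∈? E)

        heavy′ : mass μ P ≤ mass (λ x → b′ x ^ q) S′
        heavy′ = begin
          mass μ P                                                                    ≤⟨ heavy ⟩
          mass (λ x → b x ^ q) S                                                      ≤⟨ mass-∪ {A = E} {⟪ Old? ⟫} (λ {x} → split {x}) ⟩
          mass (λ x → b x ^ q) E + mass (λ x → b x ^ q) ⟪ Old? ⟫                      ≤⟨ +-mono-≤ heavyI (mass-mono λ {x} p → p , ≤-reflexive (cong (_^ q) (sym (b′-other (proj₂ (∈⁻ Old? {x} p)))))) ⟩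
          wt b I ^ q + mass (λ x → b′ x ^ q) ⟪ Old? ⟫                                 ≡⟨ cong (λ r → r ^ q + mass (λ x → b′ x ^ q) ⟪ Old? ⟫) b′-x₀ ⟨
          b′ x₀ ^ q + mass (λ x → b′ x ^ q) ⟪ Old? ⟫                                  ≤⟨ +-monoˡ-≤ _ (mass-member {w = λ x → b′ x ^ q} {⟪ Fin._≟ x₀ ⟫} {x₀} (∈⁺ (Fin._≟ x₀) refl)) ⟩
          mass (λ x → b′ x ^ q) ⟪ Fin._≟ x₀ ⟫ + mass (λ x → b′ x ^ q) ⟪ Old? ⟫        ≤⟨ mass-⊎ (λ {x} → new {x}) (λ {x} → old {x}) (λ {x} → disjoint {x}) ⟩
          mass (λ x → b′ x ^ q) S′                                                    ∎
          where
          open ≤-Reasoning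
          split : ∀ {x} → x ∈ S → x ∈ E ⊎ x ∈ ⟪ Old? ⟫
          split {x} x∈ = side (x ∈? E)
            where
            side : Dec (x ∈ E) → x ∈ E ⊎ x ∈ ⟪ Old? ⟫
            side (yes p) = inj₁ p
            side (no ¬p) = inj₂ (∈⁺ Old? (x∈ , ¬p))
          new : ∀ {x} → x ∈ ⟪ Fin._≟ x₀ ⟫ → x ∈ S′
          new {x} p with refl ← ∈⁻ (Fin._≟ x₀) {x} p = ∈⁺ S′? (E⊆S x₀∈E , inj₂ refl)
          old : ∀ {x} → x ∈ ⟪ Old? ⟫ → x ∈ S′
          old {x} p = ∈⁺ S′? (proj₁ (∈⁻ Old? {x} p) , inj₁ (proj₂ (∈⁻ Old? {x} p)))
          disjoint : ∀ {x} → x ∈ ⟪ Fin._≟ x₀ ⟫ → x ∉ ⟪ Old? ⟫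
          disjoint {x} p p′ with refl ← ∈⁻ (Fin._≟ x₀) {x} p = proj₂ (∈⁻ Old? {x₀} p′) x₀∈E

        lift′ : ∀ {x} → x ∈ S′ → ∃ λ L → Chain L × All (λ z → z ∈ P × κ′ z ≡ x) L × b′ x ≤ wt a L
        lift′ {x} x∈ with ∈⁻ S′? {x} x∈
        ... | x∈S , inj₁ x∉E with L , cL , hL , wL ← lift x∈S =
              L , cL , All.map keep hL , subst (_≤ wt a L) (sym (b′-other x∉E)) wL
          where
          keep : ∀ {z} → z ∈ P × κ z ≡ x → z ∈ P × κ′ z ≡ x
          keep {z} (z∈ , e) with κ′-cases z
          ... | inj₁ (p , _) = contradiction (subst (_∈ E) e p) x∉E
          ... | inj₂ (_ , e′) = z∈ , trans e′ e
        ... | x∈S , inj₂ refl with J , cJ , hJ , wJ ← lift-chain cI (All.map E⊆S I⊆E) =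
              J , cJ , All.map merge hJ , subst (_≤ wt a J) (sym b′-x₀) wJ
          where
          merge : ∀ {z} → z ∈ P × κ z ∈ˡ I → z ∈ P × κ′ z ≡ x₀
          merge {z} (z∈ , k) with κ′-cases z
          ... | inj₁ (_ , e)  = z∈ , e
          ... | inj₂ (∉E , _) = contradiction (All.lookup I⊆E k) ∉E

        half′ : ∀ {x} → x ∈ S′ → 2 * mass μ ⟪ (λ z → z ∈? P ×-dec κ′ z Fin.≟ x) ⟫ ≤ mass μ P
        half′ {x} x∈ with ∈⁻ S′? {x} x∈
        ... | x∈S , inj₁ x∉E = ≤-trans (*-monoʳ-≤ 2 (mass-⊆ λ {z} p → ∈⁺ Class? (shrink (∈⁻ Class′? {z} p)))) (half x∈S)
          where
          Class? : Decidable λ z → z ∈ P × κ z ≡ x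
          Class? z = z ∈? P ×-dec κ z Fin.≟ x
          Class′? : Decidable λ z → z ∈ P × κ′ z ≡ x
          Class′? z = z ∈? P ×-dec κ′ z Fin.≟ x
          shrink : ∀ {z} → z ∈ P × κ′ z ≡ x → z ∈ P × κ z ≡ x
          shrink {z} (z∈ , e) with κ′-cases z
          ... | inj₁ (_ , e′) = contradiction (subst (_∈ E) (trans (sym e′) e) x₀∈E) x∉E
          ... | inj₂ (_ , e′) = z∈ , trans (sym e′) e
        -- All of `E` is captured, so the merged class lies in the out-neighbourhood of `v`, which
        -- has at most half of `P`.
        ... | x∈S , inj₂ refl = ≤-trans (*-monoʳ-≤ 2 (mass-⊆ λ {z} p → ∈⁺ (OutP? v) (seen (∈⁻ Class′? {z} p)))) v-few
          where
          Class′? : Decidable λ z → z ∈ P × κ′ z ≡ x₀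
          Class′? z = z ∈? P ×-dec κ′ z Fin.≟ x₀
          seen : ∀ {z} → z ∈ P × κ′ z ≡ x₀ → z ∈ P × v ⟶ z
          seen {z} (z∈ , e) with v ⟶? z
          ... | yes p = z∈ , p
          ... | no ¬p with κ′-cases z
          ...   | inj₁ (κz∈E , _) = contradiction (z , z∈ , refl , ¬p) (captured κz∈E)
          ...   | inj₂ (κz∉E , e′) = contradiction (subst (_∈ E) (trans (sym e) e′) x₀∈E) κz∉E

  private
    unfold : ∀ r x y → r + 6 * (x + y) ≡ r + 6 * x + 6 * y
    unfold = solve-∀

  -- `r` is six times the weight already passed. The prefix stops as soon as this exceeds `α`; the
  -- last vertex adds at most `α`, so at most `2 * α` is used and more than `α` is left for the
  -- suffix.
  split-chain : ∀ (b : Fin n → ℕ) I r → r ≤ α → All (λ x → 6 * b x ≤ α) I → 3 * α < r + 6 * wt b I →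
                ∃ λ us → ∃ λ zs → I ≡ us ++ zs × α < r + 6 * wt b us × α < 6 * wt b zs
  split-chain b [] r r≤α _ h =
    contradiction h (≤⇒≯ (≤-trans (≤-reflexive (+-identityʳ r)) (≤-trans r≤α (m≤n*m α 3))))
  split-chain b (x ∷ I) r r≤α (bx ∷ bI) h with r + 6 * b x ≤? α
  ... | yes under with us , zs , refl , hu , hz ← split-chain b I (r + 6 * b x) under bI (subst (3 * α <_) (unfold r (b x) (wt b I)) h) =
        x ∷ us , zs , refl , subst (α <_) (sym (unfold r (b x) (wt b us))) hu , hz
  ... | no ¬under = x ∷ [] , I , refl , subst (λ t → α < r + 6 * t) (sym (+-identityʳ (b x))) (≰⇒> ¬under) ,
        +-cancelˡ-< (2 * α) α _ (begin-strict
          2 * α + α                        ≡⟨ e₁ α ⟩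
          3 * α                            <⟨ h ⟩
          r + 6 * (b x + wt b I)           ≡⟨ unfold r (b x) (wt b I) ⟩
          r + 6 * b x + 6 * wt b I         ≤⟨ +-monoˡ-≤ (6 * wt b I) (≤-trans (+-mono-≤ r≤α bx) (≤-reflexive (e₃ α))) ⟩
          2 * α + 6 * wt b I               ∎)
    where
    open ≤-Reasoning
    e₁ : ∀ a → 2 * a + a ≡ 3 * a
    e₁ = solve-∀
    e₃ : ∀ a → a + a ≡ 2 * a
    e₃ = solve-∀

  module _ (few : ∀ {v} → v ∈ W → 2 * mass μ ⟪ OutP? v ⟫ ≤ mass μ P)
           (no-boat : ∀ {x₁ x₂ y v} → x₁ ∈ P → x₂ ∈ P → y ∈ P → v ∈ W →
                      v ⟶ x₁ → v ⟶ x₂ → y ⟶ v → x₁ ⟶ x₂ → x₂ ⟶ y → y ⟶ x₁ → ⊥) where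

    ¬out⇒in : ∀ {v z} → v ∈ W → z ∈ P → ¬ v ⟶ z → z ⟶ v
    ¬out⇒in v∈W z∈P = ⟶-total λ { refl → P∩W z∈P v∈W }

    module Terminal (c : Contraction) (no-module : ∀ {v} → v ∈ W → Contraction.Module c v → ⊥) where

      open Contraction c

      triangle-free : ∀ {v} → v ∈ W → ∀ {x₁ x₂ y} → x₁ ∈ D v → x₂ ∈ D v → y ∈ S → Escapes v y → x₁ ⟶ x₂ → x₂ ⟶ y → y ⟶ x₁ → ⊥
      triangle-free {v} v∈W {x₁} {x₂} {y} p₁ p₂ y∈S (z , z∈P , refl , ¬v⟶z) a₁₂ a₂y ay₁
        with ∈⁻ (Meets? v) {x₁} p₁ | ∈⁻ (Meets? v) {x₂} p₂
      ... | _ , z₁ , z₁∈P , refl , v⟶z₁ | _ , z₂ , z₂∈P , refl , v⟶z₂ =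
        no-boat z₁∈P z₂∈P z∈P v∈W v⟶z₁ v⟶z₂ (¬out⇒in v∈W z∈P ¬v⟶z) (κ-arc⁻ z₁∈P z₂∈P a₁₂) (κ-arc⁻ z₂∈P z∈P a₂y) (κ-arc⁻ z∈P z₁∈P ay₁)

      -- If `y` is in neither class, `κ j₁ ⟶ κ j₂ ⟶ κ y ⟶ κ j₁` is a forbidden triangle. If it
      -- shares the class of `j₁` it beats `j₂`, and if it shares that of `j₂` it is beaten by `j₁`.
      separated : ∀ {v} → v ∈ W → ∀ {us zs J₁ J₂ y} → Chain (us ++ zs) → All (_∈ D v) (us ++ zs) →
                  All (λ z → z ∈ P × κ z ∈ˡ us) J₁ → All (λ z → z ∈ P × κ z ∈ˡ zs) J₂ → y ∈ P → ¬ v ⟶ y →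
                  ∀ {j₁ j₂} → j₁ ∈ˡ J₁ → j₂ ∈ˡ J₂ → ¬ y ⟶ j₂ → ¬ j₁ ⟶ y → ⊥
      separated {v} v∈W {us} {zs} {y = y} cI I⊆D h₁ h₂ y∈P ¬v⟶y {j₁} {j₂} m₁ m₂ ¬y⟶j₂ ¬j₁⟶y
        with All.lookup h₁ m₁ | All.lookup h₂ m₂
      ... | j₁∈P , k₁ | j₂∈P , k₂ = go (κ y Fin.≟ κ j₁) (κ y Fin.≟ κ j₂)
        where
        x₁⟶x₂ : κ j₁ ⟶ κ j₂
        x₁⟶x₂ = ++-cross us cI k₁ k₂
        go : Dec (κ y ≡ κ j₁) → Dec (κ y ≡ κ j₂) → ⊥
        go (yes e) _       = ¬y⟶j₂ (κ-arc⁻ y∈P j₂∈P (subst (_⟶ κ j₂) (sym e) x₁⟶x₂))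
        go _       (yes e) = ¬j₁⟶y (κ-arc⁻ j₁∈P y∈P (subst (κ j₁ ⟶_) (sym e) x₁⟶x₂))
        go (no d₁) (no d₂) = triangle-free v∈W (All.lookup I⊆D (∈ˡ.∈-++⁺ˡ k₁)) (All.lookup I⊆D (∈ˡ.∈-++⁺ʳ us k₂)) (κ-S y∈P)
          (y , y∈P , refl , ¬v⟶y) x₁⟶x₂
          (κ-arc j₂∈P y∈P (λ e → d₂ (sym e)) (⟶-total (λ { refl → d₂ refl }) ¬y⟶j₂))
          (κ-arc y∈P j₁∈P d₁ (⟶-total (λ { refl → d₁ refl }) ¬j₁⟶y))

      -- A chain above half of `α` splits into two parts, each above a sixth. By `separated`, a
      -- vertex of `P` not beaten by `v` beats the whole lift of the later part or is beaten by the
      -- whole lift of the earlier one. These vertices make up at least half of `P`, so one of the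
      -- two kinds is not negligible.
      D-light : ∀ {v} → v ∈ W → ∀ {I} → Chain I → All (_∈ D v) I → 2 * wt b I ≤ α
      D-light {v} v∈W {I} cI I⊆D = ≮⇒≥ λ α<2I →
        heavy-halves cI I⊆D (split-chain b I 0 z≤n (All.map (λ {x} p → light (proj₁ (∈⁻ (Meets? v) {x} p))) I⊆D)
          (<-≤-trans (*-monoʳ-< 3 α<2I) (≤-reflexive (sym (*-assoc 3 2 (wt b I))))))
        where
        heavy-halves : ∀ {I} → Chain I → All (_∈ D v) I → (∃ λ us → ∃ λ zs → I ≡ us ++ zs × α < 6 * wt b us × α < 6 * wt b zs) → ⊥
        heavy-halves cI I⊆D (us , zs , refl , α<us , α<zs)
          with lift-chain (Chain-++⁻ˡ us cI) (All.map (λ {x} p → proj₁ (∈⁻ (Meets? v) {x} p)) (All.++⁻ˡ us I⊆D))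
             | lift-chain (Chain-++⁻ʳ us cI) (All.map (λ {x} p → proj₁ (∈⁻ (Meets? v) {x} p)) (All.++⁻ʳ us I⊆D))
        ... | J₁ , c₁ , h₁ , w₁ | J₂ , c₂ , h₂ , w₂ = no-halves (few v∈W) (λ {y} → cover {y})
            (λ le → no-dominating J₂ ⟪ B₁? ⟫ c₂ (All.map (λ (z∈ , _) → P⊆U z∈) h₂) (λ {y} p → P⊆U (proj₁ (∈⁻ B₁? {y} p))) le
                      (<-≤-trans α<zs (*-monoʳ-≤ 6 w₂)) (λ {_} {y} j∈ p → All.lookup (proj₂ (∈⁻ B₁? {y} p)) j∈))
            (λ le → no-dominated J₁ ⟪ B₂? ⟫ c₁ (All.map (λ (z∈ , _) → P⊆U z∈) h₁) (λ {y} p → P⊆U (proj₁ (∈⁻ B₂? {y} p))) le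
                      (<-≤-trans α<us (*-monoʳ-≤ 6 w₁)) (λ {_} {y} j∈ p → All.lookup (proj₂ (∈⁻ B₂? {y} p)) j∈))
          where
          B₁? : Decidable λ y → y ∈ P × All (y ⟶_) J₂
          B₁? y = y ∈? P ×-dec All.all? (y ⟶?_) J₂
          B₂? : Decidable λ y → y ∈ P × All (_⟶ y) J₁
          B₂? y = y ∈? P ×-dec All.all? (_⟶? y) J₁
          cover : ∀ {y} → y ∈ P → y ∈ ⟪ OutP? v ⟫ ⊎ (y ∈ ⟪ B₁? ⟫ ⊎ y ∈ ⟪ B₂? ⟫)
          cover {y} y∈ = side (v ⟶? y) (All.all? (y ⟶?_) J₂) (All.all? (_⟶? y) J₁)
            where
            side : Dec (v ⟶ y) → Dec (All (y ⟶_) J₂) → Dec (All (_⟶ y) J₁) → y ∈ ⟪ OutP? v ⟫ ⊎ (y ∈ ⟪ B₁? ⟫ ⊎ y ∈ ⟪ B₂? ⟫)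
            side (yes p) _ _ = inj₁ (∈⁺ (OutP? v) (y∈ , p))
            side _ (yes p) _ = inj₂ (inj₁ (∈⁺ B₁? (y∈ , p)))
            side _ _ (yes p) = inj₂ (inj₂ (∈⁺ B₂? (y∈ , p)))
            side (no ¬p) (no ¬q) (no ¬r)
              with find (All.¬All⇒Any¬ (y ⟶?_) J₂ ¬q) | find (All.¬All⇒Any¬ (_⟶? y) J₁ ¬r)
            ... | j₂ , m₂ , n₂ | j₁ , m₁ , n₁ = ⊥-elim (separated v∈W cI I⊆D h₁ h₂ y∈ ¬p m₁ m₂ n₂ n₁)

      private
        r mW : ℕ
        r  = suc (q ∸ 2)
        mW = mass μ W

        q≡ : q ≡ suc r
        q≡ = sym (m+[n∸m]≡n (≤-trans 2≤m (m≤n*m m 5)))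

        pow-q : ∀ x → x ^ q ≡ x * x ^ r
        pow-q x = cong (x ^_) q≡

        -- The gain of the double counting: the factor 1/2 of `D-light`, raised to the power
        -- `r = q - 1`, outweighs `4 * Q`.
        4Q≤2^r : 4 * Q ≤ 2 ^ r
        4Q≤2^r = ≤-trans (≤-reflexive (sym (^-distribˡ-+-* 2 2 m))) (^-monoʳ-≤ 2 (s≤s⁻¹ (begin
          3 + m              ≤⟨ +-monoˡ-≤ m (≤-trans (n≤1+n 3) (*-monoʳ-≤ 4 1≤m)) ⟩
          4 * m + m          ≡⟨ +-comm (4 * m) m ⟩
          q                  ≡⟨ q≡ ⟩
          suc r              ∎)))
          where open ≤-Reasoning

        hits : Fin n → ℕ
        hits x = mass (λ v → ι (does (x ∈? D v)) * μ v) W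

        -- The exponent is `q - 1`, not `q`: the factor `b x` left over is what the threshold in
        -- `Bad?` compares with `hits x`.
        inner : Fin n → ℕ
        inner v = mass (λ x → ι (does (x ∈? D v)) * b x ^ r) S

        -- `D v` is exhausted by one chain, so its sum of `r`-th powers is at most the `r`-th power
        -- of the weight of that chain, which is at most half of `α`.
        inner-small : ∀ {v} → v ∈ W → 2 ^ r * inner v ≤ α ^ r
        inner-small {v} v∈W with D-listing v (triangle-free v∈W) (no-module v∈W)
        ... | I , cI , I⊆D , D⊆I = begin
          2 ^ r * inner v                                                           ≡⟨ cong (2 ^ r *_) (mass-⟪⟫ {A = S} (_∈? D v)) ⟨
          2 ^ r * mass (λ x → b x ^ r) ⟪ (λ x → x ∈? S ×-dec x ∈? D v) ⟫            ≤⟨ *-monoʳ-≤ (2 ^ r) (mass-covered _ _ I (λ {x} p → D⊆I (proj₂ (∈⁻ (λ x → x ∈? S ×-dec x ∈? D v) {x} p)))) ⟩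
          2 ^ r * wt (λ x → b x ^ r) I                                              ≤⟨ *-monoʳ-≤ (2 ^ r) (wt-power b (q ∸ 2) I) ⟩
          2 ^ r * wt b I ^ r                                                        ≡⟨ power-* 2 (wt b I) r ⟨
          (2 * wt b I) ^ r                                                          ≤⟨ ^-monoˡ-≤ r (D-light v∈W cI I⊆D) ⟩
          α ^ r                                                                     ∎
          where open ≤-Reasoning

        hits-small : 2 ^ r * mass (λ x → b x ^ r * hits x) S ≤ α ^ r * mW
        hits-small = begin
          2 ^ r * mass (λ x → b x ^ r * hits x) S         ≡⟨ cong (2 ^ r *_) (mass-fubini {w = λ x → b x ^ r} {μ} {S} {W} (λ x v → ι (does (x ∈? D v)))) ⟩
          2 ^ r * mass (λ v → μ v * inner v) W            ≡⟨ mass-* (2 ^ r) (λ v → μ v * inner v) W ⟨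
          mass (λ v → 2 ^ r * (μ v * inner v)) W          ≤⟨ mass-mono (λ {v} p → p , bound {v} p) ⟩
          mass (λ v → α ^ r * μ v) W                      ≡⟨ mass-* (α ^ r) μ W ⟩
          α ^ r * mW                                      ∎
          where
          open ≤-Reasoning
          swap : ∀ a b c → a * (b * c) ≡ a * c * b
          swap = solve-∀
          bound : ∀ {v} → v ∈ W → 2 ^ r * (μ v * inner v) ≤ α ^ r * μ v
          bound {v} p = ≤-trans (≤-reflexive (swap (2 ^ r) (μ v) (inner v))) (*-monoˡ-≤ (μ v) (inner-small p))

        -- A good `x` is hit by at most the share `b x / (4 * α)` of `W`. Shares proportional to the
        -- weight add up along a chain, to at most a quarter, because a chain weighs at most `α`.
        Bad? : Decidable λ x → x ∈ S × b x * mW < 4 * α * hits x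
        Bad? x = x ∈? S ×-dec b x * mW <? 4 * α * hits x
        Good? : Decidable λ x → x ∈ S × 4 * α * hits x ≤ b x * mW
        Good? x = x ∈? S ×-dec 4 * α * hits x ≤? b x * mW

        bq : Fin n → ℕ
        bq x = b x ^ q

        -- On a bad vertex `b x ^ q = b x ^ r * b x` is less than `4 * α * b x ^ r * hits x` divided
        -- by `mW`. By `hits-small` the sum is at most `4 * α ^ q / 2 ^ r`, which `4Q≤2^r` and
        -- `below` make at most `M / Q`.
        bad-small : Q * mass bq ⟪ Bad? ⟫ ≤ M
        bad-small = *-cancelˡ-≤ 4 (*-cancelʳ-≤ _ _ mW {{>-nonZero (0<big bigW)}} (begin
          4 * (Q * mass bq ⟪ Bad? ⟫) * mW                                          ≡⟨ e₁ Q (mass bq ⟪ Bad? ⟫) mW ⟩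
          4 * Q * (mW * mass bq ⟪ Bad? ⟫)                                          ≤⟨ *-monoˡ-≤ _ 4Q≤2^r ⟩
          2 ^ r * (mW * mass bq ⟪ Bad? ⟫)                                          ≡⟨ cong (2 ^ r *_) (mass-* mW bq ⟪ Bad? ⟫) ⟨
          2 ^ r * mass (λ x → mW * bq x) ⟪ Bad? ⟫                                  ≤⟨ *-monoʳ-≤ (2 ^ r) (mass-mono {Z′ = S} (λ {x} p → proj₁ (∈⁻ Bad? {x} p) , bound {x} (<⇒≤ (proj₂ (∈⁻ Bad? {x} p))))) ⟩
          2 ^ r * mass (λ x → 4 * α * (b x ^ r * hits x)) S                        ≡⟨ cong (2 ^ r *_) (mass-* (4 * α) (λ x → b x ^ r * hits x) S) ⟩
          2 ^ r * (4 * α * mass (λ x → b x ^ r * hits x) S)                        ≡⟨ e₂ (2 ^ r) (4 * α) _ ⟩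
          4 * α * (2 ^ r * mass (λ x → b x ^ r * hits x) S)                        ≤⟨ *-monoʳ-≤ (4 * α) hits-small ⟩
          4 * α * (α ^ r * mW)                                                     ≡⟨ e₃ α (α ^ r) mW ⟩
          4 * (α * α ^ r) * mW                                                     ≡⟨ cong (λ t → 4 * t * mW) (pow-q α) ⟨
          4 * α ^ q * mW                                                           ≤⟨ *-monoˡ-≤ mW (*-monoʳ-≤ 4 (<⇒≤ below)) ⟩
          4 * M * mW                                                               ∎))
          where
          open ≤-Reasoning
          e₁ : ∀ q x w → 4 * (q * x) * w ≡ 4 * q * (w * x)
          e₁ = solve-∀
          e₂ : ∀ a b c → a * (b * c) ≡ b * (a * c)
          e₂ = solve-∀
          e₃ : ∀ a c w → 4 * a * (c * w) ≡ 4 * (a * c) * w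
          e₃ = solve-∀
          e₄ : ∀ w b c → w * (b * c) ≡ c * (b * w)
          e₄ = solve-∀
          bound : ∀ {x} → b x * mW ≤ 4 * α * hits x → mW * bq x ≤ 4 * α * (b x ^ r * hits x)
          bound {x} le = begin
            mW * bq x                           ≡⟨ cong (mW *_) (pow-q (b x)) ⟩
            mW * (b x * b x ^ r)                ≡⟨ e₄ mW (b x) (b x ^ r) ⟩
            b x ^ r * (b x * mW)                ≤⟨ *-monoʳ-≤ (b x ^ r) le ⟩
            b x ^ r * (4 * α * hits x)          ≡⟨ e₂ (b x ^ r) (4 * α) (hits x) ⟩
            4 * α * (b x ^ r * hits x)          ∎

        good-big : M ≤ Q * mass bq ⟪ Good? ⟫
        good-big = +-cancelˡ-≤ M _ _ (begin
          M + M                                                        ≤⟨ m≤m+n (M + M) (2 * M) ⟩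
          M + M + 2 * M                                                ≡⟨ e M ⟩
          4 * M                                                        ≤⟨ bigP ⟩
          Q * mass μ P                                                 ≤⟨ *-monoʳ-≤ Q (≤-trans heavy (mass-∪ {A = ⟪ Bad? ⟫} {⟪ Good? ⟫} (λ {x} → cover {x}))) ⟩
          Q * (mass bq ⟪ Bad? ⟫ + mass bq ⟪ Good? ⟫)                   ≡⟨ *-distribˡ-+ Q _ _ ⟩
          Q * mass bq ⟪ Bad? ⟫ + Q * mass bq ⟪ Good? ⟫                 ≤⟨ +-monoˡ-≤ _ bad-small ⟩
          M + Q * mass bq ⟪ Good? ⟫                                    ∎)
          where
          open ≤-Reasoning
          e : ∀ x → x + x + 2 * x ≡ 4 * x
          e = solve-∀
          cover : ∀ {x} → x ∈ S → x ∈ ⟪ Bad? ⟫ ⊎ x ∈ ⟪ Good? ⟫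
          cover {x} x∈ = side (4 * α * hits x ≤? b x * mW)
            where
            side : Dec (4 * α * hits x ≤ b x * mW) → x ∈ ⟪ Bad? ⟫ ⊎ x ∈ ⟪ Good? ⟫
            side (yes p) = inj₂ (∈⁺ Good? (x∈ , p))
            side (no ¬p) = inj₁ (∈⁺ Bad? (x∈ , ≰⇒> ¬p))

        Hit? : ∀ x → Decidable λ v → v ∈ W × x ∈ D v
        Hit? x v = v ∈? W ×-dec x ∈? D v

        few-hits : ∀ I → All (_∈ ⟪ Good? ⟫) I → 4 * α * wt (λ x → mass μ ⟪ Hit? x ⟫) I ≤ wt b I * mW
        few-hits []      _          = ≤-reflexive (*-zeroʳ (4 * α))
        few-hits (x ∷ I) (x∈ ∷ I∈) = begin
          4 * α * (mass μ ⟪ Hit? x ⟫ + wt (λ x → mass μ ⟪ Hit? x ⟫) I)                    ≡⟨ *-distribˡ-+ (4 * α) _ _ ⟩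
          4 * α * mass μ ⟪ Hit? x ⟫ + 4 * α * wt (λ x → mass μ ⟪ Hit? x ⟫) I              ≤⟨ +-mono-≤ (≤-trans (≤-reflexive (cong (4 * α *_) (mass-⟪⟫ {A = W} (λ v → x ∈? D v)))) (proj₂ (∈⁻ Good? {x} x∈))) (few-hits I I∈) ⟩
          b x * mW + wt b I * mW                                                          ≡⟨ *-distribʳ-+ mW (b x) _ ⟨
          wt b (x ∷ I) * mW                                                               ∎
          where open ≤-Reasoning

        good-chain : ∀ {z} → M ≤ Q * z ^ q → α < 6 * z
        good-chain {z} le = ≰⇒> λ 6z≤α → <-irrefl refl (begin-strict
          6 ^ q * M                 ≤⟨ *-monoʳ-≤ (6 ^ q) le ⟩
          6 ^ q * (Q * z ^ q)       ≡⟨ e (6 ^ q) Q (z ^ q) ⟩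
          Q * (6 ^ q * z ^ q)       ≡⟨ cong (Q *_) (power-* 6 z q) ⟨
          Q * (6 * z) ^ q           ≤⟨ *-monoʳ-≤ Q (^-monoˡ-≤ q 6z≤α) ⟩
          Q * α ^ q                 <⟨ *-monoʳ-< Q {{m^n≢0 2 m}} below ⟩
          Q * M                     ≤⟨ *-monoˡ-≤ M (≤-trans (m≤m*n Q (5 ^ q) {{m^n≢0 5 q}}) (six-fifths m)) ⟩
          6 ^ q * M                 ∎)
          where
          open ≤-Reasoning
          e : ∀ a b c → a * (b * c) ≡ b * (a * c)
          e = solve-∀

      -- The good vertices carry measure at least `M / Q`, so minimality gives them a chain above a
      -- sixth of `α`; let `J` be its lift. A vertex of `W` that beats some member of `J` hits the
      -- chain, and at most a quarter of `W` does so. `J` is complete to the other three quarters,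
      -- which are not negligible by `bigW`.
      contradictory : ⊥
      contradictory = ih ⟪ Good? ⟫ b (P<U λ {x} x∈ → S⊆P (proj₁ (∈⁻ Good? {x} x∈))) λ (I , cI , I⊆G , heavyI) →
        finish I cI I⊆G (≤-trans good-big (*-monoʳ-≤ Q heavyI))
        where
        finish : ∀ I → Chain I → All (_∈ ⟪ Good? ⟫) I → M ≤ Q * wt b I ^ q → ⊥
        finish I cI I⊆G hI with lift-chain cI (All.map (λ {x} x∈ → proj₁ (∈⁻ Good? {x} x∈)) I⊆G)
        ... | J , cJ , hJ , wJ = arith (mass μ ⟪ Seen? ⟫) (mass μ ⟪ Unseen? ⟫) seen-small (≰⇒> unseen-small) (mass-∪ λ {v} → cover {v})
          where
          open ≤-Reasoning
          Seen? : Decidable λ v → v ∈ W × ∃ λ x → x ∈ˡ I × x ∈ D v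
          Seen? v with v ∈? W
          ... | no ¬p = no λ p → ¬p (proj₁ p)
          ... | yes p with Any.any? (_∈? D v) I
          ...   | yes s = yes (p , find s)
          ...   | no ¬s = no λ (_ , _ , x∈I , x∈D) → ¬s (lose x∈I x∈D)
          Unseen? : Decidable λ v → v ∈ W × All (_⟶ v) J
          Unseen? v = v ∈? W ×-dec All.all? (_⟶? v) J

          J⊆U : All (_∈ U) J
          J⊆U = All.map (λ (z∈ , _) → P⊆U z∈) hJ
          α<6b : α < 6 * wt b I
          α<6b = good-chain {wt b I} hI
          b≤α : wt b I ≤ α
          b≤α = ≤-trans wJ (bounded J cJ J⊆U)
          0<α : 0 < α
          0<α = n≢0⇒n>0 λ α≡0 → <⇒≱ (≤-<-trans z≤n α<6b) (*-monoʳ-≤ 6 (≤-trans b≤α (≤-reflexive α≡0)))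

          unseen-small : ¬ M ≤ Q * mass μ ⟪ Unseen? ⟫
          unseen-small le = no-dominated J ⟪ Unseen? ⟫ cJ J⊆U (λ {v} p → W⊆U (proj₁ (∈⁻ Unseen? {v} p))) le
            (<-≤-trans α<6b (*-monoʳ-≤ 6 wJ)) (λ {_} {v} j∈ p → All.lookup (proj₂ (∈⁻ Unseen? {v} p)) j∈)

          cover : ∀ {v} → v ∈ W → v ∈ ⟪ Seen? ⟫ ⊎ v ∈ ⟪ Unseen? ⟫
          cover {v} v∈W = side (All.all? (_⟶? v) J)
            where
            side : Dec (All (_⟶ v) J) → v ∈ ⟪ Seen? ⟫ ⊎ v ∈ ⟪ Unseen? ⟫
            side (yes p) = inj₂ (∈⁺ Unseen? (v∈W , p))
            side (no ¬p) with find (All.¬All⇒Any¬ (_⟶? v) J ¬p)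
            ... | j , j∈ , ¬j⟶v with All.lookup hJ j∈
            ...   | j∈P , k = inj₁ (∈⁺ Seen? (v∈W , κ j , k , ∈⁺ (Meets? v)
                      (κ-S j∈P , j , j∈P , refl , ⟶-total (λ { refl → P∩W j∈P v∈W }) ¬j⟶v)))

          seen-small : 4 * mass μ ⟪ Seen? ⟫ ≤ mW
          seen-small = *-cancelˡ-≤ α {{>-nonZero 0<α}} (begin
            α * (4 * mass μ ⟪ Seen? ⟫)                          ≡⟨ e α (mass μ ⟪ Seen? ⟫) ⟩
            4 * α * mass μ ⟪ Seen? ⟫                            ≤⟨ *-monoʳ-≤ (4 * α) (mass-⋃ˡ (λ x → ⟪ Hit? x ⟫) I λ {v} p → hit {v} (∈⁻ Seen? {v} p)) ⟩
            4 * α * wt (λ x → mass μ ⟪ Hit? x ⟫) I              ≤⟨ few-hits I I⊆G ⟩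
            wt b I * mW                                         ≤⟨ *-monoˡ-≤ mW b≤α ⟩
            α * mW                                              ∎)
            where
            e : ∀ a x → a * (4 * x) ≡ 4 * a * x
            e = solve-∀
            hit : ∀ {v} → (v ∈ W × ∃ λ x → x ∈ˡ I × x ∈ D v) → ∃ λ x → x ∈ˡ I × v ∈ ⟪ Hit? x ⟫
            hit (v∈W , x , x∈I , x∈D) = x , x∈I , ∈⁺ (Hit? x) (v∈W , x∈D)

          arith : ∀ s u → 4 * s ≤ mW → Q * u < M → mW ≤ s + u → ⊥
          arith s u h₁ h₂ h₃ = <-irrefl refl (begin-strict
            Q * (4 * mW)                          ≤⟨ *-monoʳ-≤ Q (*-monoʳ-≤ 4 h₃) ⟩
            Q * (4 * (s + u))                     ≡⟨ e₁ Q s u ⟩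
            Q * (4 * s) + 4 * (Q * u)             <⟨ +-mono-≤-< (*-monoʳ-≤ Q h₁) (*-monoʳ-< 4 h₂) ⟩
            Q * mW + 4 * M                        ≤⟨ +-monoʳ-≤ (Q * mW) bigW ⟩
            Q * mW + Q * mW                       ≤⟨ m≤m+n _ (2 * (Q * mW)) ⟩
            Q * mW + Q * mW + 2 * (Q * mW)        ≡⟨ e₂ Q mW ⟩
            Q * (4 * mW)                          ∎)
            where
            e₁ : ∀ q s u → q * (4 * (s + u)) ≡ q * (4 * s) + 4 * (q * u)
            e₁ = solve-∀
            e₂ : ∀ q w → q * w + q * w + 2 * (q * w) ≡ q * (4 * w)
            e₂ = solve-∀

    -- Induction on the number of representatives: a module found for some vertex of `W` allows a
    -- further contraction, and without any module `Terminal` applies.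
    no-contraction : ∀ k (c : Contraction) → card (Contraction.S c) < k → ⊥
    no-contraction (suc k) c (s≤s le) = Terminal.contradictory c λ v∈W mod →
      contract c (few v∈W) mod λ c′ lt → no-contraction k c′ (<-≤-trans lt le)

    trivial : Contraction
    trivial = record
      { κ = λ x → x ; S = P ; b = a
      ; κ-S = λ p → p ; S⊆P = λ p → p ; κ-rep = λ _ → refl ; κ-arc = λ _ _ _ p → p
      ; heavy = ≤-refl
      ; lift = λ {x} x∈ → x ∷ [] , [] ∷ [] , (x∈ , refl) ∷ [] , m≤m+n (a x) 0
      ; half = half }
      where
      half : ∀ {x} → x ∈ P → 2 * mass μ ⟪ (λ z → z ∈? P ×-dec z Fin.≟ x) ⟫ ≤ mass μ P
      half {x} x∈ = *-cancelˡ-≤ Q {{m^n≢0 2 m}} (begin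
        Q * (2 * mass μ ⟪ Class? ⟫)       ≤⟨ *-monoʳ-≤ Q (*-monoʳ-≤ 2 (≤-trans (mass-covered μ ⟪ Class? ⟫ (x ∷ []) (λ {z} p → here (proj₂ (∈⁻ Class? {z} p)))) (≤-reflexive (+-identityʳ (μ x))))) ⟩
        Q * (2 * μ x)                     ≡⟨ e Q (μ x) ⟩
        2 * (Q * μ x)                     ≤⟨ *-monoʳ-≤ 2 (atom-small 2≤m (P⊆U x∈)) ⟩
        2 * M                             ≤⟨ *-monoˡ-≤ M (≤ᵇ⇒≤ 2 4 _) ⟩
        4 * M                             ≤⟨ bigP ⟩
        Q * mass μ P                      ∎)
        where
        open ≤-Reasoning
        Class? : Decidable λ z → z ∈ P × z ≡ x
        Class? z = z ∈? P ×-dec z Fin.≟ x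
        e : ∀ q x → q * (2 * x) ≡ 2 * (q * x)
        e = solve-∀

    boats-unavoidable : ⊥
    boats-unavoidable = no-contraction (suc (card P)) trivial ≤-refl

-- Sparse pairs by greedy embedding, and sequences of layers.

-- 16 is the product of the 2 in `wrong-side` and of the losses 2 and 4 in `Halves`; the successor
-- keeps the constant positive for `L = 0`.
shrinkage : ℕ → ℕ
shrinkage L = 16 * suc L

-- A candidate set shrinks by `shrinkage L` in each of at most `h` steps, and one more such factor
-- makes single vertices negligible. `suc h` comes from the pigeonhole over the vertices of `H`, and
-- 4 from `Halves`.
pairConst : ℕ → ℕ → ℕ
pairConst h L = 4 * suc h * shrinkage L ^ suc h

-- The first pair is requested with `L` multiplied by the constant of the remaining layers: passing
-- from `Y` to a layer inside `Y` can raise the density of backward arcs by that factor.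
layerConst : ℕ → ℕ → ℕ → ℕ
layerConst h L zero    = 1
layerConst h L (suc k) = pairConst h (L * layerConst h L k) * layerConst h L k

pairConst>0 : ∀ h L → NonZero (pairConst h L)
pairConst>0 h L = m*n≢0 (4 * suc h) (shrinkage L ^ suc h) {{_}} {{m^n≢0 (shrinkage L) (suc h)}}

layerConst>0 : ∀ h L k → NonZero (layerConst h L k)
layerConst>0 h L zero    = _
layerConst>0 h L (suc k) = m*n≢0 (pairConst h (L * layerConst h L k)) (layerConst h L k) {{pairConst>0 h (L * layerConst h L k)}} {{layerConst>0 h L k}}

module Densities {n} (T : Tournament n) (μ : Fin n → ℕ) where

  open Chains T

  mass₁ : Subset n → ℕ
  mass₁ = mass μ

  NonOut? : ∀ (Y : Subset n) x → Decidable λ y → y ∈ Y × ¬ x ⟶ y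
  NonOut? Y x y = y ∈? Y ×-dec ¬? (x ⟶? y)

  NonIn? : ∀ (X : Subset n) y → Decidable λ x → x ∈ X × ¬ x ⟶ y
  NonIn? X y x = x ∈? X ×-dec ¬? (x ⟶? y)

  -- The product measure of the pairs without a forward arc. A vertex common to `X` and `Y` counts
  -- against itself.
  back : Subset n → Subset n → ℕ
  back X Y = mass (λ x → μ x * mass₁ ⟪ NonOut? Y x ⟫) X

  back-swap : ∀ X Y → back X Y ≡ mass (λ y → μ y * mass₁ ⟪ NonIn? X y ⟫) Y
  back-swap X Y = begin
    back X Y                                                                    ≡⟨ mass-cong (λ x → cong (μ x *_) (mass-⟪⟫ {A = Y} (λ y → ¬? (x ⟶? y)))) ⟩
    mass (λ x → μ x * mass (λ y → ι (does (¬? (x ⟶? y))) * μ y) Y) X            ≡⟨ mass-fubini {w = μ} {μ} (λ x y → ι (does (¬? (x ⟶? y)))) ⟩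
    mass (λ y → μ y * mass (λ x → ι (does (¬? (x ⟶? y))) * μ x) X) Y            ≡⟨ mass-cong (λ y → cong (μ y *_) (mass-⟪⟫ {A = X} (λ x → ¬? (x ⟶? y)))) ⟨
    mass (λ y → μ y * mass₁ ⟪ NonIn? X y ⟫) Y                                   ∎
    where open ≡-Reasoning

  back-mono : ∀ {X X′ Y Y′} → (∀ {v} → v ∈ X → v ∈ X′) → (∀ {v} → v ∈ Y → v ∈ Y′) → back X Y ≤ back X′ Y′
  back-mono {Y = Y} {Y′} X⊆ Y⊆ = mass-mono λ {x} p → X⊆ p , *-monoʳ-≤ (μ x)
    (mass-⊆ λ {y} p′ → let y∈ , ¬a = ∈⁻ (NonOut? Y x) {y} p′ in ∈⁺ (NonOut? Y′ x) (Y⊆ y∈ , ¬a))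

  private
    average : ∀ c d (g : Fin n → ℕ) X → (∀ {x} → x ∈ X → c * g x ≤ d) → c * mass (λ x → μ x * g x) X ≤ d * mass₁ X
    average c d g X h = begin
      c * mass (λ x → μ x * g x) X         ≡⟨ mass-* c (λ x → μ x * g x) X ⟨
      mass (λ x → c * (μ x * g x)) X       ≤⟨ mass-mono (λ {x} p → p , ≤-trans (≤-reflexive (swap c (μ x) (g x))) (*-monoˡ-≤ (μ x) (h p))) ⟩
      mass (λ x → d * μ x) X               ≡⟨ mass-* d μ X ⟩
      d * mass₁ X                          ∎
      where
      open ≤-Reasoning
      swap : ∀ a b c → a * (b * c) ≡ a * c * b
      swap = solve-∀

  back-≤ˡ : ∀ c d X Y → (∀ {x} → x ∈ X → c * mass₁ ⟪ NonOut? Y x ⟫ ≤ d) → c * back X Y ≤ d * mass₁ X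
  back-≤ˡ c d X Y = average c d (λ x → mass₁ ⟪ NonOut? Y x ⟫) X

  back-≤ʳ : ∀ c d X Y → (∀ {y} → y ∈ Y → c * mass₁ ⟪ NonIn? X y ⟫ ≤ d) → c * back X Y ≤ d * mass₁ Y
  back-≤ʳ c d X Y h = subst (λ t → c * t ≤ d * mass₁ Y) (sym (back-swap X Y)) (average c d (λ y → mass₁ ⟪ NonIn? X y ⟫) Y h)

  record Halves (X Y : Subset n) : Set where
    field
      X′ Y′    : Subset n
      X′⊆X     : ∀ {v} → v ∈ X′ → v ∈ X
      Y′⊆Y     : ∀ {v} → v ∈ Y′ → v ∈ Y
      disjoint : ∀ {v} → v ∈ X′ → v ∈ Y′ → ⊥
      half     : mass₁ X ≤ 2 * mass₁ X′
      quarter  : mass₁ Y ≤ 4 * mass₁ Y′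

  -- `mass-split` for the weight `4 * μ` gives a set `t` with between a quarter and a half of `Y`,
  -- so that both parts of `Y` keep a quarter. `X′` is the heavier part of `X` with respect to `t`,
  -- and `Y′` is the part of `Y` on the opposite side.
  halves : ∀ X Y → (∀ {y} → y ∈ Y → 4 * μ y ≤ mass₁ Y) → Halves X Y
  halves X Y atoms = build (mass-split (λ v → 4 * μ v) Y (mass₁ Y) (mass₁ Y) atoms (≤-trans (m≤n*m (mass₁ Y) 4) (≤-reflexive (sym (mass-* 4 μ Y)))))
    where
    open ≤-Reasoning
    In? : ∀ (Z t : Subset n) → Decidable λ v → v ∈ Z × v ∈ t
    In? Z t v = v ∈? Z ×-dec v ∈? t
    Out? : ∀ (Z t : Subset n) → Decidable λ v → v ∈ Z × v ∉ t
    Out? Z t v = v ∈? Z ×-dec ¬? (v ∈? t)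
    parts : ∀ Z t → mass₁ Z ≤ mass₁ ⟪ In? Z t ⟫ + mass₁ ⟪ Out? Z t ⟫
    parts Z t = mass-∪ λ {v} → cover {v}
      where
      cover : ∀ {v} → v ∈ Z → v ∈ ⟪ In? Z t ⟫ ⊎ v ∈ ⟪ Out? Z t ⟫
      cover {v} v∈ = side (v ∈? t)
        where
        side : Dec (v ∈ t) → v ∈ ⟪ In? Z t ⟫ ⊎ v ∈ ⟪ Out? Z t ⟫
        side (yes p) = inj₁ (∈⁺ (In? Z t) (v∈ , p))
        side (no ¬p) = inj₂ (∈⁺ (Out? Z t) (v∈ , ¬p))
    double : ∀ {x y z} → z ≤ x + y → y ≤ x → z ≤ 2 * x
    double {x} p q = ≤-trans p (+-monoʳ-≤ x (≤-trans q (≤-reflexive (sym (+-identityʳ x)))))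
    build : (Σ (Subset n) λ t → mass₁ Y ≤ mass (λ v → 4 * μ v) ⟪ In? Y t ⟫ × mass (λ v → 4 * μ v) ⟪ In? Y t ⟫ ≤ mass₁ Y + mass₁ Y) → Halves X Y
    build (t , lower , upper) with ≤-total (mass₁ ⟪ Out? X t ⟫) (mass₁ ⟪ In? X t ⟫)
    ... | inj₁ le = record
      { X′ = ⟪ In? X t ⟫ ; Y′ = ⟪ Out? Y t ⟫
      ; X′⊆X = λ {v} p → proj₁ (∈⁻ (In? X t) {v} p) ; Y′⊆Y = λ {v} p → proj₁ (∈⁻ (Out? Y t) {v} p)
      ; disjoint = λ {v} p p′ → proj₂ (∈⁻ (Out? Y t) {v} p′) (proj₂ (∈⁻ (In? X t) {v} p))
      ; half = double (parts X t) le
      ; quarter = +-cancelˡ-≤ (2 * mass₁ Y) _ _ (begin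
          2 * mass₁ Y + mass₁ Y                                       ≤⟨ m≤m+n _ (mass₁ Y) ⟩
          2 * mass₁ Y + mass₁ Y + mass₁ Y                             ≡⟨ e₁ (mass₁ Y) ⟩
          4 * mass₁ Y                                                 ≤⟨ *-monoʳ-≤ 4 (parts Y t) ⟩
          4 * (mass₁ ⟪ In? Y t ⟫ + mass₁ ⟪ Out? Y t ⟫)                ≡⟨ *-distribˡ-+ 4 (mass₁ ⟪ In? Y t ⟫) _ ⟩
          4 * mass₁ ⟪ In? Y t ⟫ + 4 * mass₁ ⟪ Out? Y t ⟫              ≤⟨ +-monoˡ-≤ _ (≤-trans (≤-reflexive (sym (mass-* 4 μ ⟪ In? Y t ⟫))) (≤-trans upper (≤-reflexive (e₂ (mass₁ Y))))) ⟩
          2 * mass₁ Y + 4 * mass₁ ⟪ Out? Y t ⟫                        ∎) }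
      where
      e₁ : ∀ y → 2 * y + y + y ≡ 4 * y
      e₁ = solve-∀
      e₂ : ∀ y → y + y ≡ 2 * y
      e₂ = solve-∀
    ... | inj₂ le = record
      { X′ = ⟪ Out? X t ⟫ ; Y′ = ⟪ In? Y t ⟫
      ; X′⊆X = λ {v} p → proj₁ (∈⁻ (Out? X t) {v} p) ; Y′⊆Y = λ {v} p → proj₁ (∈⁻ (In? Y t) {v} p)
      ; disjoint = λ {v} p p′ → proj₂ (∈⁻ (Out? X t) {v} p) (proj₂ (∈⁻ (In? Y t) {v} p′))
      ; half = double (≤-trans (parts X t) (≤-reflexive (+-comm (mass₁ ⟪ In? X t ⟫) _))) le
      ; quarter = ≤-trans lower (≤-reflexive (mass-* 4 μ ⟪ In? Y t ⟫)) }

  -- Distinct vertices of `H` are joined by an arc and `T` has no loops, so preserving arcs forces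
  -- injectivity; asymmetry in `T` then reflects arcs.
  homomorphism⇒Contains : ∀ {h} (H : Tournament h) (f : Fin h → Fin n) → (∀ u v → arc H u v ≡ true → f u ⟶ f v) → Contains T H
  homomorphism⇒Contains H f hom = f , injective , preserves
    where
    injective : ∀ {u v} → f u ≡ f v → u ≡ v
    injective {u} {v} e with u Fin.≟ v | arc H u v in eq
    ... | yes u≡v | _     = u≡v
    ... | no _    | true  = contradiction (subst (_⟶ f v) e (hom u v eq)) ⟶-irrefl
    ... | no u≢v  | false = contradiction (subst (f v ⟶_) e (hom v u (trans (tourn H v u λ r → u≢v (sym r)) (cong not eq)))) ⟶-irrefl
    preserves : ∀ u v → arc H u v ≡ arc T (f u) (f v)
    preserves u v with u Fin.≟ v | arc H u v in eq
    ... | _        | true  = sym (hom u v eq)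
    ... | yes refl | false = sym (irrefl T (f u))
    ... | no u≢v   | false = sym (Bool.¬-not λ a → ⟶-asym a (hom v u (trans (tourn H v u λ r → u≢v (sym r)) (cong not eq))))

  NoPair : ℕ → ℕ → Subset n → Set
  NoPair L d Z = ∀ X Y → (∀ {v} → v ∈ X → v ∈ Z) → (∀ {v} → v ∈ Y → v ∈ Z) → (∀ {v} → v ∈ X → v ∈ Y → ⊥) →
                 mass₁ Z ≤ d * mass₁ X → mass₁ Z ≤ d * mass₁ Y → L * back X Y ≤ mass₁ X * mass₁ Y → ⊥

  module _ {h} (H : Tournament h) (H-free : ¬ Contains T H) (L : ℕ) where

    private
      Λ : ℕ
      Λ = shrinkage L

      H-irrefl : ∀ {i j} → arc H i j ≡ true → i ≢ j
      H-irrefl p refl with () ← trans (sym p) (irrefl H _)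

      Λ^≢0 : ∀ k → NonZero (Λ ^ k)
      Λ^≢0 k = m^n≢0 Λ k

    module _ (Z : Subset n) (0<Z : 0 < mass₁ Z) (atoms : ∀ {v} → v ∈ Z → pairConst h L * μ v ≤ mass₁ Z) (no-pair : NoPair L (pairConst h L) Z) where

      private
        atoms-small : ∀ k → k ≤ h → ∀ {Y} → mass₁ Z ≤ Λ ^ k * mass₁ Y → ∀ {v} → v ∈ Z → Λ * μ v ≤ mass₁ Y
        atoms-small k k≤h {Y} bigY {v} v∈ = *-cancelˡ-≤ (Λ ^ k) {{Λ^≢0 k}} (begin
          Λ ^ k * (Λ * μ v)          ≡⟨ e (Λ ^ k) Λ (μ v) ⟩
          Λ ^ suc k * μ v            ≤⟨ *-monoˡ-≤ (μ v) (^-monoʳ-≤ Λ (s≤s k≤h)) ⟩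
          Λ ^ suc h * μ v            ≤⟨ *-monoˡ-≤ (μ v) (m≤n*m (Λ ^ suc h) (4 * suc h)) ⟩
          pairConst h L * μ v        ≤⟨ atoms v∈ ⟩
          mass₁ Z                    ≤⟨ bigY ⟩
          Λ ^ k * mass₁ Y            ∎)
          where
          open ≤-Reasoning
          e : ∀ a b c → a * (b * c) ≡ b * a * c
          e = solve-∀

        -- All candidate sets lie in the same `Z` and may overlap, whereas `NoPair` asks for
        -- disjoint sets; `halves` separates them. Either direction will do, since `NoPair` can be
        -- applied to both orders of the pair.
        no-sparse : ∀ k → k ≤ h → ∀ X Y → (∀ {v} → v ∈ X → v ∈ Z) → (∀ {v} → v ∈ Y → v ∈ Z) →
                    mass₁ Z ≤ Λ ^ k * (suc h * mass₁ X) → mass₁ Z ≤ Λ ^ k * mass₁ Y →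
                    (Λ * back X Y ≤ 2 * (mass₁ X * mass₁ Y)) ⊎ (Λ * back Y X ≤ 2 * (mass₁ X * mass₁ Y)) → ⊥
        no-sparse k k≤h X Y X⊆Z Y⊆Z bigX bigY sparse = conclude sparse
          where
          open ≤-Reasoning
          open Halves (halves X Y λ y∈ → ≤-trans (*-monoˡ-≤ _ (≤-trans (≤ᵇ⇒≤ 4 16 _) (m≤m*n 16 (suc L)))) (atoms-small k k≤h bigY (Y⊆Z y∈)))
          Λ^k≤ : Λ ^ k ≤ Λ ^ suc h
          Λ^k≤ = ^-monoʳ-≤ Λ (m≤n⇒m≤1+n k≤h)
          bigX′ : mass₁ Z ≤ pairConst h L * mass₁ X′
          bigX′ = begin
            mass₁ Z                                      ≤⟨ bigX ⟩
            Λ ^ k * (suc h * mass₁ X)                    ≤⟨ *-mono-≤ Λ^k≤ (*-monoʳ-≤ (suc h) (≤-trans half (*-monoˡ-≤ (mass₁ X′) (≤ᵇ⇒≤ 2 4 _)))) ⟩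
            Λ ^ suc h * (suc h * (4 * mass₁ X′))         ≡⟨ e (Λ ^ suc h) (suc h) (mass₁ X′) ⟩
            pairConst h L * mass₁ X′                         ∎
            where
            e : ∀ a b c → a * (b * (4 * c)) ≡ 4 * b * a * c
            e = solve-∀
          bigY′ : mass₁ Z ≤ pairConst h L * mass₁ Y′
          bigY′ = begin
            mass₁ Z                                      ≤⟨ bigY ⟩
            Λ ^ k * mass₁ Y                              ≤⟨ *-mono-≤ Λ^k≤ (≤-trans quarter (m≤n*m (4 * mass₁ Y′) (suc h))) ⟩
            Λ ^ suc h * (suc h * (4 * mass₁ Y′))         ≡⟨ e (Λ ^ suc h) (suc h) (mass₁ Y′) ⟩
            pairConst h L * mass₁ Y′                         ∎
            where
            e : ∀ a b c → a * (b * (4 * c)) ≡ 4 * b * a * c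
            e = solve-∀
          shrink : ∀ {β β′} → β′ ≤ β → Λ * β ≤ 2 * (mass₁ X * mass₁ Y) → L * β′ ≤ mass₁ X′ * mass₁ Y′
          shrink {β} {β′} β′≤β le = ≤-trans (*-monoˡ-≤ β′ (n≤1+n L)) (*-cancelˡ-≤ 16 (begin
            16 * (suc L * β′)                              ≡⟨ *-assoc 16 (suc L) β′ ⟨
            Λ * β′                                         ≤⟨ *-monoʳ-≤ Λ β′≤β ⟩
            Λ * β                                          ≤⟨ le ⟩
            2 * (mass₁ X * mass₁ Y)                        ≤⟨ *-monoʳ-≤ 2 (*-mono-≤ half quarter) ⟩
            2 * (2 * mass₁ X′ * (4 * mass₁ Y′))            ≡⟨ e (mass₁ X′) (mass₁ Y′) ⟩
            16 * (mass₁ X′ * mass₁ Y′)                     ∎))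
            where
            e : ∀ x y → 2 * (2 * x * (4 * y)) ≡ 16 * (x * y)
            e = solve-∀
          conclude : _ ⊎ _ → ⊥
          conclude (inj₁ le) = no-pair X′ Y′ (λ p → X⊆Z (X′⊆X p)) (λ p → Y⊆Z (Y′⊆Y p)) disjoint bigX′ bigY′
            (shrink {back X Y} (back-mono X′⊆X Y′⊆Y) le)
          conclude (inj₂ le) = no-pair Y′ X′ (λ p → Y⊆Z (Y′⊆Y p)) (λ p → X⊆Z (X′⊆X p)) (λ p p′ → disjoint p′ p) bigY′ bigX′
            (≤-trans (shrink {back Y X} (back-mono Y′⊆Y X′⊆X) le) (≤-reflexive (*-comm (mass₁ X′) (mass₁ Y′))))

        Fits : Fin h → Fin h → Fin n → Fin n → Set
        Fits i j x y = (arc H i j ≡ true → x ⟶ y) × (arc H j i ≡ true → y ⟶ x)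

        fits? : ∀ i j x y → Dec (Fits i j x y)
        fits? i j x y = (arc H i j Bool.≟ true →-dec x ⟶? y) ×-dec (arc H j i Bool.≟ true →-dec y ⟶? x)

        Cand? : ∀ (C : Fin h → Subset n) i x j → Decidable λ y → y ∈ C j × Fits i j x y
        Cand? C i x j y = y ∈? C j ×-dec fits? i j x y

        module Step (k : ℕ) (k<h : k < h) (C : Fin h → Subset n) (C⊆Z : ∀ {j v} → v ∈ C j → v ∈ Z)
                    (big : ∀ j → k ≤ toℕ j → mass₁ Z ≤ Λ ^ k * mass₁ (C j)) where

          i : Fin h
          i = fromℕ< k<h

          toℕ-i : toℕ i ≡ k
          toℕ-i = Fin.toℕ-fromℕ< k<h

          Ample : Fin n → Fin h → Set
          Ample x j = k < toℕ j → mass₁ (C j) ≤ Λ * mass₁ ⟪ Cand? C i x j ⟫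

          ample? : ∀ x j → Dec (Ample x j)
          ample? x j = k <? toℕ j →-dec mass₁ (C j) ≤? Λ * mass₁ ⟪ Cand? C i x j ⟫

          Bad? : ∀ j → Decidable λ x → x ∈ C i × ¬ Ample x j
          Bad? j x = x ∈? C i ×-dec ¬? (ample? x j)

          bigC : mass₁ Z ≤ Λ ^ k * mass₁ (C i)
          bigC = big i (≤-reflexive (sym toℕ-i))

          0<C : 0 < mass₁ (C i)
          0<C = n≢0⇒n>0 λ e → <⇒≱ 0<Z (≤-trans bigC (≤-reflexive (trans (cong (Λ ^ k *_) e) (*-zeroʳ (Λ ^ k)))))

          -- Almost all arcs between the bad vertices and `C j` go the wrong way, so a share
          -- `1 / suc h` of `C i` being bad would produce a sparse pair.
          bad-small : ∀ j → ¬ mass₁ (C i) ≤ suc h * mass₁ ⟪ Bad? j ⟫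
          bad-small j le = sides (arc H i j) refl
            where
            open ≤-Reasoning
            X Y : Subset n
            X = ⟪ Bad? j ⟫
            Y = C j
            x∈ : ∃ λ x → x ∈ X
            x∈ = inhabited μ X (n≢0⇒n>0 λ e → <⇒≱ 0<C (≤-trans le (≤-reflexive (trans (cong (suc h *_) e) (*-zeroʳ (suc h))))))
            k<j : k < toℕ j
            k<j with k <? toℕ j
            ... | yes p = p
            ... | no ¬p = contradiction (λ p → contradiction p ¬p) (proj₂ (∈⁻ (Bad? j) {proj₁ x∈} (proj₂ x∈)))
            i≢j : i ≢ j
            i≢j e = <-irrefl (trans (sym toℕ-i) (cong toℕ e)) k<j
            few : ∀ {x} → x ∈ X → Λ * mass₁ ⟪ Cand? C i x j ⟫ ≤ mass₁ Y
            few {x} p = <⇒≤ (≰⇒> λ le′ → proj₂ (∈⁻ (Bad? j) {x} p) λ _ → le′)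
            X⊆Z : ∀ {v} → v ∈ X → v ∈ Z
            X⊆Z {v} p = C⊆Z (proj₁ (∈⁻ (Bad? j) {v} p))
            bigX : mass₁ Z ≤ Λ ^ k * (suc h * mass₁ X)
            bigX = ≤-trans bigC (*-monoʳ-≤ (Λ ^ k) le)
            bigY : mass₁ Z ≤ Λ ^ k * mass₁ Y
            bigY = big j (<⇒≤ k<j)
            -- No arc joins `x` to itself, so `x` is counted apart from the candidates; being
            -- negligible, it costs only the factor 2.
            wrong-side : ∀ {x} → x ∈ X → (R : Subset n) → (∀ {y} → y ∈ R → y ∈ ⟪ Cand? C i x j ⟫ ⊎ y ≡ x) → Λ * mass₁ R ≤ 2 * mass₁ Y
            wrong-side {x} p R h = begin
              Λ * mass₁ R                                                        ≤⟨ *-monoʳ-≤ Λ (mass-∪ {A = ⟪ Cand? C i x j ⟫} {⟪ Fin._≟ x ⟫} λ {y} r → Sum.map₂ (∈⁺ (Fin._≟ x) {y}) (h r)) ⟩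
              Λ * (mass₁ ⟪ Cand? C i x j ⟫ + mass₁ ⟪ Fin._≟ x ⟫)                 ≡⟨ *-distribˡ-+ Λ (mass₁ ⟪ Cand? C i x j ⟫) _ ⟩
              Λ * mass₁ ⟪ Cand? C i x j ⟫ + Λ * mass₁ ⟪ Fin._≟ x ⟫               ≤⟨ +-mono-≤ (few p) (≤-trans (*-monoʳ-≤ Λ (≤-trans (mass-covered μ ⟪ Fin._≟ x ⟫ (x ∷ []) λ {y} e → here (∈⁻ (Fin._≟ x) {y} e)) (≤-reflexive (+-identityʳ (μ x))))) (atoms-small k (<⇒≤ k<h) bigY (X⊆Z p))) ⟩
              mass₁ Y + mass₁ Y                                                  ≡⟨ cong (mass₁ Y +_) (+-identityʳ (mass₁ Y)) ⟨
              2 * mass₁ Y                                                        ∎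
            reorder : ∀ y x → 2 * y * x ≡ 2 * (x * y)
            reorder = solve-∀
            sides : ∀ b → arc H i j ≡ b → ⊥
            sides false eq = no-sparse k (<⇒≤ k<h) X Y X⊆Z C⊆Z bigX bigY (inj₁ (≤-trans
              (back-≤ˡ Λ (2 * mass₁ Y) X Y λ {x} p → wrong-side p ⟪ NonOut? Y x ⟫ λ {y} r → place x y (∈⁻ (NonOut? Y x) {y} r))
              (≤-reflexive (reorder (mass₁ Y) (mass₁ X)))))
              where
              place : ∀ x y → y ∈ Y × ¬ x ⟶ y → y ∈ ⟪ Cand? C i x j ⟫ ⊎ y ≡ x
              place x y (y∈ , ¬x⟶y) = by (y Fin.≟ x)
                where
                by : Dec (y ≡ x) → y ∈ ⟪ Cand? C i x j ⟫ ⊎ y ≡ x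
                by (yes e) = inj₂ e
                by (no ¬e) = inj₁ (∈⁺ (Cand? C i x j) (y∈ , (λ t → contradiction (trans (sym t) eq) λ ()) , λ _ → ⟶-total (λ e → ¬e (sym e)) ¬x⟶y))
            sides true eq = no-sparse k (<⇒≤ k<h) X Y X⊆Z C⊆Z bigX bigY (inj₂ (≤-trans
              (back-≤ʳ Λ (2 * mass₁ Y) Y X λ {x} p → wrong-side p ⟪ NonIn? Y x ⟫ λ {y} r → place x y (∈⁻ (NonIn? Y x) {y} r))
              (≤-reflexive (reorder (mass₁ Y) (mass₁ X)))))
              where
              ¬ji : ¬ arc H j i ≡ true
              ¬ji t = contradiction (trans (sym t) (trans (tourn H j i λ e → i≢j (sym e)) (cong not eq))) λ ()
              place : ∀ x y → y ∈ Y × ¬ y ⟶ x → y ∈ ⟪ Cand? C i x j ⟫ ⊎ y ≡ x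
              place x y (y∈ , ¬y⟶x) = by (y Fin.≟ x)
                where
                by : Dec (y ≡ x) → y ∈ ⟪ Cand? C i x j ⟫ ⊎ y ≡ x
                by (yes e) = inj₂ e
                by (no ¬e) = inj₁ (∈⁺ (Cand? C i x j) (y∈ , (λ _ → ⟶-total ¬e ¬y⟶x) , λ t → contradiction t ¬ji))

          good-vertex : ∃ λ x → x ∈ C i × (∀ j → Ample x j)
          good-vertex with Fin.any? (λ x → x ∈? C i ×-dec Fin.all? (ample? x))
          ... | yes p = p
          ... | no ¬p = contradiction pigeonhole (<⇒≱ (m<n+m (h * mass₁ (C i)) 0<C))
            where
            open ≤-Reasoning
            pigeonhole : suc h * mass₁ (C i) ≤ h * mass₁ (C i)
            pigeonhole = begin
              suc h * mass₁ (C i)                             ≤⟨ *-monoʳ-≤ (suc h) (mass-⋃ (λ j → ⟪ Bad? j ⟫) λ {x} x∈ → bad x x∈) ⟩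
              suc h * ∑ (λ j → mass₁ ⟪ Bad? j ⟫)              ≡⟨ ∑-* (suc h) (λ j → mass₁ ⟪ Bad? j ⟫) ⟨
              ∑ (λ j → suc h * mass₁ ⟪ Bad? j ⟫)              ≤⟨ ∑-mono (λ j → <⇒≤ (≰⇒> (bad-small j))) ⟩
              ∑ {h} (λ _ → mass₁ (C i))                       ≡⟨ ∑-const h (mass₁ (C i)) ⟩
              h * mass₁ (C i)                                 ∎
              where
              bad : ∀ x → x ∈ C i → ∃ λ j → x ∈ ⟪ Bad? j ⟫
              bad x x∈ with Fin.¬∀⟶∃¬ h (Ample x) (ample? x) (λ all → ¬p (x , x∈ , all))
              ... | j , ¬a = j , ∈⁺ (Bad? j) (x∈ , ¬a)

        -- The greedy embedding of `H`. Only the values of `f` below `k` and the sets `C` from `k`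
        -- on matter; the others are leftovers or placeholders.
        embed : ∀ k j → j + k ≡ h → (f : Fin h → Fin n) (C : Fin h → Subset n) → (∀ {j v} → v ∈ C j → v ∈ Z) →
                (∀ j → k ≤ toℕ j → mass₁ Z ≤ Λ ^ k * mass₁ (C j)) →
                (∀ u v → toℕ u < k → toℕ v < k → arc H u v ≡ true → f u ⟶ f v) →
                (∀ u v → toℕ u < k → k ≤ toℕ v → ∀ {z} → z ∈ C v → Fits u v (f u) z) → ⊥
        embed k zero refl f C C⊆Z big done compatible =
          H-free (homomorphism⇒Contains H f λ u v → done u v (Fin.toℕ<n u) (Fin.toℕ<n v))
        embed k (suc j) eq f C C⊆Z big done compatible =
          embed (suc k) j (trans (+-suc j k) eq) f′ C′ (λ {l} {z} p → C⊆Z (proj₁ (∈⁻ (Cand? C i x l) {z} p))) big′ done′ compatible′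
          where
          k<h : k < h
          k<h = subst (k <_) eq (m<n+m k z<s)
          open Step k k<h C C⊆Z big
          x : Fin n
          x = proj₁ good-vertex
          C′ : Fin h → Subset n
          C′ l = ⟪ Cand? C i x l ⟫
          f′ : Fin h → Fin n
          f′ u with u Fin.≟ i
          ... | yes _ = x
          ... | no _  = f u
          old : ∀ {u} → toℕ u < suc k → u ≢ i → toℕ u < k
          old u<k u≢i = ≤∧≢⇒< (s≤s⁻¹ u<k) λ e → u≢i (Fin.toℕ-injective (trans e (sym toℕ-i)))
          big′ : ∀ l → suc k ≤ toℕ l → mass₁ Z ≤ Λ ^ suc k * mass₁ (C′ l)
          big′ l p = begin
            mass₁ Z                              ≤⟨ big l (<⇒≤ p) ⟩
            Λ ^ k * mass₁ (C l)                  ≤⟨ *-monoʳ-≤ (Λ ^ k) (proj₂ (proj₂ good-vertex) l p) ⟩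
            Λ ^ k * (Λ * mass₁ (C′ l))           ≡⟨ e (Λ ^ k) Λ (mass₁ (C′ l)) ⟩
            Λ ^ suc k * mass₁ (C′ l)             ∎
            where
            open ≤-Reasoning
            e : ∀ a b c → a * (b * c) ≡ b * a * c
            e = solve-∀
          x∈C : x ∈ C i
          x∈C = proj₁ (proj₂ good-vertex)
          k≤i : k ≤ toℕ i
          k≤i = ≤-reflexive (sym toℕ-i)
          done′ : ∀ u v → toℕ u < suc k → toℕ v < suc k → arc H u v ≡ true → f′ u ⟶ f′ v
          done′ u v pu pv a with u Fin.≟ i | v Fin.≟ i
          ... | yes refl | yes refl = contradiction refl (H-irrefl a)
          ... | no u≢i   | no v≢i   = done u v (old pu u≢i) (old pv v≢i) a
          ... | no u≢i   | yes refl = proj₁ (compatible u i (old pu u≢i) k≤i x∈C) a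
          ... | yes refl | no v≢i   = proj₂ (compatible v i (old pv v≢i) k≤i x∈C) a
          compatible′ : ∀ u v → toℕ u < suc k → suc k ≤ toℕ v → ∀ {z} → z ∈ C′ v → Fits u v (f′ u) z
          compatible′ u v pu pv {z} z∈ with u Fin.≟ i
          ... | yes refl = proj₂ (∈⁻ (Cand? C i x v) {z} z∈)
          ... | no u≢i   = compatible u v (old pu u≢i) (<⇒≤ pv) (proj₁ (∈⁻ (Cand? C i x v) {z} z∈))

      pair-exists : ⊥
      pair-exists = embed 0 h (+-identityʳ h) (λ _ → proj₁ (inhabited μ Z 0<Z)) (λ _ → Z) (λ p → p)
        (λ _ _ → ≤-reflexive (sym (+-identityʳ (mass₁ Z)))) (λ _ _ ()) (λ _ _ ())

  record Layers (L d k : ℕ) (Z : Subset n) : Set where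
    field
      G        : Fin k → Subset n
      G⊆Z      : ∀ {i v} → v ∈ G i → v ∈ Z
      big      : ∀ i → mass₁ Z ≤ d * mass₁ (G i)
      disjoint : ∀ {i j v} → toℕ i < toℕ j → v ∈ G i → v ∈ G j → ⊥
      sparse   : ∀ {i j} → toℕ i < toℕ j → L * back (G i) (G j) ≤ mass₁ (G i) * mass₁ (G j)

  -- In continuation form, since `pair-exists` merely refutes the absence of a sparse pair. Its
  -- first set becomes the first layer, the others are found inside its second set.
  layers : ∀ {h} (H : Tournament h) → ¬ Contains T H → ∀ L k Z → 0 < mass₁ Z → (∀ {v} → v ∈ Z → layerConst h L k * μ v ≤ mass₁ Z) →
           (Layers L (layerConst h L k) k Z → ⊥) → ⊥
  layers H H-free L zero Z 0<Z atoms continue = continue record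
    { G = λ () ; G⊆Z = λ { {()} } ; big = λ () ; disjoint = λ { {()} } ; sparse = λ { {()} } }
  layers {h} H H-free L (suc k) Z 0<Z atoms continue =
    pair-exists H H-free (L * d) Z 0<Z (λ {v} v∈ → ≤-trans (*-monoˡ-≤ (μ v) (m≤m*n p d {{d≢0}})) (atoms v∈)) no-pair
    where
    open ≤-Reasoning
    d p : ℕ
    d = layerConst h L k
    p = pairConst h (L * d)
    d≢0 : NonZero d
    d≢0 = layerConst>0 h L k
    p≢0 : NonZero p
    p≢0 = pairConst>0 h (L * d)
    no-pair : NoPair (L * d) p Z
    no-pair X Y X⊆Z Y⊆Z X∩Y bigX bigY sparseXY =
      layers H H-free L k Y (n≢0⇒n>0 λ e → <⇒≱ 0<Z (≤-trans bigY (≤-reflexive (trans (cong (p *_) e) (*-zeroʳ p)))))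
        (λ {v} v∈ → *-cancelˡ-≤ p {{p≢0}} (≤-trans (≤-reflexive (sym (*-assoc p d (μ v)))) (≤-trans (atoms (Y⊆Z v∈)) bigY)))
        (λ ls → continue (prepend ls))
      where
      prepend : Layers L d k Y → Layers L (p * d) (suc k) Z
      prepend ls = record { G = G′ ; G⊆Z = λ {i} → G′⊆Z i ; big = big′ ; disjoint = λ {i} {j} → disjoint′ i j ; sparse = λ {i} {j} → sparse′ i j }
        where
        open Layers ls
        G′ : Fin (suc k) → Subset n
        G′ fzero    = X
        G′ (fsuc i) = G i
        G′⊆Z : ∀ i {v} → v ∈ G′ i → v ∈ Z
        G′⊆Z fzero    v∈ = X⊆Z v∈
        G′⊆Z (fsuc i) v∈ = Y⊆Z (G⊆Z v∈)
        big′ : ∀ i → mass₁ Z ≤ p * d * mass₁ (G′ i)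
        big′ fzero    = ≤-trans bigX (*-monoˡ-≤ (mass₁ X) (m≤m*n p d {{d≢0}}))
        big′ (fsuc i) = ≤-trans bigY (≤-trans (*-monoʳ-≤ p (big i)) (≤-reflexive (sym (*-assoc p d _))))
        disjoint′ : ∀ i j {v} → toℕ i < toℕ j → v ∈ G′ i → v ∈ G′ j → ⊥
        disjoint′ fzero    (fsuc j) _       v∈ v∈′ = X∩Y v∈ (G⊆Z v∈′)
        disjoint′ (fsuc i) (fsuc j) (s<s l) v∈ v∈′ = disjoint l v∈ v∈′
        sparse′ : ∀ i j → toℕ i < toℕ j → L * back (G′ i) (G′ j) ≤ mass₁ (G′ i) * mass₁ (G′ j)
        sparse′ (fsuc i) (fsuc j) (s<s l) = sparse l
        sparse′ fzero    (fsuc j) _       = *-cancelˡ-≤ d {{d≢0}} (begin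
          d * (L * back X (G j))             ≡⟨ e₁ d L (back X (G j)) ⟩
          L * d * back X (G j)               ≤⟨ *-monoʳ-≤ (L * d) (back-mono (λ p → p) G⊆Z) ⟩
          L * d * back X Y                   ≤⟨ sparseXY ⟩
          mass₁ X * mass₁ Y                  ≤⟨ *-monoʳ-≤ (mass₁ X) (big j) ⟩
          mass₁ X * (d * mass₁ (G j))        ≡⟨ e₂ (mass₁ X) d (mass₁ (G j)) ⟩
          d * (mass₁ X * mass₁ (G j))        ∎)
          where
          e₁ : ∀ a b c → a * (b * c) ≡ b * a * c
          e₁ = solve-∀
          e₂ : ∀ a b c → a * (b * c) ≡ b * (a * c)
          e₂ = solve-∀

-- Positions, boats and layers of a left flotilla.

data Role : Set where
  first second third fourth : Role

module Flotilla {h} (H : Tournament h) (flotilla : LeftFlotilla H) where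

  θ : Fin h → Fin h
  θ = proj₁ flotilla

  θ⁻¹ : Fin h → Fin h
  θ⁻¹ u = proj₁ (proj₂ (proj₁ (proj₂ flotilla)) u)

  θ∘θ⁻¹ : ∀ u → θ (θ⁻¹ u) ≡ u
  θ∘θ⁻¹ u = proj₂ (proj₂ (proj₁ (proj₂ flotilla)) u) refl

  private
    component : ∀ x → ComponentIsLeftBoat H θ x
    component = proj₂ (proj₂ flotilla)

  seat : Fin h → Role → Fin h
  seat x first  = proj₁ (component x)
  seat x second = proj₁ (proj₂ (component x))
  seat x third  = proj₁ (proj₂ (proj₂ (component x)))
  seat x fourth = proj₁ (proj₂ (proj₂ (proj₂ (component x))))

  private
    boat : ∀ x → LeftBoat H θ (seat x first) (seat x second) (seat x third) (seat x fourth)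
    boat x = proj₁ (proj₂ (proj₂ (proj₂ (proj₂ (component x)))))

    connected⇒seat : ∀ x {y} → Connected H θ x y → ∃ λ r → y ≡ seat x r
    connected⇒seat x {y} c with Equivalence.to (proj₂ (proj₂ (proj₂ (proj₂ (proj₂ (component x))))) y) c
    ... | inj₁ e               = first , e
    ... | inj₂ (inj₁ e)        = second , e
    ... | inj₂ (inj₂ (inj₁ e)) = third , e
    ... | inj₂ (inj₂ (inj₂ e)) = fourth , e

    seat⇒connected : ∀ x r → Connected H θ x (seat x r)
    seat⇒connected x r = Equivalence.from (proj₂ (proj₂ (proj₂ (proj₂ (proj₂ (component x))))) (seat x r)) (pick r)
      where
      pick : ∀ r → seat x r ≡ seat x first ⊎ seat x r ≡ seat x second ⊎ seat x r ≡ seat x third ⊎ seat x r ≡ seat x fourth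
      pick first  = inj₁ refl
      pick second = inj₂ (inj₁ refl)
      pick third  = inj₂ (inj₂ (inj₁ refl))
      pick fourth = inj₂ (inj₂ (inj₂ refl))

    BEdge-sym : ∀ {x y} → BEdge H θ x y → BEdge H θ y x
    BEdge-sym (inj₁ e) = inj₂ e
    BEdge-sym (inj₂ e) = inj₁ e

  seat-second : ∀ x → toℕ (seat x second) ≡ suc (toℕ (seat x first))
  seat-second x = proj₁ (boat x)

  seat-third : ∀ x → toℕ (seat x third) ≡ suc (suc (toℕ (seat x first)))
  seat-third x = trans (proj₁ (proj₂ (boat x))) (cong suc (seat-second x))

  seat-fourth : ∀ x → toℕ (seat x third) < toℕ (seat x fourth)
  seat-fourth x = proj₁ (proj₂ (proj₂ (boat x)))

  first≤ : ∀ x r → toℕ (seat x first) ≤ toℕ (seat x r)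
  first≤ x first  = ≤-refl
  first≤ x second = ≤-trans (n≤1+n _) (≤-reflexive (sym (seat-second x)))
  first≤ x third  = ≤-trans (m≤n+m _ 2) (≤-reflexive (sym (seat-third x)))
  first≤ x fourth = ≤-trans (first≤ x third) (<⇒≤ (seat-fourth x))

  ≤fourth : ∀ x r → toℕ (seat x r) ≤ toℕ (seat x fourth)
  ≤fourth x first  = first≤ x fourth
  ≤fourth x second = ≤-trans (≤-trans (≤-reflexive (seat-second x)) (≤-trans (n≤1+n _) (≤-reflexive (sym (seat-third x))))) (≤fourth x third)
  ≤fourth x third  = <⇒≤ (seat-fourth x)
  ≤fourth x fourth = ≤-refl

  first<fourth : ∀ x → toℕ (seat x first) < toℕ (seat x fourth)
  first<fourth x = ≤-<-trans (first≤ x third) (seat-fourth x)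

  private
    seats-⊆ : ∀ {x y} → Connected H θ x y → ∀ r → ∃ λ s → seat y r ≡ seat x s
    seats-⊆ {x} {y} c r = connected⇒seat x (c Star.◅◅ seat⇒connected y r)

    connected-sym : ∀ {x y} → Connected H θ x y → Connected H θ y x
    connected-sym = Star.reverse BEdge-sym

  firsts : ∀ {x y} → Connected H θ x y → seat x first ≡ seat y first
  firsts {x} {y} c = Fin.toℕ-injective (≤-antisym (lower c) (lower (connected-sym c)))
    where
    lower : ∀ {x y} → Connected H θ x y → toℕ (seat x first) ≤ toℕ (seat y first)
    lower {x} {y} c with s , e ← seats-⊆ c first = subst (λ z → toℕ (seat x first) ≤ toℕ z) (sym e) (first≤ x s)

  -- The boats attached to two positions of one component are a priori unrelated witnesses. They
  -- agree because the first seat is the least position of the component, the fourth the greatest,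
  -- and the middle two follow the first. Hence `seat x first` can serve as the name of the
  -- component.
  same-seat : ∀ {x y} → Connected H θ x y → ∀ r → seat x r ≡ seat y r
  same-seat c first  = firsts c
  same-seat {x} {y} c second = Fin.toℕ-injective (trans (seat-second x) (trans (cong (λ s → suc (toℕ s)) (firsts c)) (sym (seat-second y))))
  same-seat {x} {y} c third  = Fin.toℕ-injective (trans (seat-third x) (trans (cong (λ s → suc (suc (toℕ s))) (firsts c)) (sym (seat-third y))))
  same-seat {x} {y} c fourth = Fin.toℕ-injective (≤-antisym (upper (connected-sym c)) (upper c))
    where
    upper : ∀ {x y} → Connected H θ x y → toℕ (seat y fourth) ≤ toℕ (seat x fourth)
    upper {x} {y} c with s , e ← seats-⊆ c fourth = subst (λ z → toℕ z ≤ toℕ (seat x fourth)) (sym e) (≤fourth x s)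

  first-seat : ∀ x r → seat (seat x r) first ≡ seat x first
  first-seat x r = sym (firsts (seat⇒connected x r))

  first⇒connected : ∀ {x y} → seat x first ≡ seat y first → Connected H θ x y
  first⇒connected {x} {y} e = subst (Connected H θ x) e (seat⇒connected x first) Star.◅◅ connected-sym (seat⇒connected y first)

  same-component : ∀ {x y} → seat x first ≡ seat y first → ∀ r → seat x r ≡ seat y r
  same-component e = same-seat (first⇒connected e)

  role : ∀ x → ∃ λ r → x ≡ seat x r
  role x = connected⇒seat x Star.ε

  -- A backward arc is an edge of the backward graph and so stays within one component.
  forward : ∀ {x y} → seat x first ≢ seat y first → arc H (θ x) (θ y) ≡ true → toℕ x < toℕ y
  forward {x} {y} ≢first a with <-cmp (toℕ x) (toℕ y)
  ... | tri< x<y _ _ = x<y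
  ... | tri≈ _ e _   = contradiction (cong (λ z → seat z first) (Fin.toℕ-injective e)) ≢first
  ... | tri> _ _ y<x = contradiction (firsts (inj₁ (y<x , a) Star.◅ Star.ε)) ≢first

  data BoatArc : Role → Role → Set where
    arc₁₂ : BoatArc first second
    arc₂₃ : BoatArc second third
    arc₃₁ : BoatArc third first
    arc₃₄ : BoatArc third fourth
    arc₄₁ : BoatArc fourth first
    arc₄₂ : BoatArc fourth second

  boat-arc : ∀ x r s → arc H (θ (seat x r)) (θ (seat x s)) ≡ true → BoatArc r s
  boat-arc x r s = by r s
    where
    p : Role → Fin h
    p = seat x
    irreflexive : ∀ {u} {A : Set} → arc H u u ≡ true → A
    irreflexive {u} a = contradiction (trans (sym a) (irrefl H u)) λ ()
    p₁<p₂ : toℕ (p first) < toℕ (p second)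
    p₁<p₂ = ≤-reflexive (sym (seat-second x))
    p₂<p₃ : toℕ (p second) < toℕ (p third)
    p₂<p₃ = ≤-trans (≤-reflexive (cong suc (seat-second x))) (≤-reflexive (sym (seat-third x)))
    p₁<p₃ : toℕ (p first) < toℕ (p third)
    p₁<p₃ = <-trans p₁<p₂ p₂<p₃
    p₃<p₄ : toℕ (p third) < toℕ (p fourth)
    p₃<p₄ = seat-fourth x
    against : ∀ {u v} {A : Set} → toℕ u < toℕ v → BEdge H θ u v → arc H (θ u) (θ v) ≡ true → A
    against u<v (inj₁ (v<u , _)) a = contradiction v<u (<-asym u<v)
    against {u} {v} u<v (inj₂ (_ , b)) a = contradiction (trans (sym a) (trans (tourn H (θ u) (θ v) distinct) (cong not b))) λ ()
      where
      distinct : θ u ≢ θ v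
      distinct e = contradiction (trans (sym b) (trans (cong (arc H (θ v)) e) (irrefl H (θ v)))) λ ()
    backward : ∀ {u v} {A : Set} → toℕ u < toℕ v → ¬ BEdge H θ u v → arc H (θ v) (θ u) ≡ true → A
    backward u<v ¬b a = contradiction (inj₂ (u<v , a)) ¬b
    edges = proj₂ (proj₂ (proj₂ (boat x)))
    ¬12 = proj₁ edges
    13ᵇ = proj₁ (proj₂ edges)
    14ᵇ = proj₁ (proj₂ (proj₂ edges))
    ¬23 = proj₁ (proj₂ (proj₂ (proj₂ edges)))
    24ᵇ = proj₁ (proj₂ (proj₂ (proj₂ (proj₂ edges))))
    ¬34 = proj₂ (proj₂ (proj₂ (proj₂ (proj₂ edges))))
    by : ∀ r s → arc H (θ (p r)) (θ (p s)) ≡ true → BoatArc r s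
    by first  first  = irreflexive
    by first  second = λ _ → arc₁₂
    by first  third  = against p₁<p₃ 13ᵇ
    by first  fourth = against (<-trans p₁<p₃ p₃<p₄) 14ᵇ
    by second first  = backward p₁<p₂ ¬12
    by second second = irreflexive
    by second third  = λ _ → arc₂₃
    by second fourth = against (<-trans p₂<p₃ p₃<p₄) 24ᵇ
    by third  first  = λ _ → arc₃₁
    by third  second = backward p₂<p₃ ¬23
    by third  third  = irreflexive
    by third  fourth = λ _ → arc₃₄
    by fourth first  = λ _ → arc₄₁
    by fourth second = λ _ → arc₄₂
    by fourth third  = backward p₃<p₄ ¬34
    by fourth fourth = irreflexive

  -- The triple of a boat is embedded into the layer indexed by its first position, its last
  -- vertex into the layer indexed by that vertex.
  layerOf : Role → Role
  layerOf first  = first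
  layerOf second = first
  layerOf third  = first
  layerOf fourth = fourth

  layer : Fin h → Fin h
  layer x = seat x (layerOf (proj₁ (role x)))

  layer-≤ : ∀ x → toℕ (layer x) ≤ toℕ x
  layer-≤ x with role x
  ... | r , e = subst (toℕ (seat x (layerOf r)) ≤_) (cong toℕ (sym e)) (below r)
    where
    below : ∀ r → toℕ (seat x (layerOf r)) ≤ toℕ (seat x r)
    below first  = ≤-refl
    below second = first≤ x second
    below third  = first≤ x third
    below fourth = ≤-refl

  -- Passing to layers only lowers positions, so the danger is that `y` drops below `x`. But `y`
  -- moves within three consecutive positions of its own boat, and `x` is none of them.
  layer-< : ∀ {x y} → seat x first ≢ seat y first → toℕ x < toℕ y → toℕ (layer x) < toℕ (layer y)
  layer-< {x} {y} ≢first x<y with role y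
  ... | r , e = ≤-<-trans (layer-≤ x) (below r (subst (λ z → toℕ x < toℕ z) e x<y))
    where
    foreign : ∀ s → x ≢ seat y s
    foreign s e′ = ≢first (trans (cong (λ z → seat z first) e′) (first-seat y s))
    below : ∀ r → toℕ x < toℕ (seat y r) → toℕ x < toℕ (seat y (layerOf r))
    below first  l = l
    below fourth l = l
    below second l = ≤∧≢⇒< (s≤s⁻¹ (subst (toℕ x <_) (seat-second y) l)) λ q → foreign first (Fin.toℕ-injective q)
    below third  l = below second (≤∧≢⇒< (subst (toℕ x ≤_) (sym (seat-second y)) (s≤s⁻¹ (subst (toℕ x <_) (seat-third y) l)))
                       λ q → foreign second (Fin.toℕ-injective q))

-- Embedding a left flotilla boat by boat.

-- Each of at most `h` placed vertices spoils a share `1 / typicality h` of a layer, altogether at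
-- most an eighth. The factor `2 * suc h` in `density` leaves at most half of a layer atypical.
typicality density depth : ℕ → ℕ
typicality h = 8 * suc h
density h    = 2 * suc h * typicality h
depth h      = layerConst h (density h) h

module Embedding {n} (T : Tournament n) (m : ℕ) (1≤m : 1 ≤ m) (U : Subset n) (a : Fin n → ℕ) (α : ℕ)
  (ih : ∀ B w → card B < card U → ¬ ¬ Chains.HasHeavyChain T (5 * m) w B)
  (below : α ^ (5 * m) < mass (λ v → a v ^ (5 * m)) U)
  (bounded : ∀ xs → Chains.Chain T xs → All (_∈ U) xs → wt a xs ≤ α)
  (2≤m : 2 ≤ m) {h} (H : Tournament h) (flotilla : LeftFlotilla H) (H-free : ¬ Contains T H)
  (deep : 12 * depth h ≤ 2 ^ m) where

  open Chains T
  open Critical T m 1≤m U a α ih below bounded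
  open Densities T μ
  open Flotilla H flotilla

  private
    L′ d : ℕ
    L′ = typicality h
    d  = depth h

  module _ (ls : Layers (density h) d h U) where

    open Layers ls

    -- Vacuous for equal layers: only the triple of a single boat shares a layer, and its arcs come
    -- from `Boats`.
    Ok : Fin h → Fin h → Fin n → Fin n → Set
    Ok i j x z = (toℕ i < toℕ j → x ⟶ z) × (toℕ j < toℕ i → z ⟶ x)

    ok? : ∀ i j x z → Dec (Ok i j x z)
    ok? i j x z = (toℕ i <? toℕ j →-dec x ⟶? z) ×-dec (toℕ j <? toℕ i →-dec z ⟶? x)

    Wrong? : ∀ i j x → Decidable λ z → z ∈ G j × ¬ Ok i j x z
    Wrong? i j x z = z ∈? G j ×-dec ¬? (ok? i j x z)

    Close : Fin h → Fin h → Fin n → Set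
    Close i j x = L′ * mass₁ ⟪ Wrong? i j x ⟫ ≤ mass₁ (G j)

    Typical? : ∀ i → Decidable λ x → x ∈ G i × (∀ j → Close i j x)
    Typical? i x = x ∈? G i ×-dec Fin.all? λ j → L′ * mass₁ ⟪ Wrong? i j x ⟫ ≤? mass₁ (G j)

    Typical : Fin h → Subset n
    Typical i = ⟪ Typical? i ⟫

    0<U : 0 < mass₁ U
    0<U = ≤-<-trans z≤n below

    0<G : ∀ i → 0 < mass₁ (G i)
    0<G i = n≢0⇒n>0 λ e → <⇒≱ 0<U (≤-trans (big i) (≤-reflexive (trans (cong (d *_) e) (*-zeroʳ d))))

    Atypical? : ∀ i j → Decidable λ x → x ∈ G i × ¬ Close i j x
    Atypical? i j x = x ∈? G i ×-dec ¬? (L′ * mass₁ ⟪ Wrong? i j x ⟫ ≤? mass₁ (G j))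

    -- Markov's inequality: on average `N x` has at most the share `1 / density h` of `G j`, whereas
    -- at an atypical `x` it exceeds `1 / typicality h`; the ratio is `2 * suc h`.
    markov : ∀ i j (N : Fin n → Subset n) → density h * mass (λ x → μ x * mass₁ (N x)) (G i) ≤ mass₁ (G i) * mass₁ (G j) →
             (∀ {x z} → z ∈ ⟪ Wrong? i j x ⟫ → z ∈ N x) → 2 * suc h * mass₁ ⟪ Atypical? i j ⟫ ≤ mass₁ (G i)
    markov i j N rare wrong = *-cancelʳ-≤ _ _ (mass₁ (G j)) {{>-nonZero (0<G j)}} (begin
      2 * suc h * mass₁ ⟪ Atypical? i j ⟫ * mass₁ (G j)                       ≡⟨ e₁ (2 * suc h) (mass₁ ⟪ Atypical? i j ⟫) (mass₁ (G j)) ⟩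
      2 * suc h * (mass₁ (G j) * mass₁ ⟪ Atypical? i j ⟫)                     ≡⟨ cong (2 * suc h *_) (mass-* (mass₁ (G j)) μ ⟪ Atypical? i j ⟫) ⟨
      2 * suc h * mass (λ x → mass₁ (G j) * μ x) ⟪ Atypical? i j ⟫            ≤⟨ *-monoʳ-≤ (2 * suc h) (mass-mono {Z′ = G i} λ {x} p → proj₁ (∈⁻ (Atypical? i j) {x} p) , bound x (proj₂ (∈⁻ (Atypical? i j) {x} p))) ⟩
      2 * suc h * mass (λ x → L′ * (μ x * mass₁ (N x))) (G i)                 ≡⟨ cong (2 * suc h *_) (mass-* L′ (λ x → μ x * mass₁ (N x)) (G i)) ⟩
      2 * suc h * (L′ * mass (λ x → μ x * mass₁ (N x)) (G i))                 ≡⟨ *-assoc (2 * suc h) L′ _ ⟨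
      density h * mass (λ x → μ x * mass₁ (N x)) (G i)                        ≤⟨ rare ⟩
      mass₁ (G i) * mass₁ (G j)                                               ∎)
      where
      open ≤-Reasoning
      e₁ : ∀ a b c → a * b * c ≡ a * (c * b)
      e₁ = solve-∀
      bound : ∀ x → ¬ Close i j x → mass₁ (G j) * μ x ≤ L′ * (μ x * mass₁ (N x))
      bound x ¬close = begin
        mass₁ (G j) * μ x                          ≤⟨ *-monoˡ-≤ (μ x) (<⇒≤ (≰⇒> ¬close)) ⟩
        L′ * mass₁ ⟪ Wrong? i j x ⟫ * μ x          ≤⟨ *-monoˡ-≤ (μ x) (*-monoʳ-≤ L′ (mass-⊆ λ {z} → wrong {x} {z})) ⟩
        L′ * mass₁ (N x) * μ x                     ≡⟨ e₁ L′ (mass₁ (N x)) (μ x) ⟩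
        L′ * (μ x * mass₁ (N x))                   ∎

    atypical-small : ∀ i j → 2 * suc h * mass₁ ⟪ Atypical? i j ⟫ ≤ mass₁ (G i)
    atypical-small i j with <-cmp (toℕ i) (toℕ j)
    ... | tri< i<j _ j≮i = markov i j (λ x → ⟪ NonOut? (G j) x ⟫) (sparse i<j) λ {x} {z} p → out x z (∈⁻ (Wrong? i j x) {z} p)
      where
      out : ∀ x z → z ∈ G j × ¬ Ok i j x z → z ∈ ⟪ NonOut? (G j) x ⟫
      out x z (z∈ , ¬ok) = ∈⁺ (NonOut? (G j) x) (z∈ , λ a → ¬ok ((λ _ → a) , λ j<i → contradiction j<i j≮i))
    ... | tri≈ i≮j _ j≮i = markov i j (λ x → ⟪ Wrong? i j x ⟫) (≤-trans (≤-reflexive none) z≤n) λ p → p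
      where
      none : density h * mass (λ x → μ x * mass₁ ⟪ Wrong? i j x ⟫) (G i) ≡ 0
      none = n≤0⇒n≡0 (≤-trans (*-monoʳ-≤ (density h) (≤-trans (≤-trans (mass-mono {w′ = λ _ → 0 * 1} {Z′ = G i} λ {x} p → p , empty x) (≤-reflexive (mass-* 0 (λ _ → 1) (G i)))) z≤n)) (≤-reflexive (*-zeroʳ (density h))))
        where
        empty : ∀ x → μ x * mass₁ ⟪ Wrong? i j x ⟫ ≤ 0
        empty x = ≤-trans (*-monoʳ-≤ (μ x) (mass-covered μ ⟪ Wrong? i j x ⟫ [] λ {z} p →
          contradiction ((λ i<j → contradiction i<j i≮j) , λ j<i → contradiction j<i j≮i) (proj₂ (∈⁻ (Wrong? i j x) {z} p)))) (≤-reflexive (*-zeroʳ (μ x)))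
    ... | tri> i≮j _ j<i = markov i j (λ x → ⟪ NonIn? (G j) x ⟫)
            (subst (λ t → density h * t ≤ mass₁ (G i) * mass₁ (G j)) (back-swap (G j) (G i)) (≤-trans (sparse j<i) (≤-reflexive (*-comm (mass₁ (G j)) (mass₁ (G i))))))
            λ {x} {z} p → into x z (∈⁻ (Wrong? i j x) {z} p)
      where
      into : ∀ x z → z ∈ G j × ¬ Ok i j x z → z ∈ ⟪ NonIn? (G j) x ⟫
      into x z (z∈ , ¬ok) = ∈⁺ (NonIn? (G j) x) (z∈ , λ a → ¬ok ((λ i<j → contradiction i<j i≮j) , λ _ → a))

    typical-half : ∀ i → mass₁ (G i) ≤ 2 * mass₁ (Typical i)
    typical-half i = arith (mass₁ (G i)) (mass₁ (Typical i)) (∑ λ j → mass₁ ⟪ Atypical? i j ⟫) split total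
      where
      open ≤-Reasoning
      Some? : Decidable λ x → ∃ λ j → x ∈ ⟪ Atypical? i j ⟫
      Some? x = Fin.any? λ j → x ∈? ⟪ Atypical? i j ⟫
      split : mass₁ (G i) ≤ mass₁ (Typical i) + ∑ λ j → mass₁ ⟪ Atypical? i j ⟫
      split = ≤-trans (mass-∪ {A = Typical i} {⟪ Some? ⟫} λ {x} → cover {x})
                (+-monoʳ-≤ _ (mass-⋃ (λ j → ⟪ Atypical? i j ⟫) λ {x} → ∈⁻ Some? {x}))
        where
        cover : ∀ {x} → x ∈ G i → x ∈ Typical i ⊎ x ∈ ⟪ Some? ⟫
        cover {x} x∈ = side (Fin.all? λ j → L′ * mass₁ ⟪ Wrong? i j x ⟫ ≤? mass₁ (G j))
          where
          side : Dec (∀ j → Close i j x) → x ∈ Typical i ⊎ x ∈ ⟪ Some? ⟫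
          side (yes p) = inj₁ (∈⁺ (Typical? i) (x∈ , p))
          side (no ¬p) with j , ¬c ← Fin.¬∀⟶∃¬ h (λ j → Close i j x) (λ j → L′ * mass₁ ⟪ Wrong? i j x ⟫ ≤? mass₁ (G j)) ¬p =
            inj₂ (∈⁺ Some? (j , ∈⁺ (Atypical? i j) (x∈ , ¬c)))
      total : 2 * suc h * ∑ (λ j → mass₁ ⟪ Atypical? i j ⟫) ≤ suc h * mass₁ (G i)
      total = begin
        2 * suc h * ∑ (λ j → mass₁ ⟪ Atypical? i j ⟫)         ≡⟨ ∑-* (2 * suc h) (λ j → mass₁ ⟪ Atypical? i j ⟫) ⟨
        ∑ (λ j → 2 * suc h * mass₁ ⟪ Atypical? i j ⟫)         ≤⟨ ∑-mono (atypical-small i) ⟩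
        ∑ {h} (λ _ → mass₁ (G i))                             ≡⟨ ∑-const h (mass₁ (G i)) ⟩
        h * mass₁ (G i)                                       ≤⟨ *-monoˡ-≤ (mass₁ (G i)) (n≤1+n h) ⟩
        suc h * mass₁ (G i)                                   ∎
      arith : ∀ g t s → g ≤ t + s → 2 * suc h * s ≤ suc h * g → g ≤ 2 * t
      arith g t s p₁ p₂ = +-cancelʳ-≤ g _ _ (begin
        g + g                  ≤⟨ +-mono-≤ p₁ p₁ ⟩
        t + s + (t + s)        ≡⟨ e t s ⟩
        2 * t + 2 * s          ≤⟨ +-monoʳ-≤ (2 * t) (*-cancelˡ-≤ (suc h) (≤-trans (≤-reflexive (e′ (suc h) s)) p₂)) ⟩
        2 * t + g              ∎)
        where
        e : ∀ t s → t + s + (t + s) ≡ 2 * t + 2 * s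
        e = solve-∀
        e′ : ∀ k s → k * (2 * s) ≡ 2 * k * s
        e′ = solve-∀

    -- Boats are placed as a whole, in the order of their first positions. Placing only typical
    -- vertices is what keeps the remaining candidates plentiful.
    record Partial (k : ℕ) : Set where
      field
        f       : Fin h → Fin n
        typical : ∀ u → toℕ (seat u first) < k → f u ∈ Typical (layer u)
        hom     : ∀ u v → toℕ (seat u first) < k → toℕ (seat v first) < k → arc H (θ u) (θ v) ≡ true → f u ⟶ f v

      Done : Fin h → Set
      Done u = toℕ (seat u first) < k

      Free? : ∀ j → Decidable λ z → z ∈ Typical j × (∀ u → Done u → Ok (layer u) j (f u) z)
      Free? j z = z ∈? Typical j ×-dec Fin.all? λ u → (toℕ (seat u first) <? k) →-dec ok? (layer u) j (f u) z

      Free : Fin h → Subset n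
      Free j = ⟪ Free? j ⟫

      Free⊆G : ∀ {j v} → v ∈ Free j → v ∈ G j
      Free⊆G {j} {v} p = proj₁ (∈⁻ (Typical? j) {v} (proj₁ (∈⁻ (Free? j) {v} p)))

      -- Half of the layer is typical and at most an eighth is spoiled by the placed vertices; the
      -- remaining three eighths exceed a third.
      free-big : ∀ j → mass₁ (G j) ≤ 3 * mass₁ (Free j)
      free-big j = arith (mass₁ (G j)) (mass₁ (Typical j)) (mass₁ (Free j)) (∑ λ u → mass₁ ⟪ Clash? u ⟫) (typical-half j) split total
        where
        open ≤-Reasoning
        Clash? : ∀ u → Decidable λ z → Done u × z ∈ ⟪ Wrong? (layer u) j (f u) ⟫
        Clash? u z = (toℕ (seat u first) <? k) ×-dec z ∈? ⟪ Wrong? (layer u) j (f u) ⟫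
        Some? : Decidable λ z → ∃ λ u → z ∈ ⟪ Clash? u ⟫
        Some? z = Fin.any? λ u → z ∈? ⟪ Clash? u ⟫
        split : mass₁ (Typical j) ≤ mass₁ (Free j) + ∑ λ u → mass₁ ⟪ Clash? u ⟫
        split = ≤-trans (mass-∪ {A = Free j} {⟪ Some? ⟫} λ {z} → cover {z})
                  (+-monoʳ-≤ _ (mass-⋃ (λ u → ⟪ Clash? u ⟫) λ {z} → ∈⁻ Some? {z}))
          where
          cover : ∀ {z} → z ∈ Typical j → z ∈ Free j ⊎ z ∈ ⟪ Some? ⟫
          cover {z} z∈ = side (Fin.all? fine?)
            where
            fine? : ∀ u → Dec (Done u → Ok (layer u) j (f u) z)
            fine? u = (toℕ (seat u first) <? k) →-dec ok? (layer u) j (f u) z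
            side : Dec (∀ u → Done u → Ok (layer u) j (f u) z) → z ∈ Free j ⊎ z ∈ ⟪ Some? ⟫
            side (yes p) = inj₁ (∈⁺ (Free? j) (z∈ , p))
            side (no ¬p) with Fin.¬∀⟶∃¬ h (λ u → Done u → Ok (layer u) j (f u) z) fine? ¬p
            ... | u , ¬fine = inj₂ (clash u (toℕ (seat u first) <? k) ¬fine)
              where
              clash : ∀ u → Dec (Done u) → ¬ (Done u → Ok (layer u) j (f u) z) → z ∈ ⟪ Some? ⟫
              clash u (yes q) ¬fine = ∈⁺ Some? (u , ∈⁺ (Clash? u) (q , ∈⁺ (Wrong? (layer u) j (f u)) (proj₁ (∈⁻ (Typical? j) {z} z∈) , λ o → ¬fine λ _ → o)))
              clash u (no ¬q) ¬fine = contradiction (λ q → contradiction q ¬q) ¬fine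
        each : ∀ u → L′ * mass₁ ⟪ Clash? u ⟫ ≤ mass₁ (G j)
        each u = by (toℕ (seat u first) <? k)
          where
          by : Dec (Done u) → L′ * mass₁ ⟪ Clash? u ⟫ ≤ mass₁ (G j)
          by (yes q) = ≤-trans (*-monoʳ-≤ L′ (mass-⊆ λ {z} p → proj₂ (∈⁻ (Clash? u) {z} p))) (proj₂ (∈⁻ (Typical? (layer u)) {f u} (typical u q)) j)
          by (no ¬q) = ≤-trans (*-monoʳ-≤ L′ (mass-covered μ ⟪ Clash? u ⟫ [] λ {z} p → contradiction (proj₁ (∈⁻ (Clash? u) {z} p)) ¬q)) (≤-trans (≤-reflexive (*-zeroʳ L′)) z≤n)
        total : L′ * ∑ (λ u → mass₁ ⟪ Clash? u ⟫) ≤ suc h * mass₁ (G j)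
        total = begin
          L′ * ∑ (λ u → mass₁ ⟪ Clash? u ⟫)         ≡⟨ ∑-* L′ (λ u → mass₁ ⟪ Clash? u ⟫) ⟨
          ∑ (λ u → L′ * mass₁ ⟪ Clash? u ⟫)         ≤⟨ ∑-mono each ⟩
          ∑ {h} (λ _ → mass₁ (G j))                 ≡⟨ ∑-const h (mass₁ (G j)) ⟩
          h * mass₁ (G j)                           ≤⟨ *-monoˡ-≤ (mass₁ (G j)) (n≤1+n h) ⟩
          suc h * mass₁ (G j)                       ∎
        arith : ∀ g t c s → g ≤ 2 * t → t ≤ c + s → L′ * s ≤ suc h * g → g ≤ 3 * c
        arith g t c s p₁ p₂ p₃ = *-cancelˡ-≤ 3 (+-cancelʳ-≤ g _ _ (begin
          3 * g + g                  ≡⟨ e₁ g ⟩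
          4 * g                      ≤⟨ *-monoʳ-≤ 4 (≤-trans p₁ (*-monoʳ-≤ 2 p₂)) ⟩
          4 * (2 * (c + s))          ≡⟨ e₂ c s ⟩
          8 * c + 8 * s              ≤⟨ +-mono-≤ (*-monoˡ-≤ c (n≤1+n 8)) (*-cancelˡ-≤ (suc h) (≤-trans (≤-reflexive (e₃ (suc h) s)) p₃)) ⟩
          9 * c + g                  ≡⟨ cong (_+ g) (*-assoc 3 3 c) ⟩
          3 * (3 * c) + g            ∎))
          where
          e₁ : ∀ g → 3 * g + g ≡ 4 * g
          e₁ = solve-∀
          e₂ : ∀ c s → 4 * (2 * (c + s)) ≡ 8 * c + 8 * s
          e₂ = solve-∀
          e₃ : ∀ k s → k * (8 * s) ≡ 8 * k * s
          e₃ = solve-∀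

      -- The 12 of `deep` is the 4 required by `Boats` times the 3 of `free-big`.
      free-huge : ∀ j → 4 * M ≤ Q * mass₁ (Free j)
      free-huge j = begin
        4 * M                              ≤⟨ *-monoʳ-≤ 4 (≤-trans (big j) (*-monoʳ-≤ d (free-big j))) ⟩
        4 * (d * (3 * mass₁ (Free j)))     ≡⟨ e d (mass₁ (Free j)) ⟩
        12 * d * mass₁ (Free j)            ≤⟨ *-monoˡ-≤ (mass₁ (Free j)) deep ⟩
        Q * mass₁ (Free j)                 ∎
        where
        open ≤-Reasoning
        e : ∀ d x → 4 * (d * (3 * x)) ≡ 12 * d * x
        e = solve-∀

    module Extend (k : ℕ) (k<h : k < h) (part : Partial k) (finish : Partial (suc k) → ⊥) where

      open Partial part

      i t : Fin h
      i = fromℕ< k<h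
      t = seat i fourth

      toℕ-i : toℕ i ≡ k
      toℕ-i = Fin.toℕ-fromℕ< k<h

      earlier : ∀ {u} → toℕ (seat u first) < suc k → seat u first ≢ i → Done u
      earlier lt ≢i = ≤∧≢⇒< (s≤s⁻¹ lt) λ e → ≢i (Fin.toℕ-injective (trans e (sym toℕ-i)))

      -- No boat starts at such a position, so there is nothing to place.
      idle : seat i first ≢ i → ⊥
      idle leaderless = finish record
        { f = f
        ; typical = λ u p → typical u (earlier p (≢i u))
        ; hom = λ u v p p′ → hom u v (earlier p (≢i u)) (earlier p′ (≢i v)) }
        where
        ≢i : ∀ u → seat u first ≢ i
        ≢i u e = leaderless (trans (cong (λ z → seat z first) (sym e)) (trans (first-seat u first) e))

      module _ (leader : seat i first ≡ i) where

        i<t : toℕ i < toℕ t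
        i<t = subst (λ z → toℕ z < toℕ t) leader (first<fourth i)

        -- A typical `v` of the later layer has at most an eighth of `G i` as out-neighbours, hence
        -- at most three eighths of `Free i`.
        few : ∀ {v} → v ∈ Free t → 2 * mass₁ ⟪ (λ x → x ∈? Free i ×-dec v ⟶? x) ⟫ ≤ mass₁ (Free i)
        few {v} v∈ = *-cancelˡ-≤ 4 (begin
          4 * (2 * mass₁ ⟪ Out? ⟫)                   ≡⟨ *-assoc 4 2 (mass₁ ⟪ Out? ⟫) ⟨
          8 * mass₁ ⟪ Out? ⟫                         ≤⟨ *-mono-≤ (*-monoʳ-≤ 8 (s≤s (z≤n {h}))) (mass-⊆ λ {x} p → wrong x (∈⁻ Out? {x} p)) ⟩
          L′ * mass₁ ⟪ Wrong? t i v ⟫                ≤⟨ proj₂ (∈⁻ (Typical? t) {v} (proj₁ (∈⁻ (Free? t) {v} v∈))) i ⟩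
          mass₁ (G i)                                ≤⟨ free-big i ⟩
          3 * mass₁ (Free i)                         ≤⟨ *-monoˡ-≤ (mass₁ (Free i)) (n≤1+n 3) ⟩
          4 * mass₁ (Free i)                         ∎)
          where
          open ≤-Reasoning
          Out? : Decidable λ x → x ∈ Free i × v ⟶ x
          Out? x = x ∈? Free i ×-dec v ⟶? x
          wrong : ∀ x → x ∈ Free i × v ⟶ x → x ∈ ⟪ Wrong? t i v ⟫
          wrong x (x∈ , a) = ∈⁺ (Wrong? t i v) (Free⊆G {i} x∈ , λ ok → ⟶-asym a (proj₂ ok i<t))

        module _ {x₁ x₂ y v} (x₁∈ : x₁ ∈ Free i) (x₂∈ : x₂ ∈ Free i) (y∈ : y ∈ Free i) (v∈ : v ∈ Free t)
                 (v⟶x₁ : v ⟶ x₁) (v⟶x₂ : v ⟶ x₂) (y⟶v : y ⟶ v) (x₁⟶x₂ : x₁ ⟶ x₂) (x₂⟶y : x₂ ⟶ y) (y⟶x₁ : y ⟶ x₁) where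

          place : Role → Fin n
          place first  = x₁
          place second = x₂
          place third  = y
          place fourth = v

          place-∈ : ∀ r → place r ∈ Free (seat i (layerOf r))
          place-∈ first  = subst (λ j → x₁ ∈ Free j) (sym leader) x₁∈
          place-∈ second = subst (λ j → x₂ ∈ Free j) (sym leader) x₂∈
          place-∈ third  = subst (λ j → y ∈ Free j) (sym leader) y∈
          place-∈ fourth = v∈

          place-arc : ∀ {r s} → BoatArc r s → place r ⟶ place s
          place-arc arc₁₂ = x₁⟶x₂
          place-arc arc₂₃ = x₂⟶y
          place-arc arc₃₁ = y⟶x₁
          place-arc arc₃₄ = y⟶v
          place-arc arc₄₁ = v⟶x₁
          place-arc arc₄₂ = v⟶x₂

          g : Fin h → Fin n
          g u with seat u first Fin.≟ i
          ... | yes _ = place (proj₁ (role u))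
          ... | no _  = f u

          new-seats : ∀ {u} → seat u first ≡ i → ∀ r → seat u r ≡ seat i r
          new-seats e = same-component (trans e (sym leader))

          new-∈ : ∀ u → seat u first ≡ i → place (proj₁ (role u)) ∈ Free (layer u)
          new-∈ u e = subst (λ j → place (proj₁ (role u)) ∈ Free j) (sym (new-seats e (layerOf (proj₁ (role u))))) (place-∈ (proj₁ (role u)))

          ok-new : ∀ {u w} → Done u → seat w first ≡ i → Ok (layer u) (layer w) (f u) (place (proj₁ (role w)))
          ok-new {u} {w} du e = proj₂ (∈⁻ (Free? (layer w)) {place (proj₁ (role w))} (new-∈ w e)) u du

          split-first : ∀ {u w} → seat u first ≢ i → seat w first ≡ i → seat u first ≢ seat w first
          split-first ≢i e e′ = ≢i (trans e′ e)

          extended : Partial (suc k)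
          extended = record { f = g ; typical = typical′ ; hom = hom′ }
            where
            typical′ : ∀ u → toℕ (seat u first) < suc k → g u ∈ Typical (layer u)
            typical′ u p with seat u first Fin.≟ i
            ... | yes e = proj₁ (∈⁻ (Free? (layer u)) {place (proj₁ (role u))} (new-∈ u e))
            ... | no ≢i = typical u (earlier p ≢i)
            hom′ : ∀ u w → toℕ (seat u first) < suc k → toℕ (seat w first) < suc k → arc H (θ u) (θ w) ≡ true → g u ⟶ g w
            hom′ u w pu pw a with seat u first Fin.≟ i | seat w first Fin.≟ i
            ... | no u≢ | no w≢ = hom u w (earlier pu u≢) (earlier pw w≢) a
            -- Arcs between different boats are forward, `layer-<` carries this over to the layers,
            -- and `Free?` then provides the arc of `T`.
            ... | no u≢ | yes ew = proj₁ (ok-new {u} {w} (earlier pu u≢) ew) (layer-< (split-first {u} {w} u≢ ew) (forward (split-first {u} {w} u≢ ew) a))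
            ... | yes eu | no w≢ = proj₂ (ok-new {w} {u} (earlier pw w≢) eu)
                  (layer-< (λ e → split-first {w} {u} w≢ eu (sym e)) (forward (λ e → split-first {w} {u} w≢ eu (sym e)) a))
            ... | yes eu | yes ew with role u | role w
            ...   | r , er | s , es = place-arc (boat-arc i r s
                    (subst₂ (λ p p′ → arc H (θ p) (θ p′) ≡ true) (trans er (new-seats eu r)) (trans es (new-seats ew s)) a))

        embed-boat : ⊥
        embed-boat = Boats.boats-unavoidable T m 1≤m U a α ih below bounded 2≤m (Free i) (Free t)
          (λ {v} p → G⊆Z {i} (Free⊆G {i} p)) (λ {v} p → G⊆Z {t} (Free⊆G {t} p)) (λ {v} p p′ → disjoint i<t (Free⊆G {i} p) (Free⊆G {t} p′))
          (free-huge i) (free-huge t) (λ {v} → few {v})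
          (λ x₁∈ x₂∈ y∈ v∈ a₁ a₂ a₃ a₄ a₅ a₆ → finish (extended x₁∈ x₂∈ y∈ v∈ a₁ a₂ a₃ a₄ a₅ a₆))

      step : ⊥
      step with seat i first Fin.≟ i
      ... | yes leader = embed-boat leader
      ... | no ¬leader = idle ¬leader

    embed-all : ∀ j k → j + k ≡ h → Partial k → ⊥
    embed-all zero    k refl part = H-free (homomorphism⇒Contains H (λ u → Partial.f part (θ⁻¹ u)) λ u v a →
      Partial.hom part (θ⁻¹ u) (θ⁻¹ v) (Fin.toℕ<n (seat (θ⁻¹ u) first)) (Fin.toℕ<n (seat (θ⁻¹ v) first))
        (subst₂ (λ p p′ → arc H p p′ ≡ true) (sym (θ∘θ⁻¹ u)) (sym (θ∘θ⁻¹ v)) a))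
    embed-all (suc j) k eq part = Extend.step k (subst (k <_) eq (m<n+m k z<s)) part (embed-all j (suc k) (trans (+-suc j k) eq))

    embedding-impossible : ⊥
    embedding-impossible = embed-all h 0 (+-identityʳ h) record
      { f = λ _ → proj₁ (inhabited μ U 0<U) ; typical = λ _ () ; hom = λ _ _ () }

  no-critical-weight : ⊥
  no-critical-weight = layers H H-free (density h) h U (≤-<-trans z≤n below)
    (λ {v} v∈ → ≤-trans (*-monoˡ-≤ (μ v) (≤-trans (m≤n*m d 12) deep)) (atom-small 2≤m v∈)) embedding-impossible

-- From heavy chains to transitive subtournaments.

n≤2^n : ∀ n → n ≤ 2 ^ n
n≤2^n zero    = z≤n
n≤2^n (suc n) = ≤-trans (+-mono-≤ (m^n>0 2 n) (n≤2^n n)) (≤-reflexive (cong (2 ^ n +_) (sym (+-identityʳ (2 ^ n)))))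

-- Weights are integers, so a chain heavier than `α` weighs at least `suc α` and is heavy; hence the
-- strict bound below and the weak one above. Fuel `M` suffices because `M ≤ M ^ suc q`.
floor-root : ∀ q M → 0 < M → ∃ λ α → α ^ suc q < M × M ≤ suc α ^ suc q
floor-root q M 0<M = search M 0 0<M (subst (λ t → M ≤ t ^ suc q) (sym (+-identityʳ M)) (≤-trans (≤-reflexive (sym (*-identityʳ M))) (*-monoʳ-≤ M (m^n>0 M {{>-nonZero 0<M}} q))))
  where
  search : ∀ fuel α → α ^ suc q < M → M ≤ (fuel + α) ^ suc q → ∃ λ α → α ^ suc q < M × M ≤ suc α ^ suc q
  search zero       α lt le = contradiction le (<⇒≱ lt)
  search (suc fuel) α lt le with M ≤? suc α ^ suc q
  ... | yes p = α , lt , p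
  ... | no ¬p = search fuel (suc α) (≰⇒> ¬p) (subst (λ t → M ≤ t ^ suc q) (sym (+-suc fuel α)) le)

any-list? : ∀ {n} k {R : List (Fin n) → Set} → Decidable R → Dec (∃ λ xs → length xs ≡ k × R xs)
any-list? zero R? with R? []
... | yes r = yes ([] , refl , r)
... | no ¬r = no λ { ([] , _ , r) → ¬r r }
any-list? (suc k) R? with Fin.any? (λ x → any-list? k λ xs → R? (x ∷ xs))
... | yes (x , xs , e , r) = yes (x ∷ xs , cong suc e , r)
... | no ¬r = no λ { (x ∷ xs , e , r) → ¬r (x , xs , suc-injective e , r) }

wt-length : ∀ {n} (xs : List (Fin n)) → wt (λ _ → 1) xs ≡ length xs
wt-length []       = refl
wt-length (x ∷ xs) = cong suc (wt-length xs)

module _ {n} (T : Tournament n) where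

  open Chains T

  lookup-arc : ∀ {xs} → Chain xs → ∀ {i j} → toℕ i < toℕ j → lookup xs i ⟶ lookup xs j
  lookup-arc (p ∷ c) {fzero}  {fsuc j} _       = All.lookup p (∈ˡ.∈-lookup j)
  lookup-arc (p ∷ c) {fsuc i} {fsuc j} (s<s l) = lookup-arc c l

  arc-lookup : ∀ {xs} → Chain xs → ∀ i j → lookup xs i ⟶ lookup xs j → toℕ i < toℕ j
  arc-lookup {xs} c i j a with <-cmp (toℕ i) (toℕ j)
  ... | tri< l _ _ = l
  ... | tri≈ _ e _ = contradiction (subst (λ z → lookup xs i ⟶ lookup xs z) (sym (Fin.toℕ-injective e)) a) ⟶-irrefl
  ... | tri> _ _ g = contradiction a (⟶-asym (lookup-arc c g))

  chain⇒transitive : ∀ xs → Chain xs → HasTransitiveSub T (length xs)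
  chain⇒transitive xs cxs = lookup xs , injective , acyclic
    where
    injective : ∀ {i j} → lookup xs i ≡ lookup xs j → i ≡ j
    injective {i} {j} e with <-cmp (toℕ i) (toℕ j)
    ... | tri< l _ _ = contradiction e (⟶-≢ (lookup-arc cxs l))
    ... | tri≈ _ r _ = Fin.toℕ-injective r
    ... | tri> _ _ g = contradiction (sym e) (⟶-≢ (lookup-arc cxs g))
    ascending : ∀ k (c : Fin (suc k) → Fin (length xs)) → (∀ i → lookup xs (c (inject₁ i)) ⟶ lookup xs (c (fsuc i))) →
                toℕ (c fzero) ≤ toℕ (c (fromℕ k))
    ascending zero    c steps = ≤-refl
    ascending (suc k) c steps = ≤-trans (<⇒≤ (arc-lookup cxs _ _ (steps fzero))) (ascending k (λ i → c (fsuc i)) (λ i → steps (fsuc i)))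
    acyclic : Acyclic λ i j → arc T (lookup xs i) (lookup xs j)
    acyclic (k , c , _ , steps , close) = <⇒≱ (arc-lookup cxs _ _ close) (ascending k c steps)

  module _ {h} (H : Tournament h) (flotilla : LeftFlotilla H) (H-free : ¬ Contains T H) (m : ℕ) (2≤m : 2 ≤ m)
           (deep : 12 * depth h ≤ 2 ^ m) where

    private
      q≡ : 5 * m ≡ suc (pred (5 * m))
      q≡ = sym (suc-pred (5 * m) {{>-nonZero (≤-trans (s≤s z≤n) (≤-trans 2≤m (m≤n*m m 5)))}})

      root : ∀ M → 0 < M → ∃ λ α → α ^ (5 * m) < M × M ≤ suc α ^ (5 * m)
      root = subst (λ q → ∀ M → 0 < M → ∃ λ α → α ^ q < M × M ≤ suc α ^ q) (sym q≡) (floor-root (pred (5 * m)))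

    -- Induction on the size of the support, for all weights at once. Without a heavy chain, the
    -- root `α` of the measure satisfies the hypotheses of `Embedding`.
    heavy-chain : ∀ k Z w → card Z < k → ¬ ¬ HasHeavyChain (5 * m) w Z
    heavy-chain (suc k) Z w (s≤s le) none with 0 <? mass (λ v → w v ^ (5 * m)) Z
    ... | no ¬pos = none ([] , [] , [] , ≤-trans (≮⇒≥ ¬pos) z≤n)
    ... | yes pos with α , below , above ← root _ pos =
      Embedding.no-critical-weight T m (≤-trans (s≤s z≤n) 2≤m) Z w α (λ B w′ lt → heavy-chain k B w′ (<-≤-trans lt le)) below
        (λ xs cxs xs⊆Z → ≮⇒≥ λ α<xs → none (xs , cxs , xs⊆Z , ≤-trans above (^-monoˡ-≤ (5 * m) α<xs)))
        2≤m H flotilla H-free deep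

    long-chain : ¬ ¬ ∃ λ xs → Chain xs × n ≤ length xs ^ (5 * m)
    long-chain none = heavy-chain (suc (card full)) full (λ _ → 1) ≤-refl λ (xs , cxs , _ , heavy) →
      none (xs , cxs , (begin
        n                                          ≡⟨ *-identityʳ n ⟨
        n * 1                                      ≡⟨ mass-full n 1 ⟨
        mass (λ _ → 1) full                        ≡⟨ mass-cong (λ _ → sym (^-zeroˡ (5 * m))) ⟩
        mass (λ _ → 1 ^ (5 * m)) full              ≤⟨ heavy ⟩
        wt (λ _ → 1) xs ^ (5 * m)                  ≡⟨ cong (_^ (5 * m)) (wt-length xs) ⟩
        length xs ^ (5 * m)                        ∎))
      where
      open ≤-Reasoning
      full : Subset n
      full _ = true

    large-transitive : ∃ λ k → HasTransitiveSub T k × n ≤ k ^ (5 * m)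
    large-transitive with 0 <? n
    ... | no ¬pos = 0 , chain⇒transitive [] [] , ≤-trans (≮⇒≥ ¬pos) z≤n
    -- Chains of length exactly `suc α` can be searched exhaustively, and longer ones can be
    -- truncated to that length; this eliminates the double negation.
    ... | yes pos with α , below , above ← root n pos with any-list? (suc α) (AllPairs.allPairs? _⟶?_)
    ...   | yes (xs , e , cxs) = suc α , subst (HasTransitiveSub T) e (chain⇒transitive xs cxs) , above
    ...   | no ¬xs = ⊥-elim (long-chain λ (xs , cxs , n≤) → ¬xs
              (take (suc α) xs , trans (length-take (suc α) xs) (m≤n⇒m⊓n≡m (≰⇒> λ le → <⇒≱ below (≤-trans n≤ (^-monoˡ-≤ (5 * m) le)))) , AllPairs.take⁺ (suc α) cxs))

theorem3 : ∀ (h : ℕ) (H : Tournament h) → LeftFlotilla H → ErdosHajnal H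
theorem3 h H flotilla = 1 , 5 * m , s≤s z≤n , ≤-trans (s≤s z≤n) (m≤n*m m 5) , λ n T H-free →
  let k , transitive , n≤k^q = large-transitive T H flotilla H-free m (s≤s (s≤s z≤n)) deep
  in k , transitive , ≤-trans (≤-reflexive (*-identityʳ n)) n≤k^q
  where
  m : ℕ
  -- The summand 2 provides `2 ≤ m`, and the rest suffices for `deep` because `m ≤ 2 ^ m`.
  m = 2 + 12 * depth h
  deep : 12 * depth h ≤ 2 ^ m
  deep = ≤-trans (m≤n+m (12 * depth h) 2) (n≤2^n m)
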